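{- There exists an absolute constant $c>0$ with the following property. Let $(\eta_R)_{R\ge 1}$ be positive real numbers with $\eta_R\to 0$ as $R\to\infty$ and such that $\mu_R\in\mathcal{H}_R(\eta_R)$ for all sufficiently large $R$. Then for all sufficiently large $R$: if there is a (possibly randomized) learning algorithm which, given $m$ labeled samples $(n_i,h^*(n_i))$, $1\le i\le m$, with $n_1,\dots,n_m$ drawn independently from a probability distribution $\mathcal D$ on $X_R'$ (unknown to the algorithm), outputs a hypothesis $\hat h:X_R'\to\{ -1,1\}$ such that, for every probability distribution $\mathcal D$ on $X_R'$, \[ \sup_{h^*\in\mathcal{H}_R(\eta_R)}\mathbb{P}\left(\operatorname{error}(\hat h)\ge\frac14\right)\le\frac13, \] then $m\ge cR$.
   Context: $\mu$ denotes the classical Möbius function: $\mu(1)=1$, $\mu(n)=0$ if $n$ is not squarefree, and $\mu(n)=(-1)^k$ if $n$ is squarefree with $k$ prime factors. For an integer $R\ge1$ let $X_R=\{1,2,\dots,R\}$ and $X_R'=\{n\le R:\mu(n)\ne0\}$, and let $\mu_R:X_R'\to\{ -1,1\}$ be the restriction of $\mu$ to $X_R'$. A function $f:X_R'\to\{ -1,1\}$ is extended to $X_R$ by setting $f(n)=0$ for $n\notin X_R'$. Its Fourier transform is $\widehat f(x)=\sum_{n=1}^R f(n)e^{ -2\pi i n x}$, $x\in[0,1]$, and its Fourier Ratio is \[ \operatorname{FR}(f)=\frac{\|\widehat f\|_{L^1([0,1])}}{\|\widehat f\|_{L^2([0,1])}}, \] with norms taken with respect to Lebesgue measure on $[0,1]$.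 For $\eta>0$, $\mathcal H_R(\eta)=\{f:X_R'\to\{ -1,1\}:\operatorname{FR}(f)\ge\eta\}$. A (possibly randomized) learning algorithm with $m$ samples is a map assigning to each element of $(X_R'\times\{ -1,1\})^m$ a probability distribution on functions $X_R'\to\{ -1,1\}$, from which the output $\hat h$ is drawn; it does not depend on $\mathcal D$ or on the target $h^*$ other than through the samples. For a target $h^*$ and distribution $\mathcal D$, $\operatorname{error}(h)=\mathbb P_{n\sim\mathcal D}(h(n)\ne h^*(n))$. The probability $\mathbb P$ in the success condition is over the random samples and the internal randomness of the algorithm. -}

module Defs where

open import Level using (0ℓ)
open import Algebra.Bundles using (CommutativeRing)
import Algebra.Definitions.RawMonoid as RawMonoidDefs
open import Axiom.ExcludedMiddle using (ExcludedMiddle)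
open import Data.Bool.Base using (if_then_else_)
open import Data.Fin.Base using (Fin)
open import Data.Fin.Properties using (any?)
open import Data.Integer.Base as ℤ using (ℤ; 0ℤ; 1ℤ; -1ℤ)
import Data.Integer.Properties as ℤ
open import Data.List.Base as List
  using (List; []; _∷_; foldr; upTo; allFin; filter; length; cartesianProductWith)
open import Data.Nat.Base as ℕ using (ℕ; zero; suc; _!)
import Data.Nat.Properties as ℕ
open import Data.Nat.Divisibility using (_∣_; _∣?_)
open import Data.Nat.Primality.Factorisation using (factorise; factors)
open import Data.Product.Base using (∃; _×_; _,_)
import Data.Sign.Base as Sign
open import Data.Sign.Base using (Sign)
open import Data.Vec.Base as Vec using (Vec; []; _∷_; lookup; tabulate)
import Relation.Binary.Construct.StrictToNonStrict as NonStrict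
open import Relation.Binary.Core using (Rel)
open import Relation.Binary.PropositionalEquality using (_≡_)
open import Relation.Binary.Structures using (IsStrictTotalOrder)
open import Relation.Nullary using (¬_; Dec; yes; no; does)
open import Relation.Nullary.Decidable using (¬?; _×-dec_)

-- ℝ, characterised up to unique isomorphism as the complete ordered field.
-- The equality is a setoid equality, so under excluded middle Cauchy sequences
-- of rationals, compared up to null sequences, form an instance.

record CompleteOrderedField : Set₁ where
  infix 4 _<_
  infix 8 _⁻¹
  field
    commutativeRing : CommutativeRing 0ℓ 0ℓ
  open CommutativeRing commutativeRing public
  field
    _<_                : Rel Carrier 0ℓ
    isStrictTotalOrder : IsStrictTotalOrder _≈_ _<_
    +-monoʳ-<          : ∀ x {y z} → y < z → x + y < x + z
    *-pos              : ∀ {x y} → 0# < x → 0# < y → 0# < x * y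
    0≉1                : ¬ (0# ≈ 1#)
    -- The value at 0 is irrelevant.
    _⁻¹                : Carrier → Carrier
    *-inverseʳ         : ∀ x → ¬ (x ≈ 0#) → x * x ⁻¹ ≈ 1#

  open NonStrict _≈_ _<_ public using (_≤_)

  UpperBound : (Carrier → Set) → Carrier → Set
  UpperBound P b = ∀ x → P x → x ≤ b

  field
    supremum : (P : Carrier → Set) → ∃ P → ∃ (UpperBound P) →
               ∃ λ s → UpperBound P s × (∀ b → UpperBound P b → s ≤ b)

Eventually : (ℕ → Set) → Set
Eventually P = ∃ λ N → ∀ n → N ℕ.≤ n → P n

-- The bound d ≤ n loses nothing for n ≥ 1 and makes the predicate decidable.
HasSquareFactor : ℕ → Set
HasSquareFactor n = ∃ λ d → d ℕ.< suc n × (2 ℕ.≤ d × d ℕ.* d ∣ n)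

hasSquareFactor? : ∀ n → Dec (HasSquareFactor n)
hasSquareFactor? n = ℕ.anyUpTo? (λ d → (2 ℕ.≤? d) ×-dec (d ℕ.* d ∣? n)) (suc n)

-- The value at 0 is irrelevant.
μ : ℕ → ℤ
μ zero      = 0ℤ
μ n@(suc _) = if does (hasSquareFactor? n)
              then 0ℤ
              else -1ℤ ℤ.^ length (factors (factorise n))

X : ℕ → List ℕ
X R = List.map suc (upTo R)

-- X′ R is an index type for the list of the n ≤ R with μ n ≠ 0, and elt
-- returns the integer that an index stands for.
X′-list : ℕ → List ℕ
X′-list R = filter (λ n → ¬? (μ n ℤ.≟ 0ℤ)) (X R)

∣X′∣ : ℕ → ℕ
∣X′∣ R = length (X′-list R)

X′ : ℕ → Set
X′ R = Fin (∣X′∣ R)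

elt : ∀ R → X′ R → ℕ
elt R = List.lookup (X′-list R)

-- Functions X′ R → {-1 , 1}, stored as tables so that they can be enumerated
-- without function extensionality; f at i is lookup f i.
Func : ℕ → Set
Func R = Vec Sign (∣X′∣ R)

μ-restricted : ∀ R → Func R
μ-restricted R = tabulate (λ i → ℤ.sign (μ (elt R i)))

allVecs : ∀ {A : Set} → List A → ∀ n → List (Vec A n)
allVecs xs zero    = [] ∷ []
allVecs xs (suc n) = cartesianProductWith _∷_ xs (allVecs xs n)

allFuncs : ∀ R → List (Func R)
allFuncs R = allVecs (Sign.- ∷ Sign.+ ∷ []) (∣X′∣ R)

module Analysis (em : ExcludedMiddle 0ℓ) (𝓡 : CompleteOrderedField) where

  open CompleteOrderedField 𝓡 renaming (Carrier to ℝ)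
  open RawMonoidDefs +-rawMonoid using () renaming (_×_ to _·_)

  fromℕ : ℕ → ℝ
  fromℕ n = n · 1#

  ∑ : ∀ {A : Set} → List A → (A → ℝ) → ℝ
  ∑ xs f = foldr (λ x s → f x + s) 0# xs

  ∑-syntax = ∑
  infix 5 ∑-syntax
  syntax ∑-syntax xs (λ x → e) = ∑[ x ∈ xs ] e

  𝟙 : Set → ℝ
  𝟙 P = if does (em {P}) then 1# else 0#

  -- Definite description, with junk value 0 if P has no solution; used only for
  -- P that determine their solution up to ≈.
  the : (ℝ → Set) → ℝ
  the P with em {∃ P}
  ... | yes (x , _) = x
  ... | no _        = 0#

  sqrt : ℝ → ℝ
  sqrt x = the λ y → 0# ≤ y × y * y ≈ x

  Within : ℝ → ℝ → ℝ → Set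
  Within ε x y = (x - y < ε) × (y - x < ε)

  _⟶_ : (ℕ → ℝ) → ℝ → Set
  u ⟶ l = ∀ ε → 0# < ε → Eventually λ n → Within ε (u n) l

  lim : (ℕ → ℝ) → ℝ
  lim u = the (u ⟶_)

  -- Riemann integral over [0 , 1].  It is applied below only to continuous
  -- functions, for which it agrees with the Lebesgue integral.

  -- Only pt 0 , … , pt size and tag 0 , … , tag (size ∸ 1) are used.
  record TaggedPartition : Set where
    field
      size    : ℕ
      pt tag  : ℕ → ℝ
      pt-0    : pt 0 ≈ 0#
      pt-size : pt size ≈ 1#
      pt≤tag  : ∀ i → i ℕ.< size → pt i ≤ tag i
      tag≤pt  : ∀ i → i ℕ.< size → tag i ≤ pt (suc i)

  open TaggedPartition

  MeshBelow : ℝ → TaggedPartition → Set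
  MeshBelow δ Q = ∀ i → i ℕ.< size Q → pt Q (suc i) - pt Q i < δ

  riemannSum : (ℝ → ℝ) → TaggedPartition → ℝ
  riemannSum g Q = ∑[ i ∈ upTo (size Q) ] (g (tag Q i) * (pt Q (suc i) - pt Q i))

  HasIntegral : (ℝ → ℝ) → ℝ → Set
  HasIntegral g I = ∀ ε → 0# < ε → ∃ λ δ → 0# < δ ×
    (∀ Q → MeshBelow δ Q → Within ε (riemannSum g Q) I)

  ∫ : (ℝ → ℝ) → ℝ
  ∫ g = the (HasIntegral g)

  infix 6 _+i_
  record ℂ : Set where
    constructor _+i_
    field
      re im : ℝ

  open ℂ

  _*ℂ_ : ℂ → ℂ → ℂ
  (a +i b) *ℂ (c +i d) = (a * c - b * d) +i (a * d + b * c)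

  _^ℂ_ : ℂ → ℕ → ℂ
  z ^ℂ zero  = 1# +i 0#
  z ^ℂ suc k = z *ℂ (z ^ℂ k)

  ∣_∣ℂ : ℂ → ℝ
  ∣ a +i b ∣ℂ = sqrt (a * a + b * b)

  -- exp z = ∑ z ^ k / k!, with the limit taken componentwise.
  exp : ℂ → ℂ
  exp z = lim (λ n → ∑[ k ∈ upTo n ] (fromℕ (k !) ⁻¹ * re (z ^ℂ k)))
       +i lim (λ n → ∑[ k ∈ upTo n ] (fromℕ (k !) ⁻¹ * im (z ^ℂ k)))

  sin : ℝ → ℝ
  sin θ = im (exp (0# +i θ))

  -- The least positive zero of sin.
  π : ℝ
  π = the λ p → 0# < p × sin p ≈ 0# × (∀ q → 0# < q → q < p → ¬ (sin q ≈ 0#))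

  signValue : Sign → ℝ
  signValue Sign.+ = 1#
  signValue Sign.- = - 1#

  extend : ∀ R → Func R → ℕ → ℝ
  extend R f n with any? (λ i → elt R i ℕ.≟ n)
  ... | yes (i , _) = signValue (lookup f i)
  ... | no _        = 0#

  fourier : ∀ R → Func R → ℝ → ℂ
  fourier R f x = (∑[ n ∈ X R ] (extend R f n * re (e n)))
               +i (∑[ n ∈ X R ] (extend R f n * im (e n)))
    where
    e : ℕ → ℂ
    e n = exp (0# +i (- (fromℕ 2 * π * fromℕ n * x)))

  ‖_‖₁ : (ℝ → ℂ) → ℝ
  ‖ g ‖₁ = ∫ λ x → ∣ g x ∣ℂ

  ‖_‖₂ : (ℝ → ℂ) → ℝ
  ‖ g ‖₂ = sqrt (∫ λ x → ∣ g x ∣ℂ * ∣ g x ∣ℂ)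

  FR : ∀ R → Func R → ℝ
  FR R f = ‖ fourier R f ‖₁ * ‖ fourier R f ‖₂ ⁻¹

  𝓗 : ∀ R → ℝ → Func R → Set
  𝓗 R η f = η ≤ FR R f

  -- Probability distributions on a finite type enumerated, without
  -- repetition, by xs.
  record Distribution {A : Set} (xs : List A) : Set where
    field
      prob        : A → ℝ
      prob-nonNeg : ∀ a → 0# ≤ prob a
      prob-total  : ∑ xs prob ≈ 1#

  open Distribution

  DistributionOnX′ : ℕ → Set
  DistributionOnX′ R = Distribution (allFin (∣X′∣ R))

  Algorithm : ℕ → ℕ → Set
  Algorithm R m = Vec (X′ R × Sign) m → Distribution (allFuncs R)

  error : ∀ R → DistributionOnX′ R → Func R → Func R → ℝ
  error R 𝓓 h* h =
    ∑[ n ∈ allFin (∣X′∣ R) ] (prob 𝓓 n * 𝟙 (¬ (lookup h n ≡ lookup h* n)))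

  sampleProb : ∀ R m → DistributionOnX′ R → Vec (X′ R) m → ℝ
  sampleProb R m 𝓓 ns = Vec.foldr (λ _ → ℝ) (λ n p → prob 𝓓 n * p) 1# ns

  labelled : ∀ R m → Func R → Vec (X′ R) m → Vec (X′ R × Sign) m
  labelled R m h* = Vec.map (λ n → n , lookup h* n)

  failureProb : ∀ R m → Algorithm R m → DistributionOnX′ R → Func R → ℝ
  failureProb R m 𝓐 𝓓 h* =
    ∑[ ns ∈ allVecs (allFin (∣X′∣ R)) m ]
      (sampleProb R m 𝓓 ns *
        (∑[ h ∈ allFuncs R ]
          (prob (𝓐 (labelled R m h* ns)) h * 𝟙 (fromℕ 4 ⁻¹ ≤ error R 𝓓 h* h))))

  -- The supremum over 𝓗 R η of the failure probability is at most 1/3.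
  SucceedsOn : ∀ R m → Algorithm R m → DistributionOnX′ R → ℝ → Set
  SucceedsOn R m 𝓐 𝓓 η = ∀ (h* : Func R) → 𝓗 R η h* →
    failureProb R m 𝓐 𝓓 h* ≤ fromℕ 3 ⁻¹

{-# OPTIONS --safe #-}
module Submission where

-- For a uniformly random sign function f, every value f̂ x is a sum of independent signs
-- with unimodular coefficients, so E ∣f̂ x∣² = n and E ∣f̂ x∣⁴ ≤ 6 n², where n = ∣X′∣ R.
-- With r = ‖f̂‖₂, an interpolation inequality bounds r⁴ by a small multiple of
-- ‖f̂‖₄⁴ unless ‖f̂‖₁ ≥ r / 8; averaging over f, at least one sign function in twelve
-- has Fourier Ratio at least 1/8, and hence belongs to 𝓗 R (η R) once η R ≤ 1/8.
-- Neither Parseval's identity nor any property of π is needed.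
--
-- Under the uniform distribution, a hypothesis with error below 1/4 has correlation at
-- least n / 4 with f off the sample if 4 m ≤ n.  Given the sample, the signs of f
-- outside it are still independent, so by Chebyshev the success probability averaged
-- over f is at most 16 / n.  As it is at least 2/3 on a twelfth of all f, n ≤ 288.
-- Since n ≥ R / 4, for large R this forces 4 m > n ≥ R / 4.

open import Level using (0ℓ)
import Algebra.Construct.NaturalChoice.Min as Min
import Algebra.Properties.Ring as RingProperties
import Algebra.Properties.Semiring.Exp as SemiringExp
import Algebra.Properties.Semiring.Mult as SemiringMult
import Algebra.Solver.Ring as RingSolver
open import Algebra.Solver.Ring.AlmostCommutativeRing
  using (fromCommutativeRing; _-Raw-AlmostCommutative⟶_)
open import Axiom.ExcludedMiddle using (ExcludedMiddle)
open import Data.Bool.Base using (if_then_else_)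
open import Data.Fin.Base as Fin using (Fin)
import Data.Fin.Properties as Fin
import Data.Integer.Base as ℤ
import Data.Integer.Properties as ℤ
open import Data.List.Base as List
  using (List; []; _∷_; _++_; allFin; applyUpTo; cartesianProductWith; filter; length; map; upTo)
open import Data.List.Membership.Propositional.Properties using (∈-lookup)
open import Data.List.Properties
  using (filter-++; length-++; length-map; length-tabulate; length-upTo; map-++; tabulate-lookup; upTo-∷ʳ)
import Data.List.Relation.Unary.All as All
open import Data.List.Relation.Unary.All.Properties using (all-filter)
open import Data.List.Relation.Unary.AllPairs using (_∷_)
open import Data.List.Relation.Unary.Unique.Propositional using (Unique)
import Data.List.Relation.Unary.Unique.Propositional.Properties as Unique
open import Data.Maybe.Base using (Maybe; just; nothing)
open import Data.Nat.Base as ℕ using (ℕ; zero; suc; _!)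
import Data.Nat.Properties as ℕ
open import Data.Product.Base using (∃; _×_; _,_; proj₁; proj₂)
import Data.Sign.Base as Sign
open import Data.Sign.Base using (Sign)
import Data.Sign.Properties as Sign
open import Data.Sum.Base using (_⊎_; inj₁; inj₂)
open import Data.Vec.Base as Vec using (Vec; []; _∷_; lookup; _[_]≔_)
open import Data.Vec.Properties using (lookup∘update′)
open import Function.Base using (_∘_; id)
open import Relation.Binary.Bundles using (StrictTotalOrder; TotalOrder)
import Relation.Binary.Construct.StrictToNonStrict as NonStrict
open import Relation.Binary.Definitions using (tri<; tri≈; tri>)
open import Relation.Binary.PropositionalEquality as ≡ using (_≡_; _≢_)
import Relation.Binary.Reasoning.StrictPartialOrder as StrictPartialOrderReasoning
open import Relation.Nullary using (¬_; Dec; does; yes; no; contradiction)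
open import Relation.Nullary.Decidable using (¬?)
open import Relation.Unary using (Decidable)
open import Defs

-- Once `η R` is at most 1/8, the class holds a fixed fraction of all sign functions, so learning it
-- is, up to a constant factor, as hard as learning an arbitrary one. Bounding an L¹ norm from below
-- by the L² norm needs control of some higher norm; the fourth is chosen because its average over
-- signs expands algebraically.
--
-- `sqrt`, `lim` and `∫` are definite descriptions with a junk value, so nothing can be said about
-- the Fourier Ratio before the exponential series is shown to converge and ∣f̂∣ and its powers to
-- be integrable. Two properties of the exponential enter: ∣exp(iθ)∣ = 1 and Lipschitz continuity on
-- bounded intervals. Both rest on one second-order estimate of the partial sums, and integrability
-- is derived from the Lipschitz condition.
--
-- The learner's hypothesis depends on f through the labels. The sums are therefore exchanged so
-- that the hypothesis h is fixed first; the probability of outputting h is then a weight on f that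
-- does not see the signs outside the sample.

-- Arithmetic of the ordered field, with a ring solver over integer coefficients

module OrderedField (𝓡 : CompleteOrderedField) where

  open import Data.Integer.Base using (ℤ; +_; -[1+_]; _⊖_)
  open CompleteOrderedField 𝓡 renaming (Carrier to ℝ) public
  open RingProperties ring public
    using (-‿distribˡ-*; -‿distribʳ-*; -‿involutive; -‿+-comm; -0#≈0#)
  open SemiringMult semiring public
    using (×-homo-+; ×1-homo-*) renaming (_×_ to _·_)

  strictTotalOrder : StrictTotalOrder 0ℓ 0ℓ 0ℓ
  strictTotalOrder = record { isStrictTotalOrder = isStrictTotalOrder }

  totalOrder : TotalOrder 0ℓ 0ℓ 0ℓ
  totalOrder = record { isTotalOrder = NonStrict.isTotalOrder _≈_ _<_ isStrictTotalOrder }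

  module < = StrictTotalOrder strictTotalOrder

  open StrictPartialOrderReasoning <.strictPartialOrder public

  -- Agrees with fromℕ up to ≈, but nat 1 is 1# itself, so that the ring solver
  -- below treats the numerals 0 and 1 as the constants of the ring.
  nat : ℕ → ℝ
  nat zero          = 0#
  nat (suc zero)    = 1#
  nat (suc (suc n)) = 1# + nat (suc n)

  nat≈·1 : ∀ n → nat n ≈ n · 1#
  nat≈·1 zero          = refl
  nat≈·1 (suc zero)    = sym (+-identityʳ 1#)
  nat≈·1 (suc (suc n)) = +-congˡ (nat≈·1 (suc n))

  nat-suc : ∀ n → nat (suc n) ≈ 1# + nat n
  nat-suc zero    = sym (+-identityʳ 1#)
  nat-suc (suc n) = refl

  nat-+ : ∀ m n → nat (m ℕ.+ n) ≈ nat m + nat n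
  nat-+ m n = trans (nat≈·1 (m ℕ.+ n)) (trans (×-homo-+ 1# m n)
    (+-cong (sym (nat≈·1 m)) (sym (nat≈·1 n))))

  nat-* : ∀ m n → nat (m ℕ.* n) ≈ nat m * nat n
  nat-* m n = trans (nat≈·1 (m ℕ.* n)) (trans (×1-homo-* m n)
    (*-cong (sym (nat≈·1 m)) (sym (nat≈·1 n))))

  private

    int : ℤ → ℝ
    int (+ n)    = nat n
    int -[1+ n ] = - nat (suc n)

    int-⊖ : ∀ m n → int (m ⊖ n) ≈ nat m - nat n
    int-⊖ m zero rewrite ℤ.⊖-≥ {m} {0} ℕ.z≤n =
      sym (trans (+-congˡ -0#≈0#) (+-identityʳ _))
    int-⊖ zero (suc n) = sym (+-identityˡ _)
    int-⊖ (suc m) (suc n) rewrite ℤ.[1+m]⊖[1+n]≡m⊖n m n = begin-equality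
      int (m ⊖ n)                        ≈⟨ int-⊖ m n ⟩
      nat m - nat n                      ≈⟨ +-congˡ (+-identityˡ _) ⟨
      nat m + (0# - nat n)               ≈⟨ +-congˡ (+-congʳ (-‿inverseʳ 1#)) ⟨
      nat m + (1# - 1# - nat n)          ≈⟨ +-congˡ (+-assoc _ _ _) ⟩
      nat m + (1# + (- 1# - nat n))      ≈⟨ +-assoc _ _ _ ⟨
      nat m + 1# + (- 1# - nat n)        ≈⟨ +-cong (+-comm _ _) (-‿+-comm _ _) ⟩
      1# + nat m - (1# + nat n)          ≈⟨ +-cong (nat-suc m) (-‿cong (nat-suc n)) ⟨
      nat (suc m) - nat (suc n)          ∎

    int-+ : ∀ i j → int (i ℤ.+ j) ≈ int i + int j
    int-+ (+ m)    (+ n)    = nat-+ m n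
    int-+ (+ m)    -[1+ n ] = int-⊖ m (suc n)
    int-+ -[1+ m ] (+ n)    = trans (int-⊖ n (suc m)) (+-comm _ _)
    int-+ -[1+ m ] -[1+ n ] = begin-equality
      - nat (suc (suc (m ℕ.+ n)))        ≡⟨ ≡.cong (λ k → - nat (suc k)) (ℕ.+-suc m n) ⟨
      - nat (suc m ℕ.+ suc n)            ≈⟨ -‿cong (nat-+ (suc m) (suc n)) ⟩
      - (nat (suc m) + nat (suc n))      ≈⟨ -‿+-comm _ _ ⟨
      - nat (suc m) - nat (suc n)        ∎

    int-◃⁺ : ∀ n → int (Sign.+ ℤ.◃ n) ≈ nat n
    int-◃⁺ zero    = refl
    int-◃⁺ (suc n) = refl

    int-◃⁻ : ∀ n → int (Sign.- ℤ.◃ n) ≈ - nat n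
    int-◃⁻ zero    = sym -0#≈0#
    int-◃⁻ (suc n) = refl

    int-* : ∀ i j → int (i ℤ.* j) ≈ int i * int j
    int-* (+ m)    (+ n)    = trans (int-◃⁺ (m ℕ.* n)) (nat-* m n)
    int-* (+ m)    -[1+ n ] = trans (int-◃⁻ (m ℕ.* suc n))
      (trans (-‿cong (nat-* m (suc n))) (-‿distribʳ-* _ _))
    int-* -[1+ m ] (+ n)    = trans (int-◃⁻ (suc m ℕ.* n))
      (trans (-‿cong (nat-* (suc m) n)) (-‿distribˡ-* _ _))
    int-* -[1+ m ] -[1+ n ] = begin-equality
      int (Sign.+ ℤ.◃ suc m ℕ.* suc n)   ≈⟨ int-◃⁺ (suc m ℕ.* suc n) ⟩
      nat (suc m ℕ.* suc n)              ≈⟨ nat-* (suc m) (suc n) ⟩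
      nat (suc m) * nat (suc n)          ≈⟨ -‿involutive _ ⟨
      - - (nat (suc m) * nat (suc n))    ≈⟨ -‿cong (-‿distribʳ-* _ _) ⟩
      - (nat (suc m) * - nat (suc n))    ≈⟨ -‿distribˡ-* _ _ ⟩
      - nat (suc m) * - nat (suc n)      ∎

    int-neg : ∀ i → int (ℤ.- i) ≈ - int i
    int-neg (+ zero)  = sym -0#≈0#
    int-neg (+ suc n) = refl
    int-neg -[1+ n ]  = sym (-‿involutive _)

    -- Coefficients are integers, whose equality is decidable, so the solver can evaluate numerals
    -- such as 144. As `con (+ k)` denotes `nat k` by definition, the solved identities fit goals
    -- written with `nat`.
    int-morphism : ℤ.+-*-rawRing -Raw-AlmostCommutative⟶ fromCommutativeRing commutativeRing
    int-morphism = record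
      { ⟦_⟧    = int
      ; +-homo = int-+
      ; *-homo = int-*
      ; -‿homo = int-neg
      ; 0-homo = refl
      ; 1-homo = refl
      }

    int-≟ : ∀ i j → Maybe (int i ≈ int j)
    int-≟ i j with i ℤ.≟ j
    ... | yes ≡.refl = just refl
    ... | no _       = nothing

  open RingSolver ℤ.+-*-rawRing (fromCommutativeRing commutativeRing) int-morphism int-≟ public
    using (solve; Polynomial; con; _:=_; _:+_; _:*_; _:-_; :-_)

  :0 :1 :2 :3 :4 : ∀ {n} → Polynomial n
  :0 = con (+ 0)
  :1 = con (+ 1)
  :2 = con (+ 2)
  :3 = con (+ 3)
  :4 = con (+ 4)

  ≤-refl : ∀ {x} → x ≤ x
  ≤-refl = inj₂ refl

  ≤-reflexive : ∀ {x y} → x ≈ y → x ≤ y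
  ≤-reflexive = inj₂

  <⇒≤ : ∀ {x y} → x < y → x ≤ y
  <⇒≤ = inj₁

  ≤-trans : ∀ {x y z} → x ≤ y → y ≤ z → x ≤ z
  ≤-trans = NonStrict.trans _≈_ _<_ isEquivalence <.<-resp-≈ <.trans

  ≤-antisym : ∀ {x y} → x ≤ y → y ≤ x → x ≈ y
  ≤-antisym = NonStrict.antisym _≈_ _<_ isEquivalence <.trans <.irrefl

  ≤-total : ∀ x y → x ≤ y ⊎ y ≤ x
  ≤-total = NonStrict.total _≈_ _<_ <.compare

  ≤-<-connex : ∀ x y → x ≤ y ⊎ y < x
  ≤-<-connex x y with <.compare x y
  ... | tri< x<y _ _ = inj₁ (inj₁ x<y)
  ... | tri≈ _ x≈y _ = inj₁ (inj₂ x≈y)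
  ... | tri> _ _ y<x = inj₂ y<x

  <-≤-trans : ∀ {x y z} → x < y → y ≤ z → x < z
  <-≤-trans = NonStrict.<-≤-trans _≈_ _<_ <.trans <.<-respʳ-≈

  ≤-<-trans : ∀ {x y z} → x ≤ y → y < z → x < z
  ≤-<-trans = NonStrict.≤-<-trans _≈_ _<_ sym <.trans <.<-respˡ-≈

  <⇒≱ : ∀ {x y} → x < y → ¬ (y ≤ x)
  <⇒≱ x<y y≤x = <.irrefl refl (<-≤-trans x<y y≤x)

  ≮⇒≥ : ∀ {x y} → ¬ (x < y) → y ≤ x
  ≮⇒≥ {x} {y} x≮y with ≤-<-connex y x
  ... | inj₁ y≤x = y≤x
  ... | inj₂ x<y = contradiction x<y x≮y

  ≰⇒> : ∀ {x y} → ¬ (x ≤ y) → y < x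
  ≰⇒> {x} {y} x≰y with ≤-<-connex x y
  ... | inj₁ x≤y = contradiction x≤y x≰y
  ... | inj₂ y<x = y<x

  +-monoʳ-≤ : ∀ x {y z} → y ≤ z → x + y ≤ x + z
  +-monoʳ-≤ x (inj₁ y<z) = inj₁ (+-monoʳ-< x y<z)
  +-monoʳ-≤ x (inj₂ y≈z) = inj₂ (+-congˡ y≈z)

  +-monoˡ-≤ : ∀ x {y z} → y ≤ z → y + x ≤ z + x
  +-monoˡ-≤ x {y} {z} y≤z = begin
    y + x ≈⟨ +-comm y x ⟩
    x + y ≤⟨ +-monoʳ-≤ x y≤z ⟩
    x + z ≈⟨ +-comm x z ⟩
    z + x ∎

  +-mono-≤ : ∀ {x y u v} → x ≤ y → u ≤ v → x + u ≤ y + v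
  +-mono-≤ {x} {y} {u} {v} x≤y u≤v = ≤-trans (+-monoˡ-≤ u x≤y) (+-monoʳ-≤ y u≤v)

  +-mono-<-≤ : ∀ {x y u v} → x < y → u ≤ v → x + u < y + v
  +-mono-<-≤ {x} {y} {u} {v} x<y u≤v = begin-strict
    x + u ≈⟨ +-comm x u ⟩
    u + x <⟨ +-monoʳ-< u x<y ⟩
    u + y ≤⟨ +-monoˡ-≤ y u≤v ⟩
    v + y ≈⟨ +-comm v y ⟩
    y + v ∎

  0≤y-x⇒x≤y : ∀ {x y} → 0# ≤ y - x → x ≤ y
  0≤y-x⇒x≤y {x} {y} h = begin
    x            ≈⟨ +-identityʳ x ⟨
    x + 0#       ≤⟨ +-monoʳ-≤ x h ⟩
    x + (y - x)  ≈⟨ solve 2 (λ x y → x :+ (y :- x) := y) refl x y ⟩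
    y            ∎

  x≤y⇒0≤y-x : ∀ {x y} → x ≤ y → 0# ≤ y - x
  x≤y⇒0≤y-x {x} {y} h = begin
    0#     ≈⟨ -‿inverseʳ x ⟨
    x - x  ≤⟨ +-monoˡ-≤ (- x) h ⟩
    y - x  ∎

  0<y-x⇒x<y : ∀ {x y} → 0# < y - x → x < y
  0<y-x⇒x<y {x} {y} h = begin-strict
    x            ≈⟨ +-identityʳ x ⟨
    x + 0#       <⟨ +-monoʳ-< x h ⟩
    x + (y - x)  ≈⟨ solve 2 (λ x y → x :+ (y :- x) := y) refl x y ⟩
    y            ∎

  x<y⇒0<y-x : ∀ {x y} → x < y → 0# < y - x
  x<y⇒0<y-x {x} {y} h = begin-strict
    0#     ≈⟨ -‿inverseʳ x ⟨
    x - x  <⟨ +-mono-<-≤ h ≤-refl ⟩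
    y - x  ∎

  -- The usual way to prove an inequality here: write the difference as a visibly nonnegative
  -- expression `e` and leave the identity to the ring solver.
  ≤-by : ∀ {x y e} → 0# ≤ e → y - x ≈ e → x ≤ y
  ≤-by 0≤e eq = 0≤y-x⇒x≤y (≤-trans 0≤e (≤-reflexive (sym eq)))

  <-by : ∀ {x y e} → 0# < e → y - x ≈ e → x < y
  <-by 0<e eq = 0<y-x⇒x<y (<-≤-trans 0<e (≤-reflexive (sym eq)))

  -‿anti-≤ : ∀ {x y} → x ≤ y → - y ≤ - x
  -‿anti-≤ {x} {y} h = ≤-by (x≤y⇒0≤y-x h)
    (solve 2 (λ x y → :- x :- :- y := y :- x) refl x y)

  +-nonNeg : ∀ {x y} → 0# ≤ x → 0# ≤ y → 0# ≤ x + y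
  +-nonNeg {x} {y} hx hy = ≤-trans (≤-reflexive (sym (+-identityʳ 0#))) (+-mono-≤ hx hy)

  *-nonNeg : ∀ {x y} → 0# ≤ x → 0# ≤ y → 0# ≤ x * y
  *-nonNeg (inj₁ hx) (inj₁ hy) = inj₁ (*-pos hx hy)
  *-nonNeg (inj₁ hx) (inj₂ hy) = inj₂ (sym (trans (*-congˡ (sym hy)) (zeroʳ _)))
  *-nonNeg (inj₂ hx) hy        = inj₂ (sym (trans (*-congʳ (sym hx)) (zeroˡ _)))

  +-pos-nonNeg : ∀ {x y} → 0# < x → 0# ≤ y → 0# < x + y
  +-pos-nonNeg hx hy = ≤-<-trans (≤-reflexive (sym (+-identityʳ 0#))) (+-mono-<-≤ hx hy)

  *-monoˡ-≤ : ∀ {z x y} → 0# ≤ z → x ≤ y → z * x ≤ z * y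
  *-monoˡ-≤ {z} {x} {y} hz h = ≤-by (*-nonNeg hz (x≤y⇒0≤y-x h))
    (solve 3 (λ x y z → z :* y :- z :* x := z :* (y :- x)) refl x y z)

  *-monoʳ-≤ : ∀ {z x y} → 0# ≤ z → x ≤ y → x * z ≤ y * z
  *-monoʳ-≤ {z} {x} {y} hz h = ≤-by (*-nonNeg hz (x≤y⇒0≤y-x h))
    (solve 3 (λ x y z → y :* z :- x :* z := z :* (y :- x)) refl x y z)

  *-mono-≤ : ∀ {x y u v} → 0# ≤ u → 0# ≤ y → x ≤ y → u ≤ v → x * u ≤ y * v
  *-mono-≤ 0≤u 0≤y x≤y u≤v = ≤-trans (*-monoʳ-≤ 0≤u x≤y) (*-monoˡ-≤ 0≤y u≤v)

  *-monoˡ-< : ∀ {z x y} → 0# < z → x < y → z * x < z * y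
  *-monoˡ-< {z} {x} {y} hz h = <-by (*-pos hz (x<y⇒0<y-x h))
    (solve 3 (λ x y z → z :* y :- z :* x := z :* (y :- x)) refl x y z)

  *-cancelˡ-≤ : ∀ {z x y} → 0# < z → z * x ≤ z * y → x ≤ y
  *-cancelˡ-≤ 0<z h = ≮⇒≥ λ y<x → <⇒≱ (*-monoˡ-< 0<z y<x) h

  *-cancelˡ-< : ∀ {z x y} → 0# ≤ z → z * x < z * y → x < y
  *-cancelˡ-< 0≤z h = ≰⇒> λ y≤x → <⇒≱ h (*-monoˡ-≤ 0≤z y≤x)

  square-nonNeg : ∀ x → 0# ≤ x * x
  square-nonNeg x with ≤-total 0# x
  ... | inj₁ 0≤x = *-nonNeg 0≤x 0≤x
  ... | inj₂ x≤0 = ≤-trans (*-nonNeg 0≤-x 0≤-x)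
    (≤-reflexive (solve 1 (λ x → :- x :* :- x := x :* x) refl x))
    where
    0≤-x : 0# ≤ - x
    0≤-x = ≤-trans (≤-reflexive (sym -0#≈0#)) (-‿anti-≤ x≤0)

  0<1 : 0# < 1#
  0<1 with square-nonNeg 1#
  ... | inj₁ h = <-≤-trans h (≤-reflexive (*-identityʳ 1#))
  ... | inj₂ h = contradiction (trans h (*-identityʳ 1#)) 0≉1

  0≤1 : 0# ≤ 1#
  0≤1 = <⇒≤ 0<1

  nat-nonNeg : ∀ n → 0# ≤ nat n
  nat-nonNeg zero    = ≤-refl
  nat-nonNeg (suc n) = ≤-trans (+-nonNeg 0≤1 (nat-nonNeg n)) (≤-reflexive (sym (nat-suc n)))

  nat-pos : ∀ n → 0# < nat (suc n)
  nat-pos n = <-≤-trans (+-pos-nonNeg 0<1 (nat-nonNeg n)) (≤-reflexive (sym (nat-suc n)))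

  nat-mono-≤ : ∀ {m n} → m ℕ.≤ n → nat m ≤ nat n
  nat-mono-≤ {m} {n} m≤n = begin
    nat m                  ≈⟨ +-identityʳ _ ⟨
    nat m + 0#             ≤⟨ +-monoʳ-≤ _ (nat-nonNeg (n ℕ.∸ m)) ⟩
    nat m + nat (n ℕ.∸ m)  ≈⟨ nat-+ m (n ℕ.∸ m) ⟨
    nat (m ℕ.+ (n ℕ.∸ m))  ≡⟨ ≡.cong nat (ℕ.m+[n∸m]≡n m≤n) ⟩
    nat n                  ∎

  pos⇒≉0 : ∀ {x} → 0# < x → ¬ (x ≈ 0#)
  pos⇒≉0 0<x x≈0 = <.irrefl (sym x≈0) 0<x

  *-inverse : ∀ {x} → 0# < x → x * x ⁻¹ ≈ 1#
  *-inverse 0<x = *-inverseʳ _ (pos⇒≉0 0<x)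

  ⁻¹-pos : ∀ {x} → 0# < x → 0# < x ⁻¹
  ⁻¹-pos {x} 0<x = *-cancelˡ-< (<⇒≤ 0<x) (begin-strict
    x * 0#    ≈⟨ zeroʳ x ⟩
    0#        <⟨ 0<1 ⟩
    1#        ≈⟨ *-inverse 0<x ⟨
    x * x ⁻¹  ∎)

  -- The axioms do not say that `_⁻¹` respects `_≈_`; for positive arguments this follows from
  -- uniqueness of inverses.
  ⁻¹-cong : ∀ {x y} → 0# < x → x ≈ y → x ⁻¹ ≈ y ⁻¹
  ⁻¹-cong {x} {y} 0<x x≈y = begin-equality
    x ⁻¹               ≈⟨ *-identityʳ _ ⟨
    x ⁻¹ * 1#          ≈⟨ *-congˡ (*-inverse (<.<-respʳ-≈ x≈y 0<x)) ⟨
    x ⁻¹ * (y * y ⁻¹)  ≈⟨ *-congˡ (*-congʳ x≈y) ⟨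
    x ⁻¹ * (x * y ⁻¹)  ≈⟨ solve 3 (λ x i j → i :* (x :* j) := (x :* i) :* j) refl x (x ⁻¹) (y ⁻¹) ⟩
    (x * x ⁻¹) * y ⁻¹  ≈⟨ *-congʳ (*-inverse 0<x) ⟩
    1# * y ⁻¹          ≈⟨ *-identityˡ _ ⟩
    y ⁻¹               ∎

-- Definite description, two-sided bounds and the Archimedean property

module Real (em : ExcludedMiddle 0ℓ) (𝓡 : CompleteOrderedField) where

  open OrderedField 𝓡 public
  open Analysis em 𝓡 public

  -- The way to reach `sqrt`, `lim` and `∫`: each must first be given a solution of its defining
  -- property.
  the-spec : ∀ {P} → ∃ P → P (the P)
  the-spec {P} h with em {∃ P}
  ... | yes (_ , p) = p
  ... | no ¬h       = contradiction h ¬h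

  fromℕ≈nat : ∀ n → fromℕ n ≈ nat n
  fromℕ≈nat n = sym (nat≈·1 n)

  ½ : ℝ
  ½ = nat 2 ⁻¹

  ½-pos : 0# < ½
  ½-pos = ⁻¹-pos (nat-pos 1)

  ½+½ : ∀ x → ½ * x + ½ * x ≈ x
  ½+½ x = begin-equality
    ½ * x + ½ * x    ≈⟨ solve 2 (λ h x → h :* x :+ h :* x := (:2 :* h) :* x) refl ½ x ⟩
    nat 2 * ½ * x    ≈⟨ *-congʳ (*-inverse (nat-pos 1)) ⟩
    1# * x           ≈⟨ *-identityˡ x ⟩
    x                ∎

  ½*-pos : ∀ {x} → 0# < x → 0# < ½ * x
  ½*-pos = *-pos ½-pos

  0≤-halve : ∀ {x} → 0# ≤ x + x → 0# ≤ x
  0≤-halve {x} h = *-cancelˡ-≤ (nat-pos 1)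
    (≤-by h (solve 1 (λ x → :2 :* x :- :2 :* :0 := x :+ x) refl x))

  ½x<x : ∀ {x} → 0# < x → ½ * x < x
  ½x<x {x} h = <-by (½*-pos h) (begin-equality
    x - ½ * x                 ≈⟨ +-congʳ (½+½ x) ⟨
    ½ * x + ½ * x - ½ * x     ≈⟨ solve 1 (λ y → y :+ y :- y := y) refl (½ * x) ⟩
    ½ * x                     ∎)

  ≤-by-ε : ∀ {x y} → (∀ ε → 0# < ε → x ≤ y + ε) → x ≤ y
  ≤-by-ε {x} {y} h = ≮⇒≥ λ y<x →
    let 0<d = x<y⇒0<y-x y<x in
    <⇒≱ (<-≤-trans (+-monoʳ-< y (½x<x 0<d))
           (≤-reflexive (solve 2 (λ x y → y :+ (x :- y) := x) refl x y)))
        (h (½ * (x - y)) (½*-pos 0<d))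

  infix 4 _∈±_
  -- Stands for ∣x∣ ≤ b. As a pair of inequalities it can be added and multiplied without an
  -- absolute value, and it entails 0 ≤ b.
  _∈±_ : ℝ → ℝ → Set
  x ∈± b = (- b ≤ x) × (x ≤ b)

  ±⇒nonNeg : ∀ {x b} → x ∈± b → 0# ≤ b
  ±⇒nonNeg {x} {b} (l , u) = 0≤-halve
    (≤-by (+-nonNeg (x≤y⇒0≤y-x l) (x≤y⇒0≤y-x u))
      (solve 2 (λ x b → (b :+ b) :- :0 := (x :- :- b) :+ (b :- x)) refl x b))

  ±-cong : ∀ {x y b} → x ≈ y → x ∈± b → y ∈± b
  ±-cong x≈y (l , u) = ≤-trans l (≤-reflexive x≈y) , ≤-trans (≤-reflexive (sym x≈y)) u

  ±-weaken : ∀ {x b c} → b ≤ c → x ∈± b → x ∈± c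
  ±-weaken b≤c (l , u) = ≤-trans (-‿anti-≤ b≤c) l , ≤-trans u b≤c

  ±-zero : ∀ {b} → 0# ≤ b → 0# ∈± b
  ±-zero h = ≤-trans (-‿anti-≤ h) (≤-reflexive -0#≈0#) , h

  ±-nonNeg : ∀ {x b} → 0# ≤ x → x ≤ b → x ∈± b
  ±-nonNeg 0≤x x≤b = ≤-trans (proj₁ (±-zero (≤-trans 0≤x x≤b))) 0≤x , x≤b

  ±-neg : ∀ {x b} → x ∈± b → - x ∈± b
  ±-neg (l , u) = -‿anti-≤ u , ≤-trans (-‿anti-≤ l) (≤-reflexive (-‿involutive _))

  ±-+ : ∀ {x y a b} → x ∈± a → y ∈± b → x + y ∈± a + b
  ±-+ (l , u) (l′ , u′) =
    ≤-trans (≤-reflexive (sym (-‿+-comm _ _))) (+-mono-≤ l l′) , +-mono-≤ u u′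

  -- 2(ab + xy) = (a - x)(b - y) + (a + x)(b + y) has nonnegative factors on the right, and 2(ab -
  -- xy) follows by changing the sign of y.
  ±-* : ∀ {x y a b} → x ∈± a → y ∈± b → x * y ∈± a * b
  ±-* {x} {y} {a} {b} (l , u) (l′ , u′) =
    0≤y-x⇒x≤y (0≤-halve (≤-by (+-nonNeg (*-nonNeg a-x b-y) (*-nonNeg a+x b+y))
      (solve 4 (λ x y a b → (x :* y :- :- (a :* b)) :+ (x :* y :- :- (a :* b)) :- :0 :=
        (a :- x) :* (b :- y) :+ (x :- :- a) :* (y :- :- b)) refl x y a b))) ,
    0≤y-x⇒x≤y (0≤-halve (≤-by (+-nonNeg (*-nonNeg a-x b+y) (*-nonNeg a+x b-y))
      (solve 4 (λ x y a b → (a :* b :- x :* y) :+ (a :* b :- x :* y) :- :0 :=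
        (a :- x) :* (y :- :- b) :+ (x :- :- a) :* (b :- y)) refl x y a b)))
    where
    a-x = x≤y⇒0≤y-x u
    a+x = x≤y⇒0≤y-x l
    b-y = x≤y⇒0≤y-x u′
    b+y = x≤y⇒0≤y-x l′

  ±-square : ∀ {x b} → x ∈± b → x * x ≤ b * b
  ±-square h = proj₂ (±-* h h)

  ±-cancel : ∀ {z x b} → 0# < z → z * x ∈± z * b → x ∈± b
  ±-cancel 0<z (l , u) =
    *-cancelˡ-≤ 0<z (≤-trans (≤-reflexive (sym (-‿distribʳ-* _ _))) l) , *-cancelˡ-≤ 0<z u

  ±-from-square : ∀ {x b} → 0# ≤ b → x * x ≤ b * b → x ∈± b
  ±-from-square {x} {b} 0≤b h =
    (≮⇒≥ λ x<-b → <⇒≱ (<-by (+-pos-nonNeg (square-pos (x<y⇒0<y-x x<-b))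
        (*-nonNeg (+-nonNeg 0≤b 0≤b) (<⇒≤ (x<y⇒0<y-x x<-b))))
      (solve 2 (λ x b → x :* x :- b :* b := (:- b :- x) :* (:- b :- x) :+ (b :+ b) :* (:- b :- x)) refl x b)) h) ,
    (≮⇒≥ λ b<x → <⇒≱ (<-by (+-pos-nonNeg (square-pos (x<y⇒0<y-x b<x))
        (*-nonNeg (+-nonNeg 0≤b 0≤b) (<⇒≤ (x<y⇒0<y-x b<x))))
      (solve 2 (λ x b → x :* x :- b :* b := (x :- b) :* (x :- b) :+ (b :+ b) :* (x :- b)) refl x b)) h)
    where
    square-pos : ∀ {y} → 0# < y → 0# < y * y
    square-pos h = *-pos h h

  -- A bound on ∣x∣ that is polynomial in x, hence available without a case distinction; it serves
  -- wherever some bound on a scalar or an argument is wanted.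
  x∈±x²+1 : ∀ x → x ∈± x * x + 1#
  x∈±x²+1 x =
    0≤y-x⇒x≤y (0≤-halve (≤-by (+-nonNeg (+-nonNeg (square-nonNeg (x + 1#)) (square-nonNeg x)) 0≤1)
      (solve 1 (λ x → (x :- :- (x :* x :+ :1)) :+ (x :- :- (x :* x :+ :1)) :- :0
        := (x :+ :1) :* (x :+ :1) :+ x :* x :+ :1) refl x))) ,
    0≤y-x⇒x≤y (0≤-halve (≤-by (+-nonNeg (+-nonNeg (square-nonNeg (x - 1#)) (square-nonNeg x)) 0≤1)
      (solve 1 (λ x → (x :* x :+ :1 :- x) :+ (x :* x :+ :1 :- x) :- :0
        := (x :- :1) :* (x :- :1) :+ x :* x :+ :1) refl x)))

  -- If the naturals were bounded with supremum s, then s - 1 would bound them too, because n + 1 ≤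
  -- s for every n.
  archimedean : ∀ x → ∃ λ n → x < nat n
  archimedean x with em {∃ λ n → x < nat n}
  ... | yes h = h
  ... | no ¬h with supremum (λ y → ∃ λ n → y ≈ nat n) (nat 0 , 0 , refl)
                   (x , λ y (n , y≈n) → ≤-trans (≤-reflexive y≈n) (≮⇒≥ λ x<n → ¬h (n , x<n)))
  ...   | s , ub , least = contradiction (least (s - 1#) λ y (n , y≈n) → ≤-by
            (x≤y⇒0≤y-x (ub (nat (suc n)) (suc n , refl))) (begin-equality
              s - 1# - y            ≈⟨ solve 2 (λ s y → s :- :1 :- y := s :- (:1 :+ y)) refl s y ⟩
              s - (1# + y)          ≈⟨ +-congˡ (-‿cong (trans (+-congˡ y≈n) (sym (nat-suc n)))) ⟩
              s - nat (suc n)       ∎))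
          (<⇒≱ (<-by 0<1 (solve 1 (λ s → s :- (s :- :1) := :1) refl s)))

  small-reciprocal : ∀ {C ε} → 0# ≤ C → 0# < ε → ∃ λ n → C * nat (suc n) ⁻¹ ≤ ε
  small-reciprocal {C} {ε} 0≤C 0<ε with archimedean (C * ε ⁻¹)
  ... | n , h = n , *-cancelˡ-≤ (nat-pos n) (begin
    nat (suc n) * (C * nat (suc n) ⁻¹)  ≈⟨ solve 3 (λ n c i → n :* (c :* i) := c :* (n :* i)) refl (nat (suc n)) C _ ⟩
    C * (nat (suc n) * nat (suc n) ⁻¹)  ≈⟨ *-congˡ (*-inverse (nat-pos n)) ⟩
    C * 1#                              ≈⟨ *-congˡ (*-inverse 0<ε) ⟨
    C * (ε * ε ⁻¹)                      ≈⟨ solve 3 (λ c e i → c :* (e :* i) := c :* i :* e) refl C ε _ ⟩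
    C * ε ⁻¹ * ε                        ≤⟨ *-monoʳ-≤ (<⇒≤ 0<ε) (≤-trans (<⇒≤ h) (nat-mono-≤ (ℕ.n≤1+n n))) ⟩
    nat (suc n) * ε                     ∎)

  -- Limits

  ⟶-± : ∀ {u l} → u ⟶ l → ∀ ε → 0# < ε → Eventually λ n → u n - l ∈± ε
  ⟶-± {u} {l} u⟶l ε 0<ε with u⟶l ε 0<ε
  ... | N , h = N , λ n N≤n →
    ≤-trans (-‿anti-≤ (<⇒≤ (proj₂ (h n N≤n))))
      (≤-reflexive (solve 2 (λ u l → :- (l :- u) := u :- l) refl (u n) l)) ,
    <⇒≤ (proj₁ (h n N≤n))

  ±⇒Within : ∀ {ε x y} → 0# < ε → x - y ∈± ½ * ε → Within ε x y
  ±⇒Within {ε} {x} {y} 0<ε (l , u) =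
    ≤-<-trans u (½x<x 0<ε) ,
    ≤-<-trans (≤-by (x≤y⇒0≤y-x l)
      (solve 3 (λ x y e → e :- (y :- x) := (x :- y) :- :- e) refl x y (½ * ε))) (½x<x 0<ε)

  ⟶-intro : ∀ {u l} → (∀ ε → 0# < ε → Eventually λ n → u n - l ∈± ε) → u ⟶ l
  ⟶-intro h ε 0<ε with h (½ * ε) (½*-pos 0<ε)
  ... | N , k = N , λ n N≤n → ±⇒Within 0<ε (k n N≤n)

  Eventually-× : ∀ {P Q} → Eventually P → Eventually Q → Eventually λ n → P n × Q n
  Eventually-× (M , p) (N , q) = M ℕ.⊔ N , λ n h →
    p n (ℕ.≤-trans (ℕ.m≤m⊔n M N) h) , q n (ℕ.≤-trans (ℕ.m≤n⊔m M N) h)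

  ⟶-const : ∀ {u c} → Eventually (λ n → u n ≈ c) → u ⟶ c
  ⟶-const {u} {c} (N , h) = ⟶-intro λ ε 0<ε → N , λ n N≤n →
    ±-cong (sym (trans (+-congʳ (h n N≤n)) (-‿inverseʳ c))) (±-zero (<⇒≤ 0<ε))

  ⟶-cong : ∀ {u v l} → (∀ n → u n ≈ v n) → u ⟶ l → v ⟶ l
  ⟶-cong eq u⟶l = ⟶-intro λ ε 0<ε →
    let (N , h) = ⟶-± u⟶l ε 0<ε in N , λ n N≤n → ±-cong (+-congʳ (eq n)) (h n N≤n)

  ⟶-suc : ∀ {u l} → u ⟶ l → (λ n → u (suc n)) ⟶ l
  ⟶-suc u⟶l ε 0<ε =
    let (N , h) = u⟶l ε 0<ε in N , λ n N≤n → h (suc n) (ℕ.m≤n⇒m≤1+n N≤n)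

  ⟶-+ : ∀ {u v k l} → u ⟶ k → v ⟶ l → (λ n → u n + v n) ⟶ (k + l)
  ⟶-+ {u} {v} {k} {l} u⟶k v⟶l = ⟶-intro λ ε 0<ε →
    let (N , h) = Eventually-× (⟶-± u⟶k (½ * ε) (½*-pos 0<ε)) (⟶-± v⟶l (½ * ε) (½*-pos 0<ε))
    in N , λ n N≤n →
      ±-weaken (≤-reflexive (½+½ ε)) (±-cong
        (solve 4 (λ u v k l → (u :- k) :+ (v :- l) := (u :+ v) :- (k :+ l)) refl (u n) (v n) k l)
        (±-+ (proj₁ (h n N≤n)) (proj₂ (h n N≤n))))

  ⟶-*ˡ : ∀ c {u l} → u ⟶ l → (λ n → c * u n) ⟶ (c * l)
  ⟶-*ˡ c {u} {l} u⟶l = ⟶-intro λ ε 0<ε →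
    let b       = c * c + 1#
        0<b     = <-≤-trans (+-pos-nonNeg 0<1 (square-nonNeg c)) (≤-reflexive (+-comm _ _))
        (N , h) = ⟶-± u⟶l (b ⁻¹ * ε) (*-pos (⁻¹-pos 0<b) 0<ε)
    in N , λ n N≤n → ±-weaken
      (≤-reflexive (trans (sym (*-assoc _ _ _)) (trans (*-congʳ (*-inverse 0<b)) (*-identityˡ ε))))
      (±-cong (solve 3 (λ c u l → c :* (u :- l) := c :* u :- c :* l) refl c (u n) l)
        (±-* (x∈±x²+1 c) (h n N≤n)))

  ⟶-≤ : ∀ {u v k l} → (∀ n → u n ≤ v n) → u ⟶ k → v ⟶ l → k ≤ l
  ⟶-≤ {u} {v} {k} {l} u≤v u⟶k v⟶l = ≤-by-ε λ ε 0<ε →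
    let (N , h) = Eventually-× (⟶-± u⟶k (½ * ε) (½*-pos 0<ε)) (⟶-± v⟶l (½ * ε) (½*-pos 0<ε))
        (lo , _) , (_ , hi) = h N ℕ.≤-refl
    in begin
      k                                ≤⟨ ≤-by (x≤y⇒0≤y-x lo)
        (solve 3 (λ u k e → u :+ e :- k := u :- k :- :- e) refl (u N) k (½ * ε)) ⟩
      u N + ½ * ε                      ≤⟨ +-monoˡ-≤ _ (u≤v N) ⟩
      v N + ½ * ε                      ≤⟨ ≤-by (x≤y⇒0≤y-x hi)
        (solve 3 (λ v l e → (l :+ (e :+ e)) :- (v :+ e) := e :- (v :- l)) refl (v N) l (½ * ε)) ⟩
      l + (½ * ε + ½ * ε)              ≈⟨ +-congˡ (½+½ ε) ⟩
      l + ε                            ∎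

  ⟶-unique : ∀ {u k l} → u ⟶ k → u ⟶ l → k ≈ l
  ⟶-unique h h′ = ≤-antisym (⟶-≤ (λ _ → ≤-refl) h h′) (⟶-≤ (λ _ → ≤-refl) h′ h)

  ⟶-resp : ∀ {u k l} → k ≈ l → u ⟶ k → u ⟶ l
  ⟶-resp k≈l h = ⟶-intro λ ε 0<ε → let (N , p) = ⟶-± h ε 0<ε in
    N , λ n N≤n → ±-cong (+-congˡ (-‿cong k≈l)) (p n N≤n)

  ⟶-limit-± : ∀ {u l b} → (∀ n → u n ∈± b) → u ⟶ l → l ∈± b
  ⟶-limit-± h u⟶l =
    ⟶-≤ (proj₁ ∘ h) (⟶-const (0 , λ _ _ → refl)) u⟶l ,
    ⟶-≤ (proj₂ ∘ h) u⟶l (⟶-const (0 , λ _ _ → refl))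

  monotone-≤ : ∀ {u : ℕ → ℝ} → (∀ n → u n ≤ u (suc n)) → ∀ {m n} → m ℕ.≤ n → u m ≤ u n
  monotone-≤ {u} step {m} m≤n = go (ℕ.≤⇒≤′ m≤n)
    where
    go : ∀ {n} → m ℕ.≤′ n → u m ≤ u n
    go (ℕ.≤′-reflexive ≡.refl) = ≤-refl
    go (ℕ.≤′-step h)           = ≤-trans (go h) (step _)

  -- The limit is the supremum s of the values: some u N reaches s - ε, since otherwise s - ε would
  -- be a smaller upper bound.
  monotone-converges : ∀ {u b} → (∀ n → u n ≤ u (suc n)) → (∀ n → u n ≤ b) → ∃ λ l → u ⟶ l
  monotone-converges {u} {b} step bound
    with supremum (λ y → ∃ λ n → y ≈ u n) (u 0 , 0 , refl)
           (b , λ y (n , y≈) → ≤-trans (≤-reflexive y≈) (bound n))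
  ... | s , ub , least = s , ⟶-intro close
    where
    close : ∀ ε → 0# < ε → Eventually λ n → u n - s ∈± ε
    close ε 0<ε with em {∃ λ n → s - ε ≤ u n}
    ... | yes (N , h) = N , λ n N≤n →
      ≤-by (x≤y⇒0≤y-x (≤-trans h (monotone-≤ {u} step N≤n)))
        (solve 3 (λ u s e → (u :- s) :- :- e := u :- (s :- e)) refl (u n) s ε) ,
      ≤-by (+-nonNeg (<⇒≤ 0<ε) (x≤y⇒0≤y-x (ub (u n) (n , refl))))
        (solve 3 (λ u s e → e :- (u :- s) := e :+ (s :- u)) refl (u n) s ε)
    ... | no ¬h = contradiction
      (least (s - ε) λ y (n , y≈) → ≤-trans (≤-reflexive y≈) (<⇒≤ (≰⇒> λ h → ¬h (n , h))))
      (<⇒≱ (<-by 0<ε (solve 2 (λ s e → s :- (s :- e) := e) refl s ε)))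

  lim-spec : ∀ u → ∃ (u ⟶_) → u ⟶ lim u
  lim-spec u = the-spec {u ⟶_}

  -- Square roots

  -- The root is the supremum s of all y ≥ 0 with y² ≤ x. Were s² different from x, a shift of s by
  -- some h > 0 would contradict that s is the least upper bound.
  sqrt-exists : ∀ x → 0# ≤ x → ∃ λ y → 0# ≤ y × y * y ≈ x
  sqrt-exists x 0≤x = s , 0≤s , ≤-antisym (≮⇒≥ x≮s²) (≮⇒≥ s²≮x)
    where
    P : ℝ → Set
    P y = 0# ≤ y × y * y ≤ x

    sup = supremum P
      (0# , ≤-refl , ≤-trans (≤-reflexive (zeroˡ 0#)) 0≤x)
      (x + 1# , λ y (0≤y , y²≤x) → proj₂ (±-from-square (+-nonNeg 0≤x 0≤1)
        (≤-trans y²≤x (≤-by (+-nonNeg (+-nonNeg (square-nonNeg x) 0≤x) 0≤1)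
          (solve 1 (λ x → (x :+ :1) :* (x :+ :1) :- x := x :* x :+ x :+ :1) refl x)))))

    s = proj₁ sup
    s-ub = proj₁ (proj₂ sup)
    s-least = proj₂ (proj₂ sup)

    0≤s : 0# ≤ s
    0≤s = s-ub 0# (≤-refl , ≤-trans (≤-reflexive (zeroˡ 0#)) 0≤x)

    s²≮x : ¬ (s * s < x)
    s²≮x s²<x = <⇒≱ (<-by 0<h (solve 2 (λ s h → (s :+ h) :- s := h) refl s h))
      (s-ub (s + h) (+-nonNeg 0≤s (<⇒≤ 0<h) , ≤-by (*-nonNeg (<⇒≤ 0<h) 0≤q)
        (begin-equality
          x - (s + h) * (s + h)      ≈⟨ solve 3 (λ x s h → x :- (s :+ h) :* (s :+ h) := (x :- s :* s) :- h :* (s :+ s :+ h)) refl x s h ⟩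
          d - h * (s + s + h)        ≈⟨ +-congʳ h*k ⟨
          h * k - h * (s + s + h)    ≈⟨ solve 3 (λ d s h → h :* (s :+ s :+ :1 :+ d) :- h :* (s :+ s :+ h) := h :* (:1 :+ d :- h)) refl d s h ⟩
          h * (1# + d - h)           ∎)))
      where
      d = x - s * s
      0<d = x<y⇒0<y-x s²<x
      k = s + s + 1# + d
      0<k : 0# < k
      0<k = <-by (+-pos-nonNeg 0<d (+-nonNeg (+-nonNeg 0≤s 0≤s) 0≤1))
        (solve 2 (λ s d → (s :+ s :+ :1 :+ d) :- :0 := d :+ (s :+ s :+ :1)) refl s d)
      -- The enlarged denominator k = 2s + 1 + d makes h ≤ 1 + d, and hence h(2s + h) ≤ hk = d, that
      -- is, (s + h)² ≤ x.
      h = d * k ⁻¹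
      0<h = *-pos 0<d (⁻¹-pos 0<k)
      h*k : h * k ≈ d
      h*k = trans (*-assoc _ _ _) (trans (*-congˡ (trans (*-comm _ _) (*-inverse 0<k))) (*-identityʳ d))
      0≤q : 0# ≤ 1# + d - h
      0≤q = *-cancelˡ-≤ 0<k (≤-by (+-nonNeg (*-nonNeg (+-nonNeg 0≤s 0≤s) (<⇒≤ (+-pos-nonNeg 0<1 (<⇒≤ 0<d))))
                (+-nonNeg (+-nonNeg 0≤1 (<⇒≤ 0<d)) (square-nonNeg d)))
        (begin-equality
          k * (1# + d - h) - k * 0#  ≈⟨ solve 3 (λ k d h → k :* (:1 :+ d :- h) :- k :* :0 := k :* (:1 :+ d) :- h :* k) refl k d h ⟩
          k * (1# + d) - h * k       ≈⟨ +-congˡ (-‿cong h*k) ⟩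
          k * (1# + d) - d           ≈⟨ solve 2 (λ s d → (s :+ s :+ :1 :+ d) :* (:1 :+ d) :- d := (s :+ s) :* (:1 :+ d) :+ (:1 :+ d :+ d :* d)) refl s d ⟩
          (s + s) * (1# + d) + (1# + d + d * d) ∎))

    x≮s² : ¬ (x < s * s)
    x≮s² x<s² = <⇒≱ (<-by 0<h (solve 2 (λ s h → s :- (s :- h) := h) refl s h))
      (s-least (s - h) λ y (0≤y , y²≤x) → proj₂ (±-from-square 0≤s-h
        (≤-trans y²≤x (≤-by (square-nonNeg h) (begin-equality
          (s - h) * (s - h) - x               ≈⟨ solve 3 (λ x s h → (s :- h) :* (s :- h) :- x := (s :* s :- x) :- h :* (s :+ s) :+ h :* h) refl x s h ⟩
          d - h * (s + s) + h * h             ≈⟨ +-congʳ (+-congˡ (-‿cong h*2s)) ⟩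
          d - d + h * h                       ≈⟨ solve 2 (λ d h → d :- d :+ h :* h := h :* h) refl d h ⟩
          h * h                               ∎)))))
      where
      d = s * s - x
      0<d = x<y⇒0<y-x x<s²
      0<s : 0# < s
      0<s = ≰⇒> λ s≤0 → <⇒≱ x<s² (≤-trans
        (≤-trans (*-monoˡ-≤ 0≤s s≤0) (≤-reflexive (zeroʳ s))) 0≤x)
      0<2s = +-pos-nonNeg 0<s 0≤s
      -- The Newton step from s: it gives (s - h)² = x + h², so s - h is still an upper bound.
      h = d * (s + s) ⁻¹
      0<h = *-pos 0<d (⁻¹-pos 0<2s)
      h*2s : h * (s + s) ≈ d
      h*2s = trans (*-assoc _ _ _) (trans (*-congˡ (trans (*-comm _ _) (*-inverse 0<2s))) (*-identityʳ d))
      0≤s-h : 0# ≤ s - h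
      0≤s-h = *-cancelˡ-≤ 0<2s (≤-by (+-nonNeg (square-nonNeg s) 0≤x) (begin-equality
        (s + s) * (s - h) - (s + s) * 0#  ≈⟨ solve 2 (λ s h → (s :+ s) :* (s :- h) :- (s :+ s) :* :0 := (s :* s :+ s :* s) :- h :* (s :+ s)) refl s h ⟩
        s * s + s * s - h * (s + s)       ≈⟨ +-congˡ (-‿cong h*2s) ⟩
        s * s + s * s - d                 ≈⟨ solve 2 (λ s x → (s :* s :+ s :* s) :- (s :* s :- x) := s :* s :+ x) refl s x ⟩
        s * s + x                         ∎))

  sqrt-nonNeg : ∀ {x} → 0# ≤ x → 0# ≤ sqrt x
  sqrt-nonNeg {x} h = proj₁ (the-spec (sqrt-exists x h))

  sqrt-square : ∀ {x} → 0# ≤ x → sqrt x * sqrt x ≈ x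
  sqrt-square {x} h = proj₂ (the-spec (sqrt-exists x h))

  𝟙-yes : ∀ {P : Set} → P → 𝟙 P ≈ 1#
  𝟙-yes {P} p with em {P}
  ... | yes _ = refl
  ... | no ¬p = contradiction p ¬p

  𝟙-no : ∀ {P : Set} → ¬ P → 𝟙 P ≈ 0#
  𝟙-no {P} ¬p with em {P}
  ... | yes p = contradiction p ¬p
  ... | no _  = refl

  𝟙-nonNeg : ∀ {P : Set} → 0# ≤ 𝟙 P
  𝟙-nonNeg {P} with em {P}
  ... | yes _ = 0≤1
  ... | no _  = ≤-refl

  𝟙-complement : ∀ {P : Set} → 𝟙 P + 𝟙 (¬ P) ≈ 1#
  𝟙-complement {P} = cases em
    where
    cases : Dec P → 𝟙 P + 𝟙 (¬ P) ≈ 1#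
    cases (yes p) = trans (+-cong (𝟙-yes p) (𝟙-no λ ¬p → ¬p p)) (+-identityʳ 1#)
    cases (no ¬p) = trans (+-cong (𝟙-no ¬p) (𝟙-yes ¬p)) (+-identityˡ 1#)

  -- Finite sums

  module _ {A : Set} where

    ∑-cong : ∀ (xs : List A) {f g} → (∀ x → f x ≈ g x) → ∑ xs f ≈ ∑ xs g
    ∑-cong []       h = refl
    ∑-cong (x ∷ xs) h = +-cong (h x) (∑-cong xs h)

    ∑-mono : ∀ (xs : List A) {f g} → (∀ x → f x ≤ g x) → ∑ xs f ≤ ∑ xs g
    ∑-mono []       h = ≤-refl
    ∑-mono (x ∷ xs) h = +-mono-≤ (h x) (∑-mono xs h)

    ∑-zero : ∀ (xs : List A) → ∑ xs (λ _ → 0#) ≈ 0#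
    ∑-zero []       = refl
    ∑-zero (x ∷ xs) = trans (+-identityˡ _) (∑-zero xs)

    ∑-nonNeg : ∀ (xs : List A) {f} → (∀ x → 0# ≤ f x) → 0# ≤ ∑ xs f
    ∑-nonNeg []       h = ≤-refl
    ∑-nonNeg (x ∷ xs) h = +-nonNeg (h x) (∑-nonNeg xs h)

    ∑-+ : ∀ (xs : List A) f g → ∑ xs (λ x → f x + g x) ≈ ∑ xs f + ∑ xs g
    ∑-+ []       f g = sym (+-identityʳ 0#)
    ∑-+ (x ∷ xs) f g = trans (+-congˡ (∑-+ xs f g))
      (solve 4 (λ a b c d → (a :+ b) :+ (c :+ d) := (a :+ c) :+ (b :+ d)) refl (f x) (g x) (∑ xs f) (∑ xs g))

    ∑-*ˡ : ∀ (xs : List A) c f → ∑ xs (λ x → c * f x) ≈ c * ∑ xs f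
    ∑-*ˡ []       c f = sym (zeroʳ c)
    ∑-*ˡ (x ∷ xs) c f = trans (+-congˡ (∑-*ˡ xs c f)) (sym (distribˡ c _ _))

    ∑-*ʳ : ∀ (xs : List A) f c → ∑ xs (λ x → f x * c) ≈ ∑ xs f * c
    ∑-*ʳ xs f c = trans (∑-cong xs λ x → *-comm (f x) c) (trans (∑-*ˡ xs c f) (*-comm c _))

    ∑-neg : ∀ (xs : List A) f → ∑ xs (λ x → - f x) ≈ - ∑ xs f
    ∑-neg []       f = sym -0#≈0#
    ∑-neg (x ∷ xs) f = trans (+-congˡ (∑-neg xs f)) (-‿+-comm _ _)

    ∑-- : ∀ (xs : List A) f g → ∑ xs (λ x → f x - g x) ≈ ∑ xs f - ∑ xs g
    ∑-- xs f g = trans (∑-+ xs f (λ x → - g x)) (+-congˡ (∑-neg xs g))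

    ∑-const : ∀ (xs : List A) c → ∑ xs (λ _ → c) ≈ nat (length xs) * c
    ∑-const []       c = sym (zeroˡ c)
    ∑-const (x ∷ xs) c = begin-equality
      c + ∑ xs (λ _ → c)              ≈⟨ +-congˡ (∑-const xs c) ⟩
      c + nat (length xs) * c         ≈⟨ solve 2 (λ c l → c :+ l :* c := (:1 :+ l) :* c) refl c (nat (length xs)) ⟩
      (1# + nat (length xs)) * c      ≈⟨ *-congʳ (nat-suc (length xs)) ⟨
      nat (suc (length xs)) * c       ∎

    ∑-++ : ∀ (xs ys : List A) f → ∑ (xs ++ ys) f ≈ ∑ xs f + ∑ ys f
    ∑-++ []       ys f = sym (+-identityˡ _)
    ∑-++ (x ∷ xs) ys f = trans (+-congˡ (∑-++ xs ys f)) (sym (+-assoc _ _ _))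

    ∑-± : ∀ (xs : List A) {f b} → (∀ x → f x ∈± b x) → ∑ xs f ∈± ∑ xs b
    ∑-± []       h = ±-zero ≤-refl
    ∑-± (x ∷ xs) h = ±-+ (h x) (∑-± xs h)

    ∑-map : ∀ {B : Set} (g : B → A) (xs : List B) f → ∑ (map g xs) f ≡ ∑ xs (f ∘ g)
    ∑-map g []       f = ≡.refl
    ∑-map g (x ∷ xs) f = ≡.cong (f (g x) +_) (∑-map g xs f)

  ∑-swap : ∀ {A B : Set} (xs : List A) (ys : List B) (f : A → B → ℝ) →
           ∑ xs (λ x → ∑ ys (f x)) ≈ ∑ ys (λ y → ∑ xs λ x → f x y)
  ∑-swap []       ys f = sym (∑-zero ys)
  ∑-swap (x ∷ xs) ys f = trans (+-congˡ (∑-swap xs ys f)) (sym (∑-+ ys (f x) _))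

  ∑-allVecs : ∀ {A : Set} (xs : List A) n F →
              ∑ (allVecs xs (suc n)) F ≈ ∑ xs (λ x → ∑ (allVecs xs n) λ v → F (x ∷ v))
  ∑-allVecs {A} xs n F = go xs
    where
    go : ∀ ys → ∑ (cartesianProductWith _∷_ ys (allVecs xs n)) F ≈ ∑ ys (λ x → ∑ (allVecs xs n) λ v → F (x ∷ v))
    go []       = refl
    go (y ∷ ys) = trans (∑-++ (map (y ∷_) (allVecs xs n)) _ F)
      (+-cong (reflexive (∑-map (y ∷_) (allVecs xs n) F)) (go ys))

  ∑-tabulate : ∀ {A : Set} n (g : Fin n → A) f → ∑ (List.tabulate g) f ≡ ∑ (allFin n) (f ∘ g)
  ∑-tabulate zero    g f = ≡.refl
  ∑-tabulate (suc n) g f = ≡.cong (f (g Fin.zero) +_)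
    (≡.trans (∑-tabulate n (g ∘ Fin.suc) f) (≡.sym (∑-tabulate n Fin.suc (f ∘ g))))

  ∑-allFin-suc : ∀ n f → ∑ (allFin (suc n)) f ≡ f Fin.zero + ∑ (allFin n) (f ∘ Fin.suc)
  ∑-allFin-suc n f = ≡.cong (f Fin.zero +_) (∑-tabulate n Fin.suc f)

  ∑-upTo-suc : ∀ n f → ∑ (upTo (suc n)) f ≈ ∑ (upTo n) f + f n
  ∑-upTo-suc n f = go id n
    where
    go : ∀ (g : ℕ → ℕ) n → ∑ (applyUpTo g (suc n)) f ≈ ∑ (applyUpTo g n) f + f (g n)
    go g zero    = +-comm _ _
    go g (suc n) = trans (+-congˡ (go (g ∘ suc) n)) (sym (+-assoc _ _ _))

  ∑-upTo-suc-front : ∀ n f → ∑ (upTo (suc n)) f ≡ f 0 + ∑ (upTo n) (f ∘ suc)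
  ∑-upTo-suc-front n f = ≡.cong (f 0 +_) (go suc n f)
    where
    go : ∀ (g : ℕ → ℕ) n f → ∑ (applyUpTo g n) f ≡ ∑ (upTo n) (f ∘ g)
    go g zero    f = ≡.refl
    go g (suc n) f = ≡.cong (f (g 0) +_) (≡.trans (go (g ∘ suc) n f) (≡.sym (go suc n (f ∘ g))))

  ∑-upTo-mono : ∀ n {f g} → (∀ i → i ℕ.< n → f i ≤ g i) → ∑ (upTo n) f ≤ ∑ (upTo n) g
  ∑-upTo-mono zero    h = ≤-refl
  ∑-upTo-mono (suc n) {f} {g} h = begin
    ∑ (upTo (suc n)) f      ≈⟨ ∑-upTo-suc n f ⟩
    ∑ (upTo n) f + f n      ≤⟨ +-mono-≤ (∑-upTo-mono n λ i i<n → h i (ℕ.m<n⇒m<1+n i<n)) (h n ℕ.≤-refl) ⟩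
    ∑ (upTo n) g + g n      ≈⟨ ∑-upTo-suc n g ⟨
    ∑ (upTo (suc n)) g      ∎

  ∑-telescope : ∀ n (F : ℕ → ℝ) → ∑ (upTo n) (λ i → F (suc i) - F i) ≈ F n - F 0
  ∑-telescope zero    F = sym (-‿inverseʳ _)
  ∑-telescope (suc n) F = begin-equality
    ∑ (upTo (suc n)) (λ i → F (suc i) - F i)            ≈⟨ ∑-upTo-suc n _ ⟩
    ∑ (upTo n) (λ i → F (suc i) - F i) + (F (suc n) - F n) ≈⟨ +-congʳ (∑-telescope n F) ⟩
    F n - F 0 + (F (suc n) - F n)                       ≈⟨ solve 3 (λ a b c → b :- a :+ (c :- b) := c :- a) refl (F 0) (F n) (F (suc n)) ⟩
    F (suc n) - F 0                                     ∎

-- The exponential series on the imaginary axis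

module Exponential (em : ExcludedMiddle 0ℓ) (𝓡 : CompleteOrderedField) where

  open Real em 𝓡
  open ℂ
  open SemiringExp semiring using (_^_)

  pw : ℕ → ℝ → ℝ
  pw k θ = fromℕ (k !) ⁻¹ * θ ^ k

  fromℕ!-pos : ∀ k → 0# < fromℕ (k !)
  fromℕ!-pos k with k ! | ℕ.1≤n! k
  ... | suc m | _ = <-≤-trans (nat-pos m) (≤-reflexive (sym (fromℕ≈nat (suc m))))

  ⁻¹!-suc : ∀ k → nat (suc k) * fromℕ (suc k !) ⁻¹ ≈ fromℕ (k !) ⁻¹
  ⁻¹!-suc k = begin-equality
    nat (suc k) * j                         ≈⟨ *-identityʳ _ ⟨
    nat (suc k) * j * 1#                    ≈⟨ *-congˡ (*-inverse (fromℕ!-pos k)) ⟨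
    nat (suc k) * j * (fromℕ (k !) * i)     ≈⟨ solve 4 (λ n f i j → n :* j :* (f :* i) := (n :* f) :* j :* i) refl _ _ _ _ ⟩
    nat (suc k) * fromℕ (k !) * j * i       ≈⟨ *-congʳ (*-congʳ (*-congˡ (fromℕ≈nat (k !)))) ⟩
    nat (suc k) * nat (k !) * j * i         ≈⟨ *-congʳ (*-congʳ (nat-* (suc k) (k !))) ⟨
    nat (suc k !) * j * i                   ≈⟨ *-congʳ (*-congʳ (fromℕ≈nat (suc k !))) ⟨
    fromℕ (suc k !) * j * i                 ≈⟨ *-congʳ (*-inverse (fromℕ!-pos (suc k))) ⟩
    1# * i                                  ≈⟨ *-identityˡ i ⟩
    i                                       ∎
    where
    i = fromℕ (k !) ⁻¹
    j = fromℕ (suc k !) ⁻¹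

  -- The recurrence behind the ratio test and the Taylor estimate; it lets inductions on k run
  -- without handling the factorials.
  pw-suc : ∀ k θ → nat (suc k) * pw (suc k) θ ≈ θ * pw k θ
  pw-suc k θ = begin-equality
    nat (suc k) * (fromℕ (suc k !) ⁻¹ * (θ * θ ^ k))  ≈⟨ solve 4 (λ n j t u → n :* (j :* (t :* u)) := (n :* j) :* (t :* u)) refl _ _ _ _ ⟩
    nat (suc k) * fromℕ (suc k !) ⁻¹ * (θ * θ ^ k)    ≈⟨ *-congʳ (⁻¹!-suc k) ⟩
    fromℕ (k !) ⁻¹ * (θ * θ ^ k)                      ≈⟨ solve 3 (λ i t u → i :* (t :* u) := t :* (i :* u)) refl _ _ _ ⟩
    θ * pw k θ                                        ∎

  ^-± : ∀ {θ M} → θ ∈± M → ∀ k → θ ^ k ∈± M ^ k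
  ^-± h zero    = ±-nonNeg 0≤1 ≤-refl
  ^-± h (suc k) = ±-* h (^-± h k)

  pw-± : ∀ {θ M} → θ ∈± M → ∀ k → pw k θ ∈± pw k M
  pw-± h k = ±-* (±-nonNeg (<⇒≤ (⁻¹-pos (fromℕ!-pos k))) ≤-refl) (^-± h k)

  pw-nonNeg : ∀ {M} → 0# ≤ M → ∀ k → 0# ≤ pw k M
  pw-nonNeg h k = ±⇒nonNeg (pw-± (±-nonNeg h ≤-refl) k)

  pw-sum : ℝ → ℕ → ℝ
  pw-sum M n = ∑[ k ∈ upTo n ] pw k M

  pw-sum-step : ∀ {M} → 0# ≤ M → ∀ n → pw-sum M n ≤ pw-sum M (suc n)
  pw-sum-step {M} 0≤M n = ≤-by (pw-nonNeg 0≤M n) (begin-equality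
    pw-sum M (suc n) - pw-sum M n         ≈⟨ +-congʳ (∑-upTo-suc n _) ⟩
    pw-sum M n + pw n M - pw-sum M n      ≈⟨ solve 2 (λ s p → s :+ p :- s := p) refl _ _ ⟩
    pw n M                                ∎)

  -- Ratio test: from some n₀ > 2M on, each term is at most half its predecessor, so a partial sum
  -- plus twice the next term no longer increases. K is that quantity at n₀.
  pw-sum-bounded : ∀ {M} → 0# ≤ M → ∃ λ K → ∀ n → pw-sum M n ≤ K
  pw-sum-bounded {M} 0≤M = K , λ n → begin
    pw-sum M n                               ≤⟨ monotone-≤ {pw-sum M} (pw-sum-step 0≤M) (ℕ.m≤m+n n n₀) ⟩
    pw-sum M (n ℕ.+ n₀)                      ≤⟨ ≤-by (*-nonNeg (nat-nonNeg 2) (pw-nonNeg 0≤M (n ℕ.+ n₀)))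
                                                  (solve 2 (λ s p → (s :+ p) :- s := p) refl _ _) ⟩
    pw-sum M (n ℕ.+ n₀) + nat 2 * pw (n ℕ.+ n₀) M ≤⟨ tail n ⟩
    K                                        ∎
    where
    n₀ = proj₁ (archimedean (nat 2 * M))
    K = pw-sum M n₀ + nat 2 * pw n₀ M

    halves : ∀ k → n₀ ℕ.≤ k → nat 2 * pw (suc k) M ≤ pw k M
    halves k n₀≤k = *-cancelˡ-≤ (nat-pos k) (begin
      nat (suc k) * (nat 2 * pw (suc k) M)   ≈⟨ solve 2 (λ n p → n :* (:2 :* p) := :2 :* (n :* p)) refl _ _ ⟩
      nat 2 * (nat (suc k) * pw (suc k) M)   ≈⟨ *-congˡ (pw-suc k M) ⟩
      nat 2 * (M * pw k M)                   ≈⟨ *-assoc _ _ _ ⟨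
      nat 2 * M * pw k M                     ≤⟨ *-monoʳ-≤ (pw-nonNeg 0≤M k) (≤-trans (<⇒≤ (proj₂ (archimedean (nat 2 * M))))
                                                  (nat-mono-≤ (ℕ.m≤n⇒m≤1+n n₀≤k))) ⟩
      nat (suc k) * pw k M                   ∎)

    tail : ∀ j → pw-sum M (j ℕ.+ n₀) + nat 2 * pw (j ℕ.+ n₀) M ≤ K
    tail zero    = ≤-refl
    tail (suc j) = begin
      pw-sum M (suc k) + nat 2 * pw (suc k) M     ≤⟨ +-mono-≤ (≤-reflexive (∑-upTo-suc k _)) (halves k (ℕ.m≤n+m n₀ j)) ⟩
      pw-sum M k + pw k M + pw k M                ≈⟨ solve 2 (λ s p → s :+ p :+ p := s :+ :2 :* p) refl _ _ ⟩
      pw-sum M k + nat 2 * pw k M                 ≤⟨ tail j ⟩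
      K                                           ∎
      where
      k = j ℕ.+ n₀

  -- The derivative of `pw k` at M, which is 0 for k = 0.
  pw-shifted : ℝ → ℕ → ℝ
  pw-shifted M zero    = 0#
  pw-shifted M (suc k) = pw k M

  pw-shifted-* : ∀ M k → M * pw-shifted M k ≈ nat k * pw k M
  pw-shifted-* M zero    = trans (zeroʳ M) (sym (zeroˡ _))
  pw-shifted-* M (suc k) = sym (pw-suc k M)

  -- A first-order Taylor estimate by induction instead of derivatives: with d = θ - φ, the
  -- remainder in degree k + 2, times k + 2, is θ times the remainder in degree k + 1 plus d² φᵏ/k!.
  -- By `pw-shifted-*` these parts are at most k and 1 times d² Mᵏ/k!, and k + 1 ≤ k + 2.
  pw-taylor : ∀ {θ φ M} → θ ∈± M → φ ∈± M → ∀ k →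
              pw (suc k) θ - pw (suc k) φ - (θ - φ) * pw k φ ∈± (θ - φ) * (θ - φ) * pw-shifted M k
  pw-taylor {θ} {φ} {M} hθ hφ zero = ±-cancel (nat-pos 0) (±-cong (sym (begin-equality
      1# * (pw 1 θ - pw 1 φ - (θ - φ) * pw 0 φ)           ≈⟨ solve 5 (λ p q t f r → :1 :* (p :- q :- (t :- f) :* r) :=
                                                                (:1 :* p) :- (:1 :* q) :- (t :- f) :* r) refl _ _ θ φ _ ⟩
      1# * pw 1 θ - 1# * pw 1 φ - (θ - φ) * pw 0 φ        ≈⟨ +-congʳ (+-cong (pw-suc 0 θ) (-‿cong (pw-suc 0 φ))) ⟩
      θ * pw 0 θ - φ * pw 0 θ - (θ - φ) * pw 0 θ          ≈⟨ solve 3 (λ t f r → t :* r :- f :* r :- (t :- f) :* r := :0) refl θ φ (pw 0 θ) ⟩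
      0#                                                  ∎))
    (±-zero (*-nonNeg 0≤1 (*-nonNeg (square-nonNeg _) ≤-refl))))
  pw-taylor {θ} {φ} {M} hθ hφ (suc k) = ±-cancel (nat-pos (suc k)) (±-weaken bound (±-cong (sym eq)
      (±-+ (±-* hθ (pw-taylor hθ hφ k)) (±-* (±-nonNeg (square-nonNeg d) ≤-refl) (pw-± hφ k)))))
    where
    d = θ - φ

    eq : nat (2 ℕ.+ k) * (pw (2 ℕ.+ k) θ - pw (2 ℕ.+ k) φ - d * pw (suc k) φ)
       ≈ θ * (pw (suc k) θ - pw (suc k) φ - d * pw k φ) + d * d * pw k φ
    eq = begin-equality
      nat (2 ℕ.+ k) * (pw (2 ℕ.+ k) θ - pw (2 ℕ.+ k) φ - d * pw (suc k) φ)
        ≈⟨ solve 5 (λ n p q d r → (:1 :+ n) :* (p :- q :- d :* r) :=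
             (:1 :+ n) :* p :- (:1 :+ n) :* q :- d :* r :- d :* (n :* r)) refl (nat (suc k)) _ _ d _ ⟩
      nat (2 ℕ.+ k) * pw (2 ℕ.+ k) θ - nat (2 ℕ.+ k) * pw (2 ℕ.+ k) φ - d * pw (suc k) φ - d * (nat (suc k) * pw (suc k) φ)
        ≈⟨ +-cong (+-congʳ (+-cong (pw-suc (suc k) θ) (-‿cong (pw-suc (suc k) φ)))) (-‿cong (*-congˡ (pw-suc k φ))) ⟩
      θ * pw (suc k) θ - φ * pw (suc k) φ - d * pw (suc k) φ - d * (φ * pw k φ)
        ≈⟨ solve 5 (λ t f p q r → t :* p :- f :* q :- (t :- f) :* q :- (t :- f) :* (f :* r) :=
             t :* (p :- q :- (t :- f) :* r) :+ (t :- f) :* (t :- f) :* r) refl θ φ _ _ _ ⟩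
      θ * (pw (suc k) θ - pw (suc k) φ - d * pw k φ) + d * d * pw k φ ∎

    bound : M * (d * d * pw-shifted M k) + d * d * pw k M ≤ nat (2 ℕ.+ k) * (d * d * pw k M)
    bound = ≤-by (*-nonNeg (square-nonNeg d) (pw-nonNeg (±⇒nonNeg hθ) k)) (begin-equality
      nat (2 ℕ.+ k) * (d * d * pw k M) - (M * (d * d * pw-shifted M k) + d * d * pw k M)
        ≈⟨ +-congʳ (*-congʳ (+-congˡ (nat-suc k))) ⟩
      (1# + (1# + nat k)) * (d * d * pw k M) - (M * (d * d * pw-shifted M k) + d * d * pw k M)
        ≈⟨ solve 5 (λ n D p M q → (:1 :+ (:1 :+ n)) :* (D :* p) :- (M :* (D :* q) :+ D :* p) :=
             D :* p :+ D :* (n :* p :- M :* q)) refl (nat k) (d * d) (pw k M) M (pw-shifted M k) ⟩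
      d * d * pw k M + d * d * (nat k * pw k M - M * pw-shifted M k)
        ≈⟨ +-congˡ (*-congˡ (+-congˡ (-‿cong (pw-shifted-* M k)))) ⟩
      d * d * pw k M + d * d * (nat k * pw k M - nat k * pw k M)
        ≈⟨ solve 3 (λ n D p → D :* p :+ D :* (n :* p :- n :* p) := D :* p) refl (nat k) (d * d) (pw k M) ⟩
      d * d * pw k M ∎)

  -- Coefficients `γ` bounded by 1 cover the cosine and sine series at once, and passing from `γ` to
  -- `γ ∘ suc` is differentiation.
  T : (ℕ → ℝ) → ℕ → ℝ → ℝ
  T γ n θ = ∑[ k ∈ upTo n ] (γ k * pw k θ)

  *-±1 : ∀ {x y b} → x ∈± 1# → y ∈± b → x * y ∈± b
  *-±1 hx hy = ±-weaken (≤-reflexive (*-identityˡ _)) (±-* hx hy)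

  module _ (γ : ℕ → ℝ) (γ-± : ∀ k → γ k ∈± 1#) where

    T-± : ∀ {θ M} → θ ∈± M → ∀ n → T γ n θ ∈± pw-sum M n
    T-± h n = ∑-± (upTo n) λ k → *-±1 (γ-± k) (pw-± h k)

    -- Absolute convergence: adding the majorant `pw-sum M` makes the partial sums nondecreasing and
    -- bounded. The limit of the majorant is then subtracted again.
    T-converges : ∀ θ → ∃ λ l → (λ n → T γ n θ) ⟶ l
    T-converges θ = l₁ + - 1# * l₂ , ⟶-cong
      (λ n → solve 2 (λ t p → (t :+ p) :+ :- :1 :* p := t) refl _ _) (⟶-+ conv₁ (⟶-*ˡ (- 1#) conv₂))
      where
      M = θ * θ + 1#
      0≤M = ±⇒nonNeg (x∈±x²+1 θ)
      K = proj₁ (pw-sum-bounded 0≤M)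

      pw-sum≤K : ∀ n → pw-sum M n ≤ K
      pw-sum≤K = proj₂ (pw-sum-bounded 0≤M)

      step : ∀ n → T γ n θ + pw-sum M n ≤ T γ (suc n) θ + pw-sum M (suc n)
      step n = ≤-by (x≤y⇒0≤y-x (proj₁ (*-±1 (γ-± n) (pw-± (x∈±x²+1 θ) n)))) (begin-equality
        T γ (suc n) θ + pw-sum M (suc n) - (T γ n θ + pw-sum M n)
          ≈⟨ +-congʳ (+-cong (∑-upTo-suc n _) (∑-upTo-suc n _)) ⟩
        T γ n θ + γ n * pw n θ + (pw-sum M n + pw n M) - (T γ n θ + pw-sum M n)
          ≈⟨ solve 4 (λ t x s p → t :+ x :+ (s :+ p) :- (t :+ s) := x :- :- p) refl _ _ _ _ ⟩
        γ n * pw n θ - - pw n M ∎)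

      limit₁ = monotone-converges step λ n →
        +-mono-≤ (≤-trans (proj₂ (T-± (x∈±x²+1 θ) n)) (pw-sum≤K n)) (pw-sum≤K n)
      limit₂ = monotone-converges (pw-sum-step 0≤M) pw-sum≤K
      l₁ = proj₁ limit₁
      l₂ = proj₁ limit₂
      conv₁ = proj₂ limit₁
      conv₂ = proj₂ limit₂

    -- Sum of `pw-taylor` over the terms of positive degree; the constant terms cancel. The bound is
    -- uniform in n, so it passes to the limit.
    T-taylor : ∀ {θ φ M K} → θ ∈± M → φ ∈± M → (∀ n → pw-sum M n ≤ K) → ∀ n →
               T γ (suc n) θ - T γ (suc n) φ - (θ - φ) * T (γ ∘ suc) n φ ∈± (θ - φ) * (θ - φ) * K
    T-taylor {θ} {φ} {M} {K} hθ hφ bound n = ±-weaken (≤-trans (≤-reflexive (∑-*ˡ (upTo n) (d * d) (pw-shifted M)))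
        (*-monoˡ-≤ (square-nonNeg d) (shifted≤ n)))
      (±-cong (sym eq) (∑-± (upTo n) λ k → *-±1 (γ-± (suc k)) (pw-taylor hθ hφ k)))
      where
      d = θ - φ

      shifted≤ : ∀ n → ∑ (upTo n) (pw-shifted M) ≤ K
      shifted≤ zero    = bound 0
      shifted≤ (suc n) = ≤-trans (≤-reflexive (trans (reflexive (∑-upTo-suc-front n (pw-shifted M))) (+-identityˡ _))) (bound n)

      eq : T γ (suc n) θ - T γ (suc n) φ - d * T (γ ∘ suc) n φ
         ≈ ∑[ k ∈ upTo n ] (γ (suc k) * (pw (suc k) θ - pw (suc k) φ - d * pw k φ))
      eq = begin-equality
        T γ (suc n) θ - T γ (suc n) φ - d * T (γ ∘ suc) n φ
          ≈⟨ +-congʳ (+-cong (reflexive (∑-upTo-suc-front n _)) (-‿cong (reflexive (∑-upTo-suc-front n _)))) ⟩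
        γ 0 * pw 0 θ + Σθ - (γ 0 * pw 0 θ + Σφ) - d * T (γ ∘ suc) n φ
          ≈⟨ solve 4 (λ a x y z → a :+ x :- (a :+ y) :- z := x :- y :- z) refl _ _ _ _ ⟩
        Σθ - Σφ - d * T (γ ∘ suc) n φ
          ≈⟨ +-congˡ (-‿cong (∑-*ˡ (upTo n) d _)) ⟨
        Σθ - Σφ - (∑[ k ∈ upTo n ] (d * (γ (suc k) * pw k φ)))
          ≈⟨ +-congʳ (∑-- (upTo n) _ _) ⟨
        (∑[ k ∈ upTo n ] (γ (suc k) * pw (suc k) θ - γ (suc k) * pw (suc k) φ)) - (∑[ k ∈ upTo n ] (d * (γ (suc k) * pw k φ)))
          ≈⟨ ∑-- (upTo n) _ _ ⟨
        ∑[ k ∈ upTo n ] (γ (suc k) * pw (suc k) θ - γ (suc k) * pw (suc k) φ - d * (γ (suc k) * pw k φ))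
          ≈⟨ ∑-cong (upTo n) (λ k → solve 5 (λ g p q d r → g :* p :- g :* q :- d :* (g :* r) :=
               g :* (p :- q :- d :* r)) refl (γ (suc k)) _ _ d _) ⟩
        ∑[ k ∈ upTo n ] (γ (suc k) * (pw (suc k) θ - pw (suc k) φ - d * pw k φ)) ∎
        where
        Σθ = ∑[ k ∈ upTo n ] (γ (suc k) * pw (suc k) θ)
        Σφ = ∑[ k ∈ upTo n ] (γ (suc k) * pw (suc k) φ)

  -- (iθ)ᵏ = (α k + i β k) θᵏ
  mutual
    α : ℕ → ℝ
    α zero    = 1#
    α (suc k) = - β k

    β : ℕ → ℝ
    β zero    = 0#
    β (suc k) = α k

  mutual
    α-± : ∀ k → α k ∈± 1#
    α-± zero    = ±-nonNeg 0≤1 ≤-refl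
    α-± (suc k) = ±-neg (β-± k)

    β-± : ∀ k → β k ∈± 1#
    β-± zero    = ±-zero 0≤1
    β-± (suc k) = α-± k

  mutual
    re-i^ : ∀ θ k → re ((0# +i θ) ^ℂ k) ≈ α k * θ ^ k
    re-i^ θ zero    = sym (*-identityˡ 1#)
    re-i^ θ (suc k) = begin-equality
      0# * re ((0# +i θ) ^ℂ k) - θ * im ((0# +i θ) ^ℂ k)  ≈⟨ +-cong (zeroˡ _) (-‿cong (*-congˡ (im-i^ θ k))) ⟩
      0# - θ * (β k * θ ^ k)                              ≈⟨ solve 3 (λ t b p → :0 :- t :* (b :* p) := :- b :* (t :* p)) refl _ _ _ ⟩
      - β k * (θ * θ ^ k)                                 ∎

    im-i^ : ∀ θ k → im ((0# +i θ) ^ℂ k) ≈ β k * θ ^ k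
    im-i^ θ zero    = sym (zeroˡ 1#)
    im-i^ θ (suc k) = begin-equality
      0# * im ((0# +i θ) ^ℂ k) + θ * re ((0# +i θ) ^ℂ k)  ≈⟨ +-cong (zeroˡ _) (*-congˡ (re-i^ θ k)) ⟩
      0# + θ * (α k * θ ^ k)                              ≈⟨ solve 3 (λ t b p → :0 :+ t :* (b :* p) := b :* (t :* p)) refl _ _ _ ⟩
      α k * (θ * θ ^ k)                                   ∎

  -- Cosine and sine, in the form in which they occur in `fourier`.
  c s : ℝ → ℝ
  c θ = re (exp (0# +i θ))
  s θ = im (exp (0# +i θ))

  α-⟶ : ∀ θ → (λ n → T α n θ) ⟶ c θ
  α-⟶ θ = ⟶-cong (λ n → sym (eq n)) (lim-spec _ (proj₁ limit , ⟶-cong eq (proj₂ limit)))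
    where
    limit = T-converges α α-± θ

    eq : ∀ n → T α n θ ≈ ∑[ k ∈ upTo n ] (fromℕ (k !) ⁻¹ * re ((0# +i θ) ^ℂ k))
    eq n = ∑-cong (upTo n) λ k → trans (solve 3 (λ a i t → a :* (i :* t) := i :* (a :* t)) refl _ _ _)
      (*-congˡ (sym (re-i^ θ k)))

  β-⟶ : ∀ θ → (λ n → T β n θ) ⟶ s θ
  β-⟶ θ = ⟶-cong (λ n → sym (eq n)) (lim-spec _ (proj₁ limit , ⟶-cong eq (proj₂ limit)))
    where
    limit = T-converges β β-± θ

    eq : ∀ n → T β n θ ≈ ∑[ k ∈ upTo n ] (fromℕ (k !) ⁻¹ * im ((0# +i θ) ^ℂ k))
    eq n = ∑-cong (upTo n) λ k → trans (solve 3 (λ a i t → a :* (i :* t) := i :* (a :* t)) refl _ _ _)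
      (*-congˡ (sym (im-i^ θ k)))

  T-at-0 : ∀ γ n → T γ (suc n) 0# ≈ γ 0
  T-at-0 γ n = begin-equality
    T γ (suc n) 0#                                                          ≈⟨ reflexive (∑-upTo-suc-front n _) ⟩
    γ 0 * (fromℕ 1 ⁻¹ * 1#) + (∑[ k ∈ upTo n ] (γ (suc k) * pw (suc k) 0#))   ≈⟨ +-cong
      (trans (*-congˡ (trans (*-identityʳ _) 1⁻¹)) (*-identityʳ _))
      (trans (∑-cong (upTo n) λ k → solve 3 (λ g i p → g :* (i :* (:0 :* p)) := :0) refl _ _ _) (∑-zero (upTo n))) ⟩
    γ 0 + 0#                                                                ≈⟨ +-identityʳ _ ⟩
    γ 0                                                                     ∎
    where
    1⁻¹ : fromℕ 1 ⁻¹ ≈ 1#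
    1⁻¹ = trans (sym (*-identityˡ _)) (trans (*-congʳ (sym (+-identityʳ 1#)))
      (*-inverse (+-pos-nonNeg 0<1 ≤-refl)))

  c-0 : c 0# ≈ 1#
  c-0 = ⟶-unique (⟶-suc (α-⟶ 0#)) (⟶-const (0 , λ n _ → T-at-0 α n))

  s-0 : s 0# ≈ 0#
  s-0 = ⟶-unique (⟶-suc (β-⟶ 0#)) (⟶-const (0 , λ n _ → T-at-0 β n))

  module _ {M K : ℝ} (bound : ∀ n → pw-sum M n ≤ K) where

    c-± : ∀ {θ} → θ ∈± M → c θ ∈± K
    c-± h = ⟶-limit-± (λ n → ±-weaken (bound n) (T-± α α-± h n)) (α-⟶ _)

    s-± : ∀ {θ} → θ ∈± M → s θ ∈± K
    s-± h = ⟶-limit-± (λ n → ±-weaken (bound n) (T-± β β-± h n)) (β-⟶ _)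

    c-taylor : ∀ {θ φ} → θ ∈± M → φ ∈± M → c θ - c φ + (θ - φ) * s φ ∈± (θ - φ) * (θ - φ) * K
    c-taylor {θ} {φ} hθ hφ = ⟶-limit-± (λ n → T-taylor α α-± hθ hφ bound n)
      (⟶-cong (λ n → trans
          (solve 4 (λ x y d z → x :+ :- :1 :* y :+ d :* z := x :- y :- d :* (:- :1 :* z)) refl _ _ (θ - φ) _)
          (+-congˡ (-‿cong (*-congˡ (trans (sym (∑-*ˡ (upTo n) _ _)) (∑-cong (upTo n) λ k →
            solve 2 (λ b p → :- :1 :* (b :* p) := :- b :* p) refl _ _))))))
        (⟶-resp (solve 4 (λ x y d z → x :+ :- :1 :* y :+ d :* z := x :- y :+ d :* z) refl _ _ (θ - φ) _)
          (⟶-+ (⟶-+ (⟶-suc (α-⟶ θ)) (⟶-*ˡ (- 1#) (⟶-suc (α-⟶ φ)))) (⟶-*ˡ (θ - φ) (β-⟶ φ)))))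

    s-taylor : ∀ {θ φ} → θ ∈± M → φ ∈± M → s θ - s φ - (θ - φ) * c φ ∈± (θ - φ) * (θ - φ) * K
    s-taylor {θ} {φ} hθ hφ = ⟶-limit-± (λ n → T-taylor β β-± hθ hφ bound n)
      (⟶-cong (λ n → solve 4 (λ x y d z → x :+ :- :1 :* y :+ :- d :* z := x :- y :- d :* z) refl _ _ (θ - φ) _)
        (⟶-resp (solve 4 (λ x y d z → x :+ :- :1 :* y :+ :- d :* z := x :- y :- d :* z) refl _ _ (θ - φ) _)
          (⟶-+ (⟶-+ (⟶-suc (β-⟶ θ)) (⟶-*ˡ (- 1#) (⟶-suc (β-⟶ φ)))) (⟶-*ˡ (- (θ - φ)) (α-⟶ φ)))))

  norm² : ℝ → ℝ
  norm² θ = c θ * c θ + s θ * s θ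

  -- Says that cos² + sin² has derivative 0, in a quantitative form: the terms linear in θ - φ
  -- cancel.
  norm²-increment : ∀ {M} → 0# ≤ M → ∃ λ K → ∀ {θ φ} → θ ∈± M → φ ∈± M →
                    norm² θ - norm² φ ∈± K * ((θ - φ) * (θ - φ))
  norm²-increment {M} 0≤M = K′ , increment
    where
    K = proj₁ (pw-sum-bounded 0≤M)

    bound : ∀ n → pw-sum M n ≤ K
    bound = proj₂ (pw-sum-bounded 0≤M)

    m = M + M
    K′ = (K * K + K * K) + nat 2 * (K * (K + m * K)) + nat 2 * (K * (K + m * K)) + K * (m * m * K) + K * (m * m * K)

    increment : ∀ {θ φ} → θ ∈± M → φ ∈± M → norm² θ - norm² φ ∈± K′ * ((θ - φ) * (θ - φ))
    increment {θ} {φ} hθ hφ = ±-weaken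
      (≤-reflexive (solve 3 (λ K m D →
        D :* (K :* K :+ K :* K) :+ :2 :* (D :* K :* (K :+ m :* K)) :+ :2 :* (D :* K :* (K :+ m :* K))
          :+ D :* K :* (m :* m :* K) :+ D :* K :* (m :* m :* K)
        := ((K :* K :+ K :* K) :+ :2 :* (K :* (K :+ m :* K)) :+ :2 :* (K :* (K :+ m :* K))
          :+ K :* (m :* m :* K) :+ K :* (m :* m :* K)) :* D) refl K m (d * d)))
      -- Here ρ and σ are the Taylor remainders, c = c₀ - d s₀ + ρ and s = s₀ + d c₀ + σ. In the sum
      -- of squares the cross terms ∓2 d c₀ s₀ cancel, and each surviving term carries a factor d²
      -- once ρ and σ are estimated.
      (±-cong (solve 5 (λ c c₀ s s₀ d →
          let ρ = c :- c₀ :+ d :* s₀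
              σ = s :- s₀ :- d :* c₀
          in d :* d :* (c₀ :* c₀ :+ s₀ :* s₀) :+ :2 :* (ρ :* (c₀ :- d :* s₀)) :+ :2 :* (σ :* (s₀ :+ d :* c₀))
               :+ ρ :* ρ :+ σ :* σ
             := (c :* c :+ s :* s) :- (c₀ :* c₀ :+ s₀ :* s₀)) refl (c θ) (c φ) (s θ) (s φ) d)
        (±-+ (±-+ (±-+ (±-+
          (±-* (±-nonNeg (square-nonNeg d) ≤-refl) (±-+ (±-* cφ cφ) (±-* sφ sφ)))
          (±-* ±2 (±-* ρ (±-+ cφ (±-neg (±-* d∈±m sφ))))))
          (±-* ±2 (±-* σ (±-+ sφ (±-* d∈±m cφ)))))
          (±-* ρ (ρ-coarse ρ)))
          (±-* σ (ρ-coarse σ))))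
      where
      d = θ - φ
      cφ = c-± bound hφ
      sφ = s-± bound hφ
      ρ = c-taylor bound hθ hφ
      σ = s-taylor bound hθ hφ

      ±2 : nat 2 ∈± nat 2
      ±2 = ±-nonNeg (nat-nonNeg 2) ≤-refl

      d∈±m : d ∈± m
      d∈±m = ±-+ hθ (±-neg hφ)

      ρ-coarse : ∀ {x} → x ∈± d * d * K → x ∈± m * m * K
      -- `bound 0` is 0# ≤ K, the empty sum being 0#. In ρ² and σ² one factor keeps its d² and the
      -- other gets this constant bound.
      ρ-coarse = ±-weaken (*-monoʳ-≤ (bound 0) (±-square d∈±m))

  -- Subdividing [0 , θ] into n parts bounds the total increment by K θ² / n.
  quadratic-increment⇒constant : ∀ (h : ℝ → ℝ) {M K} → 0# ≤ K →
    (∀ {θ φ} → θ ∈± M → φ ∈± M → h θ - h φ ∈± K * ((θ - φ) * (θ - φ))) →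
    ∀ {θ} → θ ∈± M → h θ ≈ h 0#
  quadratic-increment⇒constant h {M} {K} 0≤K increment {θ} hθ =
    ≤-antisym (≤-by-ε λ ε 0<ε → ≤-by (x≤y⇒0≤y-x (proj₂ (close ε 0<ε)))
        (solve 3 (λ a b e → b :+ e :- a := e :- (a :- b)) refl (h θ) (h 0#) ε))
      (≤-by-ε λ ε 0<ε → ≤-by (x≤y⇒0≤y-x (proj₁ (close ε 0<ε)))
        (solve 3 (λ a b e → a :+ e :- b := (a :- b) :- :- e) refl (h θ) (h 0#) ε))
    where
    0≤M = ±⇒nonNeg hθ

    -- `h` is not assumed to respect `_≈_`; the increment bound at equal arguments supplies what is
    -- needed.
    h-cong : ∀ {x y} → x ∈± M → x ≈ y → h x - h y ∈± 0#
    h-cong {x} {y} hx x≈y = ±-weaken (≤-reflexive (trans (*-congˡ (*-congʳ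
        (trans (+-congʳ x≈y) (-‿inverseʳ y)))) (solve 2 (λ k z → k :* (:0 :* z) := :0) refl K (x - y))))
      (increment hx (±-cong x≈y hx))

    close : ∀ ε → 0# < ε → h θ - h 0# ∈± ε
    close ε 0<ε = ±-weaken (≤-trans total (proj₂ small))
        (±-cong (solve 3 (λ a b z → (a :- b) :+ (b :- z) := a :- z) refl (h θ) (h (x N)) (h 0#))
          (±-+ (h-cong hθ (sym x-N)) (steps N ℕ.≤-refl)))
      where
      small = small-reciprocal (*-nonNeg 0≤K (square-nonNeg θ)) 0<ε
      N = suc (proj₁ small)
      i = nat N ⁻¹
      δ = θ * i
      N*i : nat N * i ≈ 1#
      N*i = *-inverse (nat-pos (proj₁ small))

      x : ℕ → ℝ
      x j = nat j * δ

      x-N : x N ≈ θ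
      x-N = trans (solve 3 (λ n t i → n :* (t :* i) := t :* (n :* i)) refl (nat N) θ i)
        (trans (*-congˡ N*i) (*-identityʳ θ))

      x-± : ∀ j → j ℕ.≤ N → x j ∈± M
      x-± j j≤N = ±-weaken (≤-reflexive (*-identityʳ M))
        (±-cong (solve 3 (λ n t i → t :* (n :* i) := n :* (t :* i)) refl (nat j) θ i)
          (±-* hθ (±-nonNeg (*-nonNeg (nat-nonNeg j) 0≤i)
            (≤-trans (*-monoʳ-≤ 0≤i (nat-mono-≤ j≤N)) (≤-reflexive N*i)))))
        where
        0≤i = <⇒≤ (⁻¹-pos (nat-pos (proj₁ small)))

      steps : ∀ j → j ℕ.≤ N → h (x j) - h 0# ∈± nat j * (K * (δ * δ))
      steps zero    _     = ±-weaken (≤-reflexive (sym (zeroˡ _)))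
        (h-cong (x-± 0 ℕ.z≤n) (zeroˡ δ))
      steps (suc j) 1+j≤N = ±-weaken
        (≤-reflexive (begin-equality
          K * ((x (suc j) - x j) * (x (suc j) - x j)) + nat j * (K * (δ * δ))
            ≈⟨ +-congʳ (*-congˡ (*-cong Δ Δ)) ⟩
          K * (δ * δ) + nat j * (K * (δ * δ))
            ≈⟨ solve 2 (λ n k → k :+ n :* k := (:1 :+ n) :* k) refl (nat j) (K * (δ * δ)) ⟩
          (1# + nat j) * (K * (δ * δ))
            ≈⟨ *-congʳ (nat-suc j) ⟨
          nat (suc j) * (K * (δ * δ)) ∎))
        (±-cong (solve 3 (λ a b z → (a :- b) :+ (b :- z) := a :- z) refl _ (h (x j)) (h 0#))
          (±-+ (increment (x-± (suc j) 1+j≤N) (x-± j (ℕ.<⇒≤ 1+j≤N))) (steps j (ℕ.<⇒≤ 1+j≤N))))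
        where
        Δ : x (suc j) - x j ≈ δ
        Δ = trans (+-congʳ (*-congʳ (nat-suc j)))
          (solve 2 (λ n d → (:1 :+ n) :* d :- n :* d := d) refl (nat j) δ)

      total : 0# + nat N * (K * (δ * δ)) ≤ K * (θ * θ) * i
      total = ≤-reflexive (begin-equality
        0# + nat N * (K * (θ * i * (θ * i)))  ≈⟨ solve 4 (λ n k t i → :0 :+ n :* (k :* (t :* i :* (t :* i))) :=
                                                   k :* (t :* t) :* i :* (n :* i)) refl (nat N) K θ i ⟩
        K * (θ * θ) * i * (nat N * i)         ≈⟨ *-congˡ N*i ⟩
        K * (θ * θ) * i * 1#                  ≈⟨ *-identityʳ _ ⟩
        K * (θ * θ) * i                       ∎)

  -- A function with quadratically small increments is constant, and at 0 the value is 1.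
  norm²≈1 : ∀ θ → c θ * c θ + s θ * s θ ≈ 1#
  norm²≈1 θ = begin-equality
    -- The sign of K is not recorded in `norm²-increment`, so K is replaced by the nonnegative K² +
    -- 1.
    norm² θ                    ≈⟨ quadratic-increment⇒constant norm² (±⇒nonNeg (x∈±x²+1 K))
                                    (λ hx hy → ±-weaken (*-monoʳ-≤ (square-nonNeg _) (proj₂ (x∈±x²+1 K)))
                                      (proj₂ increment hx hy)) (x∈±x²+1 θ) ⟩
    norm² 0#                   ≈⟨ +-cong (*-cong c-0 c-0) (*-cong s-0 s-0) ⟩
    1# * 1# + 0# * 0#          ≈⟨ solve 0 (:1 :* :1 :+ :0 :* :0 := :1) refl ⟩
    1#                         ∎
    where
    increment = norm²-increment (±⇒nonNeg (x∈±x²+1 θ))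
    K = proj₁ increment

  c-±1 : ∀ θ → c θ ∈± 1#
  c-±1 θ = ±-from-square 0≤1 (≤-by (square-nonNeg (s θ)) (trans
    (+-congʳ (trans (*-identityˡ 1#) (sym (norm²≈1 θ))))
    (solve 2 (λ c s → c :+ s :- c := s) refl _ _)))

  s-±1 : ∀ θ → s θ ∈± 1#
  s-±1 θ = ±-from-square 0≤1 (≤-by (square-nonNeg (c θ)) (trans
    (+-congʳ (trans (*-identityˡ 1#) (sym (norm²≈1 θ))))
    (solve 2 (λ c s → c :+ s :- s := c) refl _ _)))

  -- D is any bound on ∣θ - φ∣, which keeps the condition free of absolute values.
  LipschitzOn± : ℝ → ℝ → (ℝ → ℝ) → Set
  LipschitzOn± M L f = ∀ {θ φ D} → θ ∈± M → φ ∈± M → θ - φ ∈± D → f θ - f φ ∈± L * D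

  -- In L = 1 + 2MK, the 1 bounds the derivative and 2MK comes from the Taylor remainder, one of
  -- whose two factors θ - φ is bounded by 2M.
  c-s-Lipschitz : ∀ M → 0# ≤ M → ∃ λ L → LipschitzOn± M L c × LipschitzOn± M L s
  c-s-Lipschitz M 0≤M = 1# + (M + M) * K ,
    (λ {θ} {φ} {D} hθ hφ hd → ±-weaken (combine D) (±-cong
      (solve 4 (λ a b d s → :- (d :* s) :+ (a :- b :+ d :* s) := a :- b) refl (c θ) (c φ) (θ - φ) (s φ))
      (±-+ (±-neg (±-* hd (s-±1 φ))) (coarse hθ hφ hd (c-taylor bound hθ hφ))))) ,
    (λ {θ} {φ} {D} hθ hφ hd → ±-weaken (combine D) (±-cong
      (solve 4 (λ a b d s → d :* s :+ (a :- b :- d :* s) := a :- b) refl (s θ) (s φ) (θ - φ) (c φ))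
      (±-+ (±-* hd (c-±1 φ)) (coarse hθ hφ hd (s-taylor bound hθ hφ)))))
    where
    K = proj₁ (pw-sum-bounded 0≤M)

    bound : ∀ n → pw-sum M n ≤ K
    bound = proj₂ (pw-sum-bounded 0≤M)

    coarse : ∀ {θ φ D x} → θ ∈± M → φ ∈± M → θ - φ ∈± D →
             x ∈± (θ - φ) * (θ - φ) * K → x ∈± (M + M) * D * K
    coarse hθ hφ hd = ±-weaken (*-monoʳ-≤ (bound 0) (proj₂ (±-* (±-+ hθ (±-neg hφ)) hd)))

    combine : ∀ D → D * 1# + (M + M) * D * K ≤ (1# + (M + M) * K) * D
    combine D = ≤-reflexive (solve 3 (λ d m k → d :* :1 :+ m :* d :* k := (:1 :+ m :* k) :* d) refl D (M + M) K)

-- Riemann integrability of Lipschitz functions, linearity and monotonicity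

module Integral (em : ExcludedMiddle 0ℓ) (𝓡 : CompleteOrderedField) where

  open Real em 𝓡
  open TaggedPartition
  open Min totalOrder
    using (_⊓_; x≤y⇒x⊓y≈x; ⊓-glb) renaming (x≤y⇒y⊓x≈x to x≥y⇒x⊓y≈y)

  LipschitzOn01 : ℝ → (ℝ → ℝ) → Set
  LipschitzOn01 L g = ∀ {x y D} → 0# ≤ x → x ≤ 1# → 0# ≤ y → y ≤ 1# →
                      x - y ∈± D → g x - g y ∈± L * D

  uniform : ℕ → TaggedPartition
  uniform n = record
    { size    = suc n
    ; pt      = point
    ; tag     = point
    ; pt-0    = zeroˡ _
    ; pt-size = *-inverse (nat-pos n)
    ; pt≤tag  = λ _ _ → ≤-refl
    ; tag≤pt  = λ i _ → *-monoʳ-≤ (<⇒≤ (⁻¹-pos (nat-pos n))) (nat-mono-≤ (ℕ.n≤1+n i))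
    }
    where
    point : ℕ → ℝ
    point i = nat i * nat (suc n) ⁻¹

  Δ : TaggedPartition → ℕ → ℝ
  Δ Q i = pt Q (suc i) - pt Q i

  pt-step : ∀ Q i → i ℕ.< size Q → pt Q i ≤ pt Q (suc i)
  pt-step Q i i<n = ≤-trans (pt≤tag Q i i<n) (tag≤pt Q i i<n)

  Δ-nonNeg : ∀ Q i → i ℕ.< size Q → 0# ≤ Δ Q i
  Δ-nonNeg Q i i<n = x≤y⇒0≤y-x (pt-step Q i i<n)

  ∑Δ≈1 : ∀ Q → ∑ (upTo (size Q)) (Δ Q) ≈ 1#
  ∑Δ≈1 Q = trans (∑-telescope (size Q) (pt Q)) (trans (+-cong (pt-size Q) (-‿cong (pt-0 Q)))
    (solve 0 (:1 :- :0 := :1) refl))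

  pt-mono : ∀ Q {i j} → i ℕ.≤ j → j ℕ.≤ size Q → pt Q i ≤ pt Q j
  pt-mono Q {i} i≤j = go (ℕ.≤⇒≤′ i≤j)
    where
    go : ∀ {j} → i ℕ.≤′ j → j ℕ.≤ size Q → pt Q i ≤ pt Q j
    go (ℕ.≤′-reflexive ≡.refl) _  = ≤-refl
    go (ℕ.≤′-step h) 1+j≤n = ≤-trans (go h (ℕ.<⇒≤ 1+j≤n)) (pt-step Q _ 1+j≤n)

  0≤pt : ∀ Q j → j ℕ.≤ size Q → 0# ≤ pt Q j
  0≤pt Q j h = ≤-trans (≤-reflexive (sym (pt-0 Q))) (pt-mono Q ℕ.z≤n h)

  pt≤1 : ∀ Q j → j ℕ.≤ size Q → pt Q j ≤ 1#
  pt≤1 Q j h = ≤-trans (pt-mono Q h ℕ.≤-refl) (≤-reflexive (pt-size Q))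

  0≤tag : ∀ Q j → j ℕ.< size Q → 0# ≤ tag Q j
  0≤tag Q j h = ≤-trans (0≤pt Q j (ℕ.<⇒≤ h)) (pt≤tag Q j h)

  tag≤1 : ∀ Q j → j ℕ.< size Q → tag Q j ≤ 1#
  tag≤1 Q j h = ≤-trans (tag≤pt Q j h) (pt≤1 Q (suc j) h)

  -- For a ≤ b this is the length of the part of [a , b] to the left of y, a primitive of the
  -- indicator of [a , b].
  clip : ℝ → ℝ → ℝ → ℝ
  clip a b y = y ⊓ b - y ⊓ a

  -- clip a b y - clip a b x is the length of [a , b] ∩ [x , y].
  overlap-nonNeg : ∀ {a b x y v} → a ≤ b → x ≤ y →
            (∀ p → a ≤ p → p ≤ b → x ≤ p → p ≤ y → 0# ≤ v) →
            0# ≤ v * (clip a b y - clip a b x)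
  overlap-nonNeg {a} {b} {x} {y} {v} a≤b x≤y h = cases (≤-total y a) (≤-total b x) (≤-total x a)
    where
    cases : y ≤ a ⊎ a ≤ y → b ≤ x ⊎ x ≤ b → x ≤ a ⊎ a ≤ x → 0# ≤ v * (clip a b y - clip a b x)
    cases (inj₁ y≤a) _ _ = ≤-reflexive (sym (trans (*-congˡ (+-cong
          (+-cong (x≤y⇒x⊓y≈x (≤-trans y≤a a≤b)) (-‿cong (x≤y⇒x⊓y≈x y≤a)))
          (-‿cong (+-cong (x≤y⇒x⊓y≈x (≤-trans x≤y (≤-trans y≤a a≤b))) (-‿cong (x≤y⇒x⊓y≈x (≤-trans x≤y y≤a)))))))
        (solve 3 (λ v x y → v :* ((y :- y) :- (x :- x)) := :0) refl v x y)))
    cases (inj₂ a≤y) (inj₁ b≤x) _ = ≤-reflexive (sym (trans (*-congˡ (+-cong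
          (+-cong (x≥y⇒x⊓y≈y (≤-trans b≤x x≤y)) (-‿cong (x≥y⇒x⊓y≈y a≤y)))
          (-‿cong (+-cong (x≥y⇒x⊓y≈y b≤x) (-‿cong (x≥y⇒x⊓y≈y (≤-trans a≤b b≤x)))))))
        (solve 3 (λ v a b → v :* ((b :- a) :- (b :- a)) := :0) refl v a b)))
    -- In the cases above the length is 0 and the sign of v does not matter. From here on the larger
    -- left endpoint is a common point of both intervals, at which the hypothesis applies.
    cases (inj₂ a≤y) (inj₂ x≤b) (inj₁ x≤a) = *-nonNeg (h a ≤-refl a≤b x≤a a≤y) (≤-trans (x≤y⇒0≤y-x (⊓-glb a≤y a≤b))
          (≤-reflexive (sym (trans (+-cong (+-congˡ (-‿cong (x≥y⇒x⊓y≈y a≤y)))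
              (-‿cong (+-cong (x≤y⇒x⊓y≈x x≤b) (-‿cong (x≤y⇒x⊓y≈x x≤a)))))
            (solve 3 (λ m a x → m :- a :- (x :- x) := m :- a) refl (y ⊓ b) a x)))))
    cases (inj₂ a≤y) (inj₂ x≤b) (inj₂ a≤x) = *-nonNeg (h x a≤x x≤b ≤-refl x≤y) (≤-trans (x≤y⇒0≤y-x (⊓-glb x≤y x≤b))
          (≤-reflexive (sym (trans (+-cong (+-congˡ (-‿cong (x≥y⇒x⊓y≈y a≤y)))
              (-‿cong (+-cong (x≤y⇒x⊓y≈x x≤b) (-‿cong (x≥y⇒x⊓y≈y a≤x)))))
            (solve 3 (λ m a x → m :- a :- (x :- a) := m :- x) refl (y ⊓ b) a x)))))

  ±-within : ∀ {a b x y} → a ≤ x → x ≤ b → a ≤ y → y ≤ b → x - y ∈± b - a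
  ±-within {a} {b} {x} {y} a≤x x≤b a≤y y≤b =
    ≤-by (+-nonNeg (x≤y⇒0≤y-x a≤x) (x≤y⇒0≤y-x y≤b))
      (solve 4 (λ a b x y → (x :- y) :- :- (b :- a) := (x :- a) :+ (b :- y)) refl a b x y) ,
    ≤-by (+-nonNeg (x≤y⇒0≤y-x a≤y) (x≤y⇒0≤y-x x≤b))
      (solve 4 (λ a b x y → (b :- a) :- (x :- y) := (y :- a) :+ (b :- x)) refl a b x y)

  module Lipschitz {g : ℝ → ℝ} {L : ℝ} (lip : LipschitzOn01 L g) where

    L-nonNeg : 0# ≤ L
    L-nonNeg = ≤-trans (±⇒nonNeg (lip 0≤1 ≤-refl ≤-refl 0≤1
        (±-cong (solve 0 (:1 := :1 :- :0) refl) (±-nonNeg 0≤1 ≤-refl))))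
      (≤-reflexive (*-identityʳ L))

    -- Darboux sums in which the infimum and supremum over a piece are replaced by the bounds that
    -- the tag value and the Lipschitz condition give.
    lower upper : TaggedPartition → ℝ
    lower Q = ∑[ i ∈ upTo (size Q) ] ((g (tag Q i) - L * Δ Q i) * Δ Q i)
    upper Q = ∑[ i ∈ upTo (size Q) ] ((g (tag Q i) + L * Δ Q i) * Δ Q i)

    -- In place of a common refinement, the upper step function of Q′ is integrated in closed form
    -- over each piece of Q by means of `clip`.
    lower≤upper : ∀ Q Q′ → lower Q ≤ upper Q′
    lower≤upper Q Q′ = begin
      lower Q                                                       ≤⟨ ∑-upTo-mono (size Q) piece ⟩
      (∑[ i ∈ upTo (size Q) ] (U (pt Q (suc i)) - U (pt Q i)))      ≈⟨ ∑-telescope (size Q) (U ∘ pt Q) ⟩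
      U (pt Q (size Q)) - U (pt Q 0)                                ≈⟨ ∑-- (upTo n′) _ _ ⟨
      ∑[ j ∈ upTo n′ ] (u j * step j (pt Q (size Q)) - u j * step j (pt Q 0)) ≤⟨ ∑-upTo-mono n′ ends ⟩
      upper Q′                                                      ∎
      where
      n′ = size Q′

      u : ℕ → ℝ
      u j = g (tag Q′ j) + L * Δ Q′ j

      step : ℕ → ℝ → ℝ
      step j = clip (pt Q′ j) (pt Q′ (suc j))

      -- The primitive of the upper step function of Q′; over a piece of Q with tag t and
      -- length ℓ, its slope is at least g t - L ℓ.
      U : ℝ → ℝ
      U y = ∑[ j ∈ upTo n′ ] (u j * step j y)

      ends : ∀ j → j ℕ.< n′ → u j * step j (pt Q (size Q)) - u j * step j (pt Q 0) ≤ u j * Δ Q′ j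
      ends j j<n′ = ≤-reflexive (trans (+-cong
          (*-congˡ (+-cong (at-1 (suc j) j<n′) (-‿cong (at-1 j (ℕ.<⇒≤ j<n′)))))
          (-‿cong (*-congˡ (+-cong (at-0 (suc j) j<n′) (-‿cong (at-0 j (ℕ.<⇒≤ j<n′)))))))
        (solve 4 (λ u a b z → u :* (b :- a) :- u :* (z :- z) := u :* (b :- a)) refl (u j) _ _ _))
        where
        at-1 : ∀ j → j ℕ.≤ n′ → pt Q (size Q) ⊓ pt Q′ j ≈ pt Q′ j
        at-1 j h = x≥y⇒x⊓y≈y (≤-trans (pt≤1 Q′ j h) (≤-reflexive (sym (pt-size Q))))

        at-0 : ∀ j → j ℕ.≤ n′ → pt Q 0 ⊓ pt Q′ j ≈ pt Q 0
        at-0 j h = x≤y⇒x⊓y≈x (≤-trans (≤-reflexive (pt-0 Q)) (0≤pt Q′ j h))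

      piece : ∀ i → i ℕ.< size Q → (g (tag Q i) - L * Δ Q i) * Δ Q i ≤ U (pt Q (suc i)) - U (pt Q i)
      -- The pieces of Q′ cover [0 , 1], so y - x is the sum of the overlaps of [x , y] with them;
      -- the claim then splits over j.
      piece i i<n = ≤-by (≤-trans (≤-reflexive (sym (∑-zero (upTo n′)))) (∑-upTo-mono n′ nonNeg)) (begin-equality
        U y - U x - m * (y - x)
          ≈⟨ +-cong (∑-- (upTo n′) _ _) (-‿cong (*-congˡ (+-cong (total y (0≤pt Q (suc i) i<n) (pt≤1 Q (suc i) i<n))
               (-‿cong (total x (0≤pt Q i (ℕ.<⇒≤ i<n)) (pt≤1 Q i (ℕ.<⇒≤ i<n))))))) ⟨
        (∑[ j ∈ upTo n′ ] (u j * step j y - u j * step j x)) - m * (∑ (upTo n′) (λ j → step j y) - ∑ (upTo n′) (λ j → step j x))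
          ≈⟨ +-congˡ (-‿cong (trans (*-congˡ (sym (∑-- (upTo n′) _ _))) (sym (∑-*ˡ (upTo n′) m _)))) ⟩
        (∑[ j ∈ upTo n′ ] (u j * step j y - u j * step j x)) - (∑[ j ∈ upTo n′ ] (m * (step j y - step j x)))
          ≈⟨ ∑-- (upTo n′) _ _ ⟨
        ∑[ j ∈ upTo n′ ] (u j * step j y - u j * step j x - m * (step j y - step j x))
          ≈⟨ ∑-cong (upTo n′) (λ j → solve 4 (λ u m p q → u :* p :- u :* q :- m :* (p :- q) := (u :- m) :* (p :- q)) refl (u j) m _ _) ⟩
        ∑[ j ∈ upTo n′ ] ((u j - m) * (step j y - step j x)) ∎)
        where
        x = pt Q i
        y = pt Q (suc i)
        m = g (tag Q i) - L * (y - x)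

        total : ∀ z → 0# ≤ z → z ≤ 1# → ∑ (upTo n′) (λ j → step j z) ≈ z
        total z 0≤z z≤1 = trans (∑-telescope n′ (λ j → z ⊓ pt Q′ j)) (trans (+-cong
            (x≤y⇒x⊓y≈x (≤-trans z≤1 (≤-reflexive (sym (pt-size Q′)))))
            (-‿cong (trans (x≥y⇒x⊓y≈y (≤-trans (≤-reflexive (pt-0 Q′)) 0≤z)) (pt-0 Q′))))
          (solve 1 (λ z → z :- :0 := z) refl z))

        nonNeg : ∀ j → j ℕ.< n′ → 0# ≤ (u j - m) * (step j y - step j x)
        -- A common point p links the two tags: g t - L Δ ≤ g p ≤ g t′ + L Δ′.
        nonNeg j j<n′ = overlap-nonNeg (pt-step Q′ j j<n′) (pt-step Q i i<n) λ p a≤p p≤b x≤p p≤y →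
          let 0≤p = ≤-trans (0≤pt Q i (ℕ.<⇒≤ i<n)) x≤p
              p≤1 = ≤-trans p≤y (pt≤1 Q (suc i) i<n)
              near-tag  = lip 0≤p p≤1 (0≤tag Q i i<n) (tag≤1 Q i i<n)
                (±-within x≤p p≤y (pt≤tag Q i i<n) (tag≤pt Q i i<n))
              near-tag′ = lip (0≤tag Q′ j j<n′) (tag≤1 Q′ j j<n′) 0≤p p≤1
                (±-within (pt≤tag Q′ j j<n′) (tag≤pt Q′ j j<n′) a≤p p≤b)
          in ≤-by (+-nonNeg (x≤y⇒0≤y-x (proj₁ near-tag)) (x≤y⇒0≤y-x (proj₁ near-tag′)))
               (solve 5 (λ t t′ p D D′ → (t′ :+ D′ :- (t :- D)) :- :0 := ((p :- t) :- :- D) :+ ((t′ :- p) :- :- D′))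
                 refl (g (tag Q i)) (g (tag Q′ j)) (g p) (L * (y - x)) (L * Δ Q′ j))

    private
      I-sup = supremum (λ v → ∃ λ Q → v ≈ lower Q) (lower (uniform 0) , uniform 0 , refl)
        (upper (uniform 0) , λ v (Q , v≈) → ≤-trans (≤-reflexive v≈) (lower≤upper Q (uniform 0)))
      I = proj₁ I-sup

      lower≤I : ∀ Q → lower Q ≤ I
      lower≤I Q = proj₁ (proj₂ I-sup) _ (Q , refl)

      I≤upper : ∀ Q → I ≤ upper Q
      I≤upper Q = proj₂ (proj₂ I-sup) _ λ v (Q′ , v≈) → ≤-trans (≤-reflexive v≈) (lower≤upper Q′ Q)

      defect : TaggedPartition → ℝ
      defect Q = ∑[ i ∈ upTo (size Q) ] (L * Δ Q i * Δ Q i)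

      -- The Riemann sum lies midway between `lower Q` and `upper Q`, which enclose I, at distance
      -- `defect Q` from either.
      riemann-± : ∀ Q → riemannSum g Q - I ∈± defect Q
      riemann-± Q =
        ≤-by (x≤y⇒0≤y-x (I≤upper Q)) (trans
          (solve 3 (λ s i d → s :- i :- :- d := s :+ d :- i) refl (riemannSum g Q) I (defect Q))
          (+-congʳ (trans (sym (∑-+ (upTo (size Q)) _ _)) (∑-cong (upTo (size Q)) λ i → sym (distribʳ _ _ _))))) ,
        ≤-by (x≤y⇒0≤y-x (lower≤I Q)) (trans
          (solve 3 (λ s i d → d :- (s :- i) := i :- (s :- d)) refl (riemannSum g Q) I (defect Q))
          (+-congˡ (-‿cong (trans (sym (∑-- (upTo (size Q)) _ _)) (∑-cong (upTo (size Q)) λ i →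
            solve 3 (λ g l d → g :* d :- l :* d := (g :- l) :* d) refl _ _ _)))))

      defect≤ : ∀ Q δ → MeshBelow δ Q → defect Q ≤ L * δ
      defect≤ Q δ mesh = begin
        defect Q                                     ≤⟨ ∑-upTo-mono (size Q) (λ i i<n → *-monoʳ-≤ (Δ-nonNeg Q i i<n)
                                                          (*-monoˡ-≤ L-nonNeg (<⇒≤ (mesh i i<n)))) ⟩
        (∑[ i ∈ upTo (size Q) ] (L * δ * Δ Q i))     ≈⟨ ∑-*ˡ (upTo (size Q)) (L * δ) (Δ Q) ⟩
        L * δ * ∑ (upTo (size Q)) (Δ Q)              ≈⟨ *-congˡ (∑Δ≈1 Q) ⟩
        L * δ * 1#                                   ≈⟨ *-identityʳ _ ⟩
        L * δ                                        ∎

    integrable : ∃ (HasIntegral g)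
    integrable = I , λ ε 0<ε →
      let 0<L+1 = <-≤-trans (+-pos-nonNeg 0<1 L-nonNeg) (≤-reflexive (+-comm 1# L))
          δ   = (L + 1#) ⁻¹ * (½ * ε)
          0<δ = *-pos (⁻¹-pos 0<L+1) (½*-pos 0<ε)
      in δ , 0<δ , λ Q mesh → ±⇒Within 0<ε (±-weaken (≤-trans (defect≤ Q δ mesh) (begin
           L * δ                              ≤⟨ *-monoʳ-≤ (<⇒≤ 0<δ) (≤-by 0≤1 (solve 1 (λ l → l :+ :1 :- l := :1) refl L)) ⟩
           (L + 1#) * δ                       ≈⟨ *-assoc _ _ _ ⟨
           (L + 1#) * (L + 1#) ⁻¹ * (½ * ε)   ≈⟨ *-congʳ (*-inverse 0<L+1) ⟩
           1# * (½ * ε)                       ≈⟨ *-identityˡ _ ⟩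
           ½ * ε                              ∎)) (riemann-± Q))

  ∫-spec : ∀ {g} → ∃ (HasIntegral g) → HasIntegral g (∫ g)
  ∫-spec {g} = the-spec {HasIntegral g}

  HasIntegral± : (ℝ → ℝ) → ℝ → Set
  HasIntegral± g I = ∀ ε → 0# < ε → ∃ λ δ → 0# < δ ×
    (∀ Q → MeshBelow δ Q → riemannSum g Q - I ∈± ε)

  HasIntegral⇒± : ∀ {g I} → HasIntegral g I → HasIntegral± g I
  HasIntegral⇒± {g} {I} h ε 0<ε = let (δ , 0<δ , k) = h ε 0<ε in δ , 0<δ , λ Q mesh →
    ≤-trans (-‿anti-≤ (<⇒≤ (proj₂ (k Q mesh))))
      (≤-reflexive (solve 2 (λ u l → :- (l :- u) := u :- l) refl _ I)) ,
    <⇒≤ (proj₁ (k Q mesh))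

  ±⇒HasIntegral : ∀ {g I} → HasIntegral± g I → HasIntegral g I
  ±⇒HasIntegral h ε 0<ε = let (δ , 0<δ , k) = h (½ * ε) (½*-pos 0<ε) in
    δ , 0<δ , λ Q mesh → ±⇒Within 0<ε (k Q mesh)

  common-lower : ∀ {x y} → 0# < x → 0# < y → ∃ λ z → 0# < z × z ≤ x × z ≤ y
  common-lower {x} {y} 0<x 0<y with ≤-total x y
  ... | inj₁ x≤y = x , 0<x , ≤-refl , x≤y
  ... | inj₂ y≤x = y , 0<y , y≤x , ≤-refl

  mesh-weaken : ∀ {δ δ′ Q} → δ ≤ δ′ → MeshBelow δ Q → MeshBelow δ′ Q
  mesh-weaken δ≤δ′ mesh i i<n = <-≤-trans (mesh i i<n) δ≤δ′

  common-mesh : ∀ {g h I J} → HasIntegral g I → HasIntegral h J → ∀ ε → 0# < ε →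
                ∃ λ δ → 0# < δ × (∀ Q → MeshBelow δ Q →
                  riemannSum g Q - I ∈± ½ * ε × riemannSum h Q - J ∈± ½ * ε)
  common-mesh {g} {h} hg hh ε 0<ε =
    let (δ₁ , 0<δ₁ , k₁) = HasIntegral⇒± {g} hg (½ * ε) (½*-pos 0<ε)
        (δ₂ , 0<δ₂ , k₂) = HasIntegral⇒± {h} hh (½ * ε) (½*-pos 0<ε)
        (δ , 0<δ , δ≤δ₁ , δ≤δ₂) = common-lower 0<δ₁ 0<δ₂
    in δ , 0<δ , λ Q mesh → k₁ Q (mesh-weaken {Q = Q} δ≤δ₁ mesh) , k₂ Q (mesh-weaken {Q = Q} δ≤δ₂ mesh)

  integral-+ : ∀ {g h I J} → HasIntegral g I → HasIntegral h J → HasIntegral (λ x → g x + h x) (I + J)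
  integral-+ {g} {h} {I} {J} hg hh = ±⇒HasIntegral {λ x → g x + h x} λ ε 0<ε →
    let (δ , 0<δ , k) = common-mesh {g} {h} hg hh ε 0<ε in
    δ , 0<δ , λ Q mesh → ±-weaken (≤-reflexive (½+½ ε)) (±-cong (begin-equality
      riemannSum g Q - I + (riemannSum h Q - J)      ≈⟨ solve 4 (λ u v k l → (u :- k) :+ (v :- l) := (u :+ v) :- (k :+ l)) refl _ _ I J ⟩
      riemannSum g Q + riemannSum h Q - (I + J)      ≈⟨ +-congʳ (∑-+ (upTo (size Q)) _ _) ⟨
      (∑[ i ∈ upTo (size Q) ] (g (tag Q i) * Δ Q i + h (tag Q i) * Δ Q i)) - (I + J)
        ≈⟨ +-congʳ (∑-cong (upTo (size Q)) λ i → distribʳ _ _ _) ⟨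
      riemannSum (λ x → g x + h x) Q - (I + J)       ∎)
      (±-+ (proj₁ (k Q mesh)) (proj₂ (k Q mesh))))

  riemannSum-const : ∀ c Q → riemannSum (λ _ → c) Q ≈ c
  riemannSum-const c Q = trans (∑-*ˡ (upTo (size Q)) c (Δ Q)) (trans (*-congˡ (∑Δ≈1 Q)) (*-identityʳ c))

  integral-const : ∀ c → HasIntegral (λ _ → c) c
  integral-const c = ±⇒HasIntegral {λ _ → c} λ ε 0<ε → 1# , 0<1 , λ Q _ →
    ±-cong (sym (trans (+-congʳ (riemannSum-const c Q)) (-‿inverseʳ c))) (±-zero (<⇒≤ 0<ε))

  integral-*ˡ : ∀ c {g I} → HasIntegral g I → HasIntegral (λ x → c * g x) (c * I)
  integral-*ˡ c {g} {I} hg = ±⇒HasIntegral {λ x → c * g x} λ ε 0<ε →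
    let b   = c * c + 1#
        0<b = <-≤-trans (+-pos-nonNeg 0<1 (square-nonNeg c)) (≤-reflexive (+-comm _ _))
        (δ , 0<δ , k) = HasIntegral⇒± {g} hg (b ⁻¹ * ε) (*-pos (⁻¹-pos 0<b) 0<ε)
    in δ , 0<δ , λ Q mesh → ±-weaken
      (≤-reflexive (trans (sym (*-assoc _ _ _)) (trans (*-congʳ (*-inverse 0<b)) (*-identityˡ ε))))
      (±-cong (begin-equality
          c * (riemannSum g Q - I)                                    ≈⟨ solve 3 (λ c u l → c :* (u :- l) := c :* u :- c :* l) refl c _ I ⟩
          c * riemannSum g Q - c * I                                  ≈⟨ +-congʳ (∑-*ˡ (upTo (size Q)) c _) ⟨
          (∑[ i ∈ upTo (size Q) ] (c * (g (tag Q i) * Δ Q i))) - c * I ≈⟨ +-congʳ (∑-cong (upTo (size Q)) λ i → *-assoc _ _ _) ⟨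
          riemannSum (λ x → c * g x) Q - c * I                        ∎)
        (±-* (x∈±x²+1 c) (k Q mesh)))

  integral-∑ : ∀ {A : Set} (xs : List A) {g : A → ℝ → ℝ} {I : A → ℝ} →
               (∀ a → HasIntegral (g a) (I a)) → HasIntegral (λ x → ∑[ a ∈ xs ] g a x) (∑ xs I)
  integral-∑ []       h = integral-const 0#
  integral-∑ (a ∷ xs) {g} h = integral-+ {g a} {λ x → ∑[ a ∈ xs ] g a x} (h a) (integral-∑ xs {g} h)

  -- Guards against vacuity of `HasIntegral`: two integrals are compared at one partition where both
  -- Riemann sums are close to them.
  fine-partition : ∀ δ → 0# < δ → ∃ (MeshBelow δ)
  fine-partition δ 0<δ = let (n , h) = small-reciprocal 0≤1 (½*-pos 0<δ) in
    uniform n , λ i _ → ≤-<-trans (begin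
      nat (suc i) * nat (suc n) ⁻¹ - nat i * nat (suc n) ⁻¹   ≈⟨ +-congʳ (*-congʳ (nat-suc i)) ⟩
      (1# + nat i) * nat (suc n) ⁻¹ - nat i * nat (suc n) ⁻¹  ≈⟨ solve 2 (λ i j → (:1 :+ i) :* j :- i :* j := :1 :* j) refl _ _ ⟩
      1# * nat (suc n) ⁻¹                                     ≤⟨ h ⟩
      ½ * δ                                                   ∎) (½x<x 0<δ)

  integral-mono : ∀ {g h I J} → HasIntegral g I → HasIntegral h J → (∀ x → g x ≤ h x) → I ≤ J
  integral-mono {g} {h} {I} {J} hg hh g≤h = ≤-by-ε λ ε 0<ε →
    let (δ , 0<δ , k) = common-mesh {g} {h} hg hh ε 0<ε
        (Q , mesh)    = fine-partition δ 0<δ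
    in conclude ε Q (proj₁ (proj₁ (k Q mesh))) (proj₂ (proj₂ (k Q mesh)))
    where
    conclude : ∀ ε Q → - (½ * ε) ≤ riemannSum g Q - I → riemannSum h Q - J ≤ ½ * ε → I ≤ J + ε
    conclude ε Q lo hi = begin
      I                                ≤⟨ ≤-by (x≤y⇒0≤y-x lo)
        (solve 3 (λ u k e → u :+ e :- k := u :- k :- :- e) refl (riemannSum g Q) I (½ * ε)) ⟩
      riemannSum g Q + ½ * ε           ≤⟨ +-monoˡ-≤ (½ * ε) sums ⟩
      riemannSum h Q + ½ * ε           ≤⟨ ≤-by (x≤y⇒0≤y-x hi)
        (solve 3 (λ v l e → (l :+ (e :+ e)) :- (v :+ e) := e :- (v :- l)) refl (riemannSum h Q) J (½ * ε)) ⟩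
      J + (½ * ε + ½ * ε)              ≈⟨ +-congˡ (½+½ ε) ⟩
      J + ε                            ∎
      where
      sums : riemannSum g Q ≤ riemannSum h Q
      sums = ∑-upTo-mono (size Q) {λ i → g (tag Q i) * Δ Q i} {λ i → h (tag Q i) * Δ Q i}
        λ i i<n → *-monoʳ-≤ (Δ-nonNeg Q i i<n) (g≤h (tag Q i))

-- Moments of sums with random signs

module Rademacher (em : ExcludedMiddle 0ℓ) (𝓡 : CompleteOrderedField) where

  open Real em 𝓡

  signs : List Sign
  signs = Sign.- ∷ Sign.+ ∷ []

  -- Expectations are kept unnormalised, as sums over all sign vectors, with `2^ n` in the role of
  -- total mass.
  ∑± : ∀ n → (Vec Sign n → ℝ) → ℝ
  ∑± n = ∑ (allVecs signs n)

  ∑±-suc : ∀ n F → ∑± (suc n) F ≈ ∑± n (λ f → F (Sign.- ∷ f) + F (Sign.+ ∷ f))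
  ∑±-suc n F = trans (∑-allVecs signs n F)
    (trans (+-congˡ (+-identityʳ _)) (sym (∑-+ (allVecs signs n) _ _)))

  2^ : ℕ → ℝ
  2^ n = ∑± n (λ _ → 1#)

  2^-pos : ∀ n → 0# < 2^ n
  2^-pos zero    = +-pos-nonNeg 0<1 ≤-refl
  2^-pos (suc n) = <-≤-trans (+-pos-nonNeg (2^-pos n) (<⇒≤ (2^-pos n)))
    (≤-reflexive (sym (trans (∑±-suc n _) (∑-+ (allVecs signs n) _ _))))

  2^-suc : ∀ n → 2^ (suc n) ≈ 2^ n + 2^ n
  2^-suc n = trans (∑±-suc n _) (∑-+ (allVecs signs n) _ _)

  ∑±-const : ∀ n c → ∑± n (λ _ → c) ≈ c * 2^ n
  ∑±-const n c = trans (∑-cong (allVecs signs n) λ _ → sym (*-identityʳ c)) (∑-*ˡ (allVecs signs n) c _)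

  dot : ∀ {n} → (Fin n → ℝ) → Vec Sign n → ℝ
  dot {n} b f = ∑[ i ∈ allFin n ] (signValue (lookup f i) * b i)

  energy : ∀ {n} → (Fin n → ℝ) → ℝ
  energy {n} b = ∑[ i ∈ allFin n ] (b i * b i)

  energy-nonNeg : ∀ {n} (b : Fin n → ℝ) → 0# ≤ energy b
  energy-nonNeg {n} b = ∑-nonNeg (allFin n) λ i → square-nonNeg (b i)

  energy-suc : ∀ {n} (b : Fin (suc n) → ℝ) → energy b ≈ b Fin.zero * b Fin.zero + energy (b ∘ Fin.suc)
  energy-suc {n} b = reflexive (∑-allFin-suc n _)

  dot-⁻ : ∀ {n} (b : Fin (suc n) → ℝ) f → dot b (Sign.- ∷ f) ≈ dot (b ∘ Fin.suc) f - b Fin.zero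
  dot-⁻ {n} b f = trans (reflexive (∑-allFin-suc n _))
    (solve 2 (λ a t → :- :1 :* a :+ t := t :- a) refl (b Fin.zero) (dot (b ∘ Fin.suc) f))

  dot-⁺ : ∀ {n} (b : Fin (suc n) → ℝ) f → dot b (Sign.+ ∷ f) ≈ dot (b ∘ Fin.suc) f + b Fin.zero
  dot-⁺ {n} b f = trans (reflexive (∑-allFin-suc n _))
    (solve 2 (λ a t → :1 :* a :+ t := t :+ a) refl (b Fin.zero) (dot (b ∘ Fin.suc) f))

  -- The cross terms vanish because flipping a sign with b i ≉ 0# preserves the weight.
  weighted-second-moment : ∀ n (w : Vec Sign n → ℝ) (b : Fin n → ℝ) →
    (∀ i → b i ≈ 0# ⊎ (∀ f t → w (f [ i ]≔ t) ≈ w f)) →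
    ∑± n (λ f → w f * (dot b f * dot b f)) ≈ ∑± n w * energy b
  weighted-second-moment zero    w b _   = solve 1 (λ w → w :* (:0 :* :0) :+ :0 := (w :+ :0) :* :0) refl (w [])
  weighted-second-moment (suc n) w b inv = begin-equality
    ∑± (suc n) (λ f → w f * (dot b f * dot b f))
      ≈⟨ ∑±-suc n _ ⟩
    ∑± n (λ f → w⁻ f * (dot b (Sign.- ∷ f) * dot b (Sign.- ∷ f)) + w⁺ f * (dot b (Sign.+ ∷ f) * dot b (Sign.+ ∷ f)))
      ≈⟨ ∑-cong (allVecs signs n) (λ f → +-cong (*-congˡ (*-cong (dot-⁻ b f) (dot-⁻ b f))) (*-congˡ (*-cong (dot-⁺ b f) (dot-⁺ b f)))) ⟩
    ∑± n (λ f → w⁻ f * ((d f - a) * (d f - a)) + w⁺ f * ((d f + a) * (d f + a)))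
      ≈⟨ ∑-cong (allVecs signs n) (λ f → cancel f (inv Fin.zero)) ⟩
    ∑± n (λ f → w⁻ f * (d f * d f) + w⁺ f * (d f * d f) + a * a * (w⁻ f + w⁺ f))
      ≈⟨ trans (∑-+ (allVecs signs n) _ _) (+-cong (∑-+ (allVecs signs n) _ _)
           (trans (∑-*ˡ (allVecs signs n) (a * a) _) (*-congˡ (∑-+ (allVecs signs n) _ _)))) ⟩
    ∑± n (λ f → w⁻ f * (d f * d f)) + ∑± n (λ f → w⁺ f * (d f * d f)) + a * a * (∑± n w⁻ + ∑± n w⁺)
      ≈⟨ +-congʳ (+-cong (weighted-second-moment n w⁻ b′ (λ i → tail-inv Sign.- i (inv (Fin.suc i))))
           (weighted-second-moment n w⁺ b′ (λ i → tail-inv Sign.+ i (inv (Fin.suc i))))) ⟩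
    ∑± n w⁻ * energy b′ + ∑± n w⁺ * energy b′ + a * a * (∑± n w⁻ + ∑± n w⁺)
      ≈⟨ solve 4 (λ p q e a → p :* e :+ q :* e :+ a :* a :* (p :+ q) := (p :+ q) :* (a :* a :+ e)) refl (∑± n w⁻) (∑± n w⁺) (energy b′) a ⟩
    (∑± n w⁻ + ∑± n w⁺) * (a * a + energy b′)
      ≈⟨ *-cong (trans (∑±-suc n w) (∑-+ (allVecs signs n) _ _)) (energy-suc b) ⟨
    ∑± (suc n) w * energy b ∎
    where
    a = b Fin.zero
    b′ = b ∘ Fin.suc

    w⁻ w⁺ d : Vec Sign n → ℝ
    w⁻ f = w (Sign.- ∷ f)
    w⁺ f = w (Sign.+ ∷ f)
    d = dot b′

    tail-inv : ∀ s i → b (Fin.suc i) ≈ 0# ⊎ (∀ f t → w (f [ Fin.suc i ]≔ t) ≈ w f) →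
               b′ i ≈ 0# ⊎ (∀ f t → w (s ∷ (f [ i ]≔ t)) ≈ w (s ∷ f))
    tail-inv s i (inj₁ z) = inj₁ z
    tail-inv s i (inj₂ h) = inj₂ λ f t → h (s ∷ f) t

    cancel : ∀ f → a ≈ 0# ⊎ (∀ f t → w (f [ Fin.zero ]≔ t) ≈ w f) →
             w⁻ f * ((d f - a) * (d f - a)) + w⁺ f * ((d f + a) * (d f + a)) ≈
             w⁻ f * (d f * d f) + w⁺ f * (d f * d f) + a * a * (w⁻ f + w⁺ f)
    cancel f (inj₁ a≈0) = begin-equality
      w⁻ f * ((d f - a) * (d f - a)) + w⁺ f * ((d f + a) * (d f + a))
        ≈⟨ solve 4 (λ p q d a → p :* ((d :- a) :* (d :- a)) :+ q :* ((d :+ a) :* (d :+ a))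
             := p :* (d :* d) :+ q :* (d :* d) :+ a :* a :* (p :+ q) :+ a :* ((q :- p) :* (:2 :* d))) refl (w⁻ f) (w⁺ f) (d f) a ⟩
      w⁻ f * (d f * d f) + w⁺ f * (d f * d f) + a * a * (w⁻ f + w⁺ f) + a * ((w⁺ f - w⁻ f) * (nat 2 * d f))
        ≈⟨ +-congˡ (trans (*-congʳ a≈0) (zeroˡ _)) ⟩
      w⁻ f * (d f * d f) + w⁺ f * (d f * d f) + a * a * (w⁻ f + w⁺ f) + 0#
        ≈⟨ +-identityʳ _ ⟩
      w⁻ f * (d f * d f) + w⁺ f * (d f * d f) + a * a * (w⁻ f + w⁺ f) ∎
    cancel f (inj₂ h) = begin-equality
      w⁻ f * ((d f - a) * (d f - a)) + w⁺ f * ((d f + a) * (d f + a))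
        ≈⟨ +-congˡ (*-congʳ w⁺≈w⁻) ⟩
      w⁻ f * ((d f - a) * (d f - a)) + w⁻ f * ((d f + a) * (d f + a))
        ≈⟨ solve 3 (λ p d a → p :* ((d :- a) :* (d :- a)) :+ p :* ((d :+ a) :* (d :+ a))
             := p :* (d :* d) :+ p :* (d :* d) :+ a :* a :* (p :+ p)) refl (w⁻ f) (d f) a ⟩
      w⁻ f * (d f * d f) + w⁻ f * (d f * d f) + a * a * (w⁻ f + w⁻ f)
        ≈⟨ +-cong (+-congˡ (*-congʳ w⁺≈w⁻)) (*-congˡ (+-congˡ w⁺≈w⁻)) ⟨
      w⁻ f * (d f * d f) + w⁺ f * (d f * d f) + a * a * (w⁻ f + w⁺ f) ∎
      where
      w⁺≈w⁻ : w⁺ f ≈ w⁻ f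
      w⁺≈w⁻ = h (Sign.- ∷ f) Sign.+

  second-moment : ∀ n (b : Fin n → ℝ) → ∑± n (λ f → dot b f * dot b f) ≈ 2^ n * energy b
  second-moment n b = trans (∑-cong (allVecs signs n) λ f → sym (*-identityˡ _))
    (weighted-second-moment n (λ _ → 1#) b λ _ → inj₂ λ _ _ → refl)

  -- Khinchine's inequality for exponent 4. Averaging over the first sign turns (d ± a)⁴ into d⁴ +
  -- 6a²d² + a⁴; with E d² = e and E d⁴ ≤ 3e² this averages to at most 3(e + a²)².
  fourth-moment : ∀ n (b : Fin n → ℝ) →
    ∑± n (λ f → dot b f * dot b f * (dot b f * dot b f)) ≤ nat 3 * (energy b * energy b) * 2^ n
  fourth-moment zero    b = ≤-reflexive
    (solve 0 (:0 :* :0 :* (:0 :* :0) :+ :0 := :3 :* (:0 :* :0) :* (:1 :+ :0)) refl)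
  fourth-moment (suc n) b = begin
    ∑± (suc n) (λ f → dot b f * dot b f * (dot b f * dot b f))
      ≈⟨ ∑±-suc n _ ⟩
    ∑± n (λ f → D⁻ f * D⁻ f * (D⁻ f * D⁻ f) + D⁺ f * D⁺ f * (D⁺ f * D⁺ f))
      ≈⟨ ∑-cong (allVecs signs n) (λ f → +-cong
           (*-cong (*-cong (dot-⁻ b f) (dot-⁻ b f)) (*-cong (dot-⁻ b f) (dot-⁻ b f)))
           (*-cong (*-cong (dot-⁺ b f) (dot-⁺ b f)) (*-cong (dot-⁺ b f) (dot-⁺ b f)))) ⟩
    ∑± n (λ f → (d f - a) * (d f - a) * ((d f - a) * (d f - a)) + (d f + a) * (d f + a) * ((d f + a) * (d f + a)))
      ≈⟨ ∑-cong (allVecs signs n) (λ f → solve 2 (λ d a →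
           (d :- a) :* (d :- a) :* ((d :- a) :* (d :- a)) :+ (d :+ a) :* (d :+ a) :* ((d :+ a) :* (d :+ a))
           := :2 :* (d :* d :* (d :* d)) :+ con-12 :* (a :* a) :* (d :* d) :+ :2 :* (a :* a :* (a :* a))) refl (d f) a) ⟩
    ∑± n (λ f → nat 2 * (d f * d f * (d f * d f)) + nat 12 * (a * a) * (d f * d f) + nat 2 * (a * a * (a * a)))
      ≈⟨ trans (∑-+ (allVecs signs n) _ _) (+-cong (trans (∑-+ (allVecs signs n) _ _)
           (+-cong (∑-*ˡ (allVecs signs n) _ _) (trans (∑-*ˡ (allVecs signs n) _ _) (*-congˡ (second-moment n b′))))) (∑±-const n _)) ⟩
    nat 2 * ∑± n (λ f → d f * d f * (d f * d f)) + nat 12 * (a * a) * (2^ n * e) + nat 2 * (a * a * (a * a)) * 2^ n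
      ≤⟨ +-monoˡ-≤ _ (+-monoˡ-≤ _ (*-monoˡ-≤ (nat-nonNeg 2) (fourth-moment n b′))) ⟩
    nat 2 * (nat 3 * (e * e) * 2^ n) + nat 12 * (a * a) * (2^ n * e) + nat 2 * (a * a * (a * a)) * 2^ n
      ≤⟨ ≤-by (*-nonNeg (*-nonNeg (nat-nonNeg 4) (square-nonNeg (a * a))) (<⇒≤ (2^-pos n)))
           (solve 3 (λ e a p → :3 :* ((a :* a :+ e) :* (a :* a :+ e)) :* (p :+ p)
             :- (:2 :* (:3 :* (e :* e) :* p) :+ con-12 :* (a :* a) :* (p :* e) :+ :2 :* (a :* a :* (a :* a)) :* p)
             := :4 :* (a :* a :* (a :* a)) :* p) refl e a (2^ n)) ⟩
    nat 3 * ((a * a + e) * (a * a + e)) * (2^ n + 2^ n)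
      ≈⟨ *-cong (*-congˡ (*-cong (energy-suc b) (energy-suc b))) (2^-suc n) ⟨
    nat 3 * (energy b * energy b) * 2^ (suc n) ∎
    where
    a = b Fin.zero
    b′ = b ∘ Fin.suc
    e = energy b′

    d D⁻ D⁺ : Vec Sign n → ℝ
    d = dot b′
    D⁻ f = dot b (Sign.- ∷ f)
    D⁺ f = dot b (Sign.+ ∷ f)
    con-12 : ∀ {n} → Polynomial n
    con-12 = con (ℤ.+ 12)

  module _ n (c s : Fin n → ℝ) (unit : ∀ i → c i * c i + s i * s i ≈ 1#) where

    energies : energy c + energy s ≈ nat n
    energies = begin-equality
      energy c + energy s                              ≈⟨ ∑-+ (allFin n) _ _ ⟨
      (∑[ i ∈ allFin n ] (c i * c i + s i * s i))      ≈⟨ ∑-cong (allFin n) unit ⟩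
      ∑ (allFin n) (λ _ → 1#)                          ≈⟨ ∑-const (allFin n) 1# ⟩
      nat (List.length (allFin n)) * 1#                ≈⟨ *-identityʳ _ ⟩
      nat (List.length (allFin n))                     ≡⟨ ≡.cong nat (length-tabulate {n = n} id) ⟩
      nat n                                            ∎

    complex-second-moment : ∑± n (λ f → dot c f * dot c f + dot s f * dot s f) ≈ nat n * 2^ n
    complex-second-moment = trans (∑-+ (allVecs signs n) _ _) (trans (+-cong (second-moment n c) (second-moment n s))
      (trans (sym (distribˡ _ _ _)) (trans (*-congˡ energies) (*-comm _ _))))

    -- The constant is 6 = 2 · 3: first (x² + y²)² ≤ 2(x⁴ + y⁴), then `fourth-moment` for the two
    -- coordinates, whose energies add up to n.
    complex-fourth-moment :
      ∑± n (λ f → (dot c f * dot c f + dot s f * dot s f) * (dot c f * dot c f + dot s f * dot s f))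
      ≤ nat 6 * (nat n * nat n) * 2^ n
    complex-fourth-moment = begin
      ∑± n (λ f → (dot c f * dot c f + dot s f * dot s f) * (dot c f * dot c f + dot s f * dot s f))
        ≤⟨ ∑-mono (allVecs signs n) (λ f → ≤-by (square-nonNeg (dot c f * dot c f - dot s f * dot s f))
             (solve 2 (λ x y → :2 :* (x :* x :* (x :* x) :+ y :* y :* (y :* y)) :- (x :* x :+ y :* y) :* (x :* x :+ y :* y)
               := (x :* x :- y :* y) :* (x :* x :- y :* y)) refl (dot c f) (dot s f))) ⟩
      ∑± n (λ f → nat 2 * (dot c f * dot c f * (dot c f * dot c f) + dot s f * dot s f * (dot s f * dot s f)))
        ≈⟨ trans (∑-*ˡ (allVecs signs n) _ _) (*-congˡ (∑-+ (allVecs signs n) _ _)) ⟩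
      nat 2 * (∑± n (λ f → dot c f * dot c f * (dot c f * dot c f)) + ∑± n (λ f → dot s f * dot s f * (dot s f * dot s f)))
        ≤⟨ *-monoˡ-≤ (nat-nonNeg 2) (+-mono-≤ (fourth-moment n c) (fourth-moment n s)) ⟩
      nat 2 * (nat 3 * (energy c * energy c) * 2^ n + nat 3 * (energy s * energy s) * 2^ n)
        ≤⟨ ≤-by (*-nonNeg (*-nonNeg (nat-nonNeg 12) (*-nonNeg (energy-nonNeg c) (energy-nonNeg s))) (<⇒≤ (2^-pos n)))
             (solve 3 (λ c s p → con (ℤ.+ 6) :* ((c :+ s) :* (c :+ s)) :* p :- :2 :* (:3 :* (c :* c) :* p :+ :3 :* (s :* s) :* p)
               := con (ℤ.+ 12) :* (c :* s) :* p) refl (energy c) (energy s) (2^ n)) ⟩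
      nat 6 * ((energy c + energy s) * (energy c + energy s)) * 2^ n
        ≈⟨ *-congʳ (*-congˡ (*-cong energies energies)) ⟩
      nat 6 * (nat n * nat n) * 2^ n ∎

-- The enumeration of squarefree numbers

Unique⇒lookup-injective : ∀ {A : Set} {xs : List A} → Unique xs →
                          ∀ i j → List.lookup xs i ≡ List.lookup xs j → i ≡ j
Unique⇒lookup-injective (_   ∷ _)  Fin.zero    Fin.zero    _  = ≡.refl
Unique⇒lookup-injective (x∉ ∷ _)  Fin.zero    (Fin.suc j) eq = contradiction eq (All.lookup x∉ (∈-lookup j))
Unique⇒lookup-injective (x∉ ∷ _)  (Fin.suc i) Fin.zero    eq = contradiction (≡.sym eq) (All.lookup x∉ (∈-lookup i))
Unique⇒lookup-injective (_   ∷ us) (Fin.suc i) (Fin.suc j) eq = ≡.cong Fin.suc (Unique⇒lookup-injective us i j eq)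

μ≢0? : Decidable (λ n → ¬ (μ n ≡ ℤ.0ℤ))
μ≢0? n = ¬? (μ n ℤ.≟ ℤ.0ℤ)

-- `extend` searches for some index of n; injectivity ensures that the index found is the intended
-- one.
elt-injective : ∀ R i j → elt R i ≡ elt R j → i ≡ j
elt-injective R = Unique⇒lookup-injective
  (Unique.filter⁺ μ≢0? (Unique.map⁺ ℕ.suc-injective (Unique.upTo⁺ R)))

μ-elt≢0 : ∀ R i → ¬ (μ (elt R i) ≡ ℤ.0ℤ)
μ-elt≢0 R i = All.lookup (all-filter μ≢0? (X R)) (∈-lookup i)

-- The Fourier transform as a sign sum, and its Lipschitz continuity

module FourierAnalysis (em : ExcludedMiddle 0ℓ) (𝓡 : CompleteOrderedField) where

  open Real em 𝓡
  open Exponential em 𝓡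
  open Integral em 𝓡
  open Rademacher em 𝓡
  open ℂ

  extend-elt : ∀ R f i → extend R f (elt R i) ≡ signValue (lookup f i)
  extend-elt R f i with Fin.any? (λ j → elt R j ℕ.≟ elt R i)
  ... | yes (j , eq) = ≡.cong (signValue ∘ lookup f) (elt-injective R j i eq)
  ... | no ¬∃        = contradiction (i , ≡.refl) ¬∃

  extend-zero : ∀ R f n → μ n ≡ ℤ.0ℤ → extend R f n ≡ 0#
  extend-zero R f n μn≡0 with Fin.any? (λ j → elt R j ℕ.≟ n)
  ... | yes (j , ≡.refl) = contradiction μn≡0 (μ-elt≢0 R j)
  ... | no _             = ≡.refl

  ∑-filter : ∀ {A : Set} {P : A → Set} (P? : Decidable P) (xs : List A) g →
             (∀ x → ¬ P x → g x ≈ 0#) → ∑ xs g ≈ ∑ (filter P? xs) g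
  ∑-filter P? []       g h = refl
  ∑-filter P? (x ∷ xs) g h with P? x
  ... | yes _ = +-congˡ (∑-filter P? xs g h)
  ... | no ¬p = trans (+-cong (h x ¬p) (∑-filter P? xs g h)) (+-identityˡ _)

  -- Brings the coordinates of `fourier` into the form of the moment lemmas, one independent sign
  -- per index.
  ∑-extend : ∀ R f g → (∑[ n ∈ X R ] (extend R f n * g n)) ≈ dot (g ∘ elt R) f
  ∑-extend R f g = begin-equality
    (∑[ n ∈ X R ] (extend R f n * g n))
      ≈⟨ ∑-filter μ≢0? (X R) _ (λ n ¬¬p → trans (*-congʳ (reflexive (extend-zero R f n (zero-μ n ¬¬p)))) (zeroˡ _)) ⟩
    (∑[ n ∈ X′-list R ] (extend R f n * g n))
      ≡⟨ ≡.cong (λ xs → ∑[ n ∈ xs ] (extend R f n * g n)) (tabulate-lookup (X′-list R)) ⟨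
    (∑[ n ∈ List.tabulate (elt R) ] (extend R f n * g n))
      ≡⟨ ∑-tabulate (∣X′∣ R) (elt R) _ ⟩
    (∑[ i ∈ allFin (∣X′∣ R) ] (extend R f (elt R i) * g (elt R i)))
      ≈⟨ ∑-cong (allFin (∣X′∣ R)) (λ i → *-congʳ (reflexive (extend-elt R f i))) ⟩
    dot (g ∘ elt R) f ∎
    where
    zero-μ : ∀ n → ¬ ¬ (μ n ≡ ℤ.0ℤ) → μ n ≡ ℤ.0ℤ
    zero-μ n ¬¬p with μ n ℤ.≟ ℤ.0ℤ
    ... | yes p = p
    ... | no ¬p = contradiction ¬p ¬¬p

  phase : ℕ → ℝ → ℝ
  phase n x = - (fromℕ 2 * π * fromℕ n * x)

  cosines sines : ∀ R → ℝ → Fin (∣X′∣ R) → ℝ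
  cosines R x i = c (phase (elt R i) x)
  sines   R x i = s (phase (elt R i) x)

  mod : ∀ R → Func R → ℝ → ℝ
  mod R f x = ∣ fourier R f x ∣ℂ

  norm-nonNeg : ∀ x y → 0# ≤ x * x + y * y
  norm-nonNeg x y = +-nonNeg (square-nonNeg x) (square-nonNeg y)

  mod-nonNeg : ∀ R f x → 0# ≤ mod R f x
  mod-nonNeg R f x = sqrt-nonNeg (norm-nonNeg _ _)

  mod-square : ∀ R f x → mod R f x * mod R f x ≈
    dot (cosines R x) f * dot (cosines R x) f + dot (sines R x) f * dot (sines R x) f
  mod-square R f x = trans (sqrt-square (norm-nonNeg _ _)) (+-cong
    (*-cong (∑-extend R f (λ n → c (phase n x))) (∑-extend R f (λ n → c (phase n x))))
    (*-cong (∑-extend R f (λ n → s (phase n x))) (∑-extend R f (λ n → s (phase n x)))))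

  -- Lipschitz functions

  Lip : (ℝ → ℝ) → Set
  Lip g = ∃ λ L → LipschitzOn01 L g

  Lip-const : ∀ k → Lip (λ _ → k)
  Lip-const k = 0# , λ _ _ _ _ _ → ±-cong (sym (-‿inverseʳ k)) (±-zero (≤-reflexive (sym (zeroˡ _))))

  Lip-+ : ∀ {g h} → Lip g → Lip h → Lip (λ x → g x + h x)
  Lip-+ {g} {h} (L , lg) (M , lh) = L + M , λ {x} {y} a b c d e →
    ±-weaken (≤-reflexive (sym (distribʳ _ _ _)))
      (±-cong (solve 4 (λ a b c d → a :- b :+ (c :- d) := a :+ c :- (b :+ d)) refl (g x) (g y) (h x) (h y))
        (±-+ (lg a b c d e) (lh a b c d e)))

  Lip-*ˡ : ∀ k {g} → Lip g → Lip (λ x → k * g x)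
  Lip-*ˡ k {g} (L , lg) = (k * k + 1#) * L , λ {x} {y} a b c d e →
    ±-weaken (≤-reflexive (sym (*-assoc _ _ _)))
      (±-cong (solve 3 (λ k a b → k :* (a :- b) := k :* a :- k :* b) refl k (g x) (g y))
        (±-* (x∈±x²+1 k) (lg a b c d e)))

  Lip-∑ : ∀ {A : Set} (xs : List A) (k : A → ℝ) {g : A → ℝ → ℝ} → (∀ a → Lip (g a)) → Lip (λ x → ∑[ a ∈ xs ] (k a * g a x))
  Lip-∑ []       k h = Lip-const 0#
  Lip-∑ (a ∷ xs) k {g} h = Lip-+ {λ x → k a * g a x} {λ x → ∑[ a ∈ xs ] (k a * g a x)}
    (Lip-*ˡ (k a) {g a} (h a)) (Lip-∑ xs k {g} h)

  Lip⇒bounded : ∀ {g} → Lip g → ∃ λ b → ∀ {x} → 0# ≤ x → x ≤ 1# → g x ∈± b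
  Lip⇒bounded {g} (L , lg) = L * 1# + (g 0# * g 0# + 1#) , λ {x} a b →
    ±-cong (solve 2 (λ x z → (x :- z) :+ z := x) refl (g x) (g 0#))
      (±-+ (lg a b ≤-refl 0≤1 (±-cong (solve 1 (λ x → x := x :- :0) refl x) (±-nonNeg a b))) (x∈±x²+1 (g 0#)))

  Lip-* : ∀ {g h} → Lip g → Lip h → Lip (λ x → g x * h x)
  Lip-* {g} {h} lg lh = bg * proj₁ lh + bh * proj₁ lg , λ {x} {y} a b c d e →
    ±-weaken (≤-reflexive (solve 5 (λ p L q M D → p :* (L :* D) :+ q :* (M :* D) := (p :* L :+ q :* M) :* D)
        refl bg (proj₁ lh) bh (proj₁ lg) _))
      (±-cong (solve 4 (λ gx gy hx hy → gx :* (hx :- hy) :+ hy :* (gx :- gy) := gx :* hx :- gy :* hy) refl (g x) (g y) (h x) (h y))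
        (±-+ (±-* (proj₂ (Lip⇒bounded {g} lg) a b) (proj₂ lh a b c d e))
             (±-* (proj₂ (Lip⇒bounded {h} lh) c d) (proj₂ lg a b c d e))))
    where
    bg = proj₁ (Lip⇒bounded {g} lg)
    bh = proj₁ (Lip⇒bounded {h} lh)

  -- Triangle inequality for the modulus. It is checked on squares, where the mixed terms are
  -- controlled by ∣a′∣ ≤ t′ and ∣b′∣ ≤ t′.
  norm-increment : ∀ {a b a′ b′ t t′ p q} → 0# ≤ t → 0# ≤ t′ →
    t * t ≈ a * a + b * b → t′ * t′ ≈ a′ * a′ + b′ * b′ →
    a - a′ ∈± p → b - b′ ∈± q → t - t′ ≤ p + q
  norm-increment {a} {b} {a′} {b′} {t} {t′} {p} {q} 0≤t 0≤t′ t² t′² ha hb =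
    ≤-by (x≤y⇒0≤y-x (proj₂ (±-from-square 0≤bound square≤)))
      (solve 3 (λ t t′ r → r :- (t :- t′) := t′ :+ r :- t) refl t t′ (p + q))
    where
    0≤p = ±⇒nonNeg ha
    0≤q = ±⇒nonNeg hb
    0≤bound = +-nonNeg 0≤t′ (+-nonNeg 0≤p 0≤q)

    a′∈± : a′ ∈± t′
    a′∈± = ±-from-square 0≤t′ (≤-by (square-nonNeg b′) (trans (+-congʳ t′²)
      (solve 2 (λ a b → a :+ b :- a := b) refl (a′ * a′) (b′ * b′))))

    b′∈± : b′ ∈± t′
    b′∈± = ±-from-square 0≤t′ (≤-by (square-nonNeg a′) (trans (+-congʳ t′²)
      (solve 2 (λ a b → a :+ b :- b := a) refl (a′ * a′) (b′ * b′))))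

    cross-a = x≤y⇒0≤y-x (proj₂ (±-* a′∈± ha))
    cross-b = x≤y⇒0≤y-x (proj₂ (±-* b′∈± hb))

    square≤ : t * t ≤ (t′ + (p + q)) * (t′ + (p + q))
    square≤ = ≤-by
      (+-nonNeg (+-nonNeg (+-nonNeg (*-nonNeg (nat-nonNeg 2) cross-a) (*-nonNeg (nat-nonNeg 2) cross-b))
          (+-nonNeg (x≤y⇒0≤y-x (±-square ha)) (x≤y⇒0≤y-x (±-square hb))))
        (*-nonNeg (nat-nonNeg 2) (*-nonNeg 0≤p 0≤q)))
      (begin-equality
        (t′ + (p + q)) * (t′ + (p + q)) - t * t
          ≈⟨ solve 4 (λ t t′ p q → (t′ :+ (p :+ q)) :* (t′ :+ (p :+ q)) :- t :* t :=
               t′ :* t′ :+ :2 :* t′ :* (p :+ q) :+ (p :+ q) :* (p :+ q) :- t :* t) refl t t′ p q ⟩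
        t′ * t′ + nat 2 * t′ * (p + q) + (p + q) * (p + q) - t * t
          ≈⟨ +-cong (+-congʳ (+-congʳ t′²)) (-‿cong t²) ⟩
        a′ * a′ + b′ * b′ + nat 2 * t′ * (p + q) + (p + q) * (p + q) - (a * a + b * b)
          ≈⟨ solve 7 (λ a b a′ b′ t′ p q → a′ :* a′ :+ b′ :* b′ :+ :2 :* t′ :* (p :+ q) :+ (p :+ q) :* (p :+ q) :- (a :* a :+ b :* b)
               := :2 :* (t′ :* p :- a′ :* (a :- a′)) :+ :2 :* (t′ :* q :- b′ :* (b :- b′))
                  :+ ((p :* p :- (a :- a′) :* (a :- a′)) :+ (q :* q :- (b :- b′) :* (b :- b′))) :+ :2 :* (p :* q)) refl a b a′ b′ t′ p q ⟩
        nat 2 * (t′ * p - a′ * (a - a′)) + nat 2 * (t′ * q - b′ * (b - b′))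
          + ((p * p - (a - a′) * (a - a′)) + (q * q - (b - b′) * (b - b′))) + nat 2 * (p * q) ∎)

  -- `sqrt` is not Lipschitz at 0, so the modulus is treated as one function of both coordinates
  -- instead of as a composite.
  Lip-norm : ∀ {a b} → Lip a → Lip b → Lip (λ x → sqrt (a x * a x + b x * b x))
  Lip-norm {a} {b} (L , la) (M , lb) = L + M , λ {x} {y} h₁ h₂ h₃ h₄ hd →
    let bound : ∀ {x y} → a x - a y ∈± L * _ → b x - b y ∈± M * _ →
                sqrt (a x * a x + b x * b x) - sqrt (a y * a y + b y * b y) ≤ (L + M) * _
        bound = λ {x} {y} da db → ≤-trans
          (norm-increment (sqrt-nonNeg (norm-nonNeg _ _)) (sqrt-nonNeg (norm-nonNeg _ _))
            (sqrt-square (norm-nonNeg _ _)) (sqrt-square (norm-nonNeg _ _)) da db)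
          (≤-reflexive (sym (distribʳ _ L M)))
        flip : ∀ {x y D} → x - y ∈± D → y - x ∈± D
        flip = λ {x} {y} h → ±-cong (solve 2 (λ x y → :- (x :- y) := y :- x) refl x y) (±-neg h)
    in ≤-trans (-‿anti-≤ (bound (la h₃ h₄ h₁ h₂ (flip hd)) (lb h₃ h₄ h₁ h₂ (flip hd))))
         (≤-reflexive (solve 2 (λ u v → :- (v :- u) := u :- v) refl _ _)) ,
       bound (la h₁ h₂ h₃ h₄ hd) (lb h₁ h₂ h₃ h₄ hd)

  Lip-phase : ∀ n {g} → (∀ M → 0# ≤ M → ∃ λ L → LipschitzOn± M L g) → Lip (λ x → g (phase n x))
  Lip-phase n {g} lip = L * m , λ {x} {y} {D} 0≤x x≤1 0≤y y≤1 hd → ±-weaken (≤-reflexive (sym (*-assoc L m D)))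
      (proj₂ (lip m 0≤m) (phase-± 0≤x x≤1) (phase-± 0≤y y≤1) (±-cong
        (solve 3 (λ k x y → :- (k :* (x :- y)) := :- (k :* x) :- :- (k :* y)) refl κ x y) (±-neg (±-* (x∈±x²+1 κ) hd))))
    where
    κ = fromℕ 2 * π * fromℕ n
    m = κ * κ + 1#
    0≤m = ±⇒nonNeg (x∈±x²+1 κ)
    L = proj₁ (lip m 0≤m)

    phase-± : ∀ {x} → 0# ≤ x → x ≤ 1# → phase n x ∈± m
    phase-± 0≤x x≤1 = ±-weaken (≤-reflexive (*-identityʳ m)) (±-neg (±-* (x∈±x²+1 κ) (±-nonNeg 0≤x x≤1)))

  Lip-mod : ∀ R f → Lip (mod R f)
  Lip-mod R f = Lip-norm {λ x → re (fourier R f x)} {λ x → im (fourier R f x)}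
    (Lip-∑ (X R) (extend R f) {λ n x → c (phase n x)} (λ n → Lip-phase n {c} λ M 0≤M →
      let (L , lc , _) = c-s-Lipschitz M 0≤M in L , lc))
    (Lip-∑ (X R) (extend R f) {λ n x → s (phase n x)} (λ n → Lip-phase n {s} λ M 0≤M →
      let (L , _ , ls) = c-s-Lipschitz M 0≤M in L , ls))

  Lip⇒∫ : ∀ g → Lip g → HasIntegral g (∫ g)
  Lip⇒∫ g (L , lip) = ∫-spec {g} (Lipschitz.integrable {g} {L} lip)

-- A fixed proportion of sign functions has large Fourier Ratio

module FourierRatio (em : ExcludedMiddle 0ℓ) (𝓡 : CompleteOrderedField) (R : ℕ) where

  open Real em 𝓡
  open Exponential em 𝓡
  open Integral em 𝓡
  open Rademacher em 𝓡
  open FourierAnalysis em 𝓡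

  n = ∣X′∣ R

  mod² mod⁴ : Func R → ℝ → ℝ
  mod² f x = mod R f x * mod R f x
  mod⁴ f x = mod² f x * mod² f x

  I₁ I₂ I₄ : Func R → ℝ
  I₁ f = ∫ (mod R f)
  I₂ f = ∫ (mod² f)
  I₄ f = ∫ (mod⁴ f)

  I₁-spec : ∀ f → HasIntegral (mod R f) (I₁ f)
  I₁-spec f = Lip⇒∫ (mod R f) (Lip-mod R f)

  Lip-mod² : ∀ f → Lip (mod² f)
  Lip-mod² f = Lip-* {mod R f} {mod R f} (Lip-mod R f) (Lip-mod R f)

  I₂-spec : ∀ f → HasIntegral (mod² f) (I₂ f)
  I₂-spec f = Lip⇒∫ (mod² f) (Lip-mod² f)

  I₄-spec : ∀ f → HasIntegral (mod⁴ f) (I₄ f)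
  I₄-spec f = Lip⇒∫ (mod⁴ f) (Lip-* {mod² f} {mod² f} (Lip-mod² f) (Lip-mod² f))

  I₂-nonNeg : ∀ f → 0# ≤ I₂ f
  I₂-nonNeg f = integral-mono {λ _ → 0#} {mod² f} (integral-const 0#) (I₂-spec f) λ x → square-nonNeg (mod R f x)

  -- Cauchy-Schwarz on an interval of length 1: integrate (∣f̂∣² - I₂)² ≥ 0.
  I₂²≤I₄ : ∀ f → I₂ f * I₂ f ≤ I₄ f
  I₂²≤I₄ f = ≤-by (x≤y⇒0≤y-x (integral-mono {λ x → nat 2 * I₂ f * mod² f x} {λ x → mod⁴ f x + I₂ f * I₂ f}
      (integral-*ˡ (nat 2 * I₂ f) {mod² f} (I₂-spec f))
      (integral-+ {mod⁴ f} {λ _ → I₂ f * I₂ f} (I₄-spec f) (integral-const (I₂ f * I₂ f)))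
      λ x → ≤-by (square-nonNeg (mod² f x - I₂ f))
        (solve 2 (λ m a → m :* m :+ a :* a :- :2 :* a :* m := (m :- a) :* (m :- a)) refl (mod² f x) (I₂ f))))
    (solve 2 (λ a b → b :- a :* a := b :+ a :* a :- :2 :* a :* a) refl (I₂ f) (I₄ f))

  -- t (t - s)² (t + 2 s) ≥ 0 with t = ∣ f̂ ∣; a substitute for Hölder's inequality.
  interpolation : ∀ f s → 0# ≤ s → nat 3 * (s * s) * I₂ f ≤ nat 2 * (s * s * s) * I₁ f + I₄ f
  interpolation f s 0≤s = integral-mono
    {λ x → nat 3 * (s * s) * mod² f x} {λ x → nat 2 * (s * s * s) * mod R f x + mod⁴ f x}
    (integral-*ˡ (nat 3 * (s * s)) {mod² f} (I₂-spec f))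
    (integral-+ {λ x → nat 2 * (s * s * s) * mod R f x} {mod⁴ f}
      (integral-*ˡ (nat 2 * (s * s * s)) {mod R f} (I₁-spec f)) (I₄-spec f))
    λ x → let 0≤t = mod-nonNeg R f x in
      ≤-by (*-nonNeg 0≤t (*-nonNeg (square-nonNeg (mod R f x - s)) (+-nonNeg 0≤t (*-nonNeg (nat-nonNeg 2) 0≤s))))
        (solve 2 (λ t s → :2 :* (s :* s :* s) :* t :+ t :* t :* (t :* t) :- :3 :* (s :* s) :* (t :* t)
          := t :* ((t :- s) :* (t :- s) :* (t :+ :2 :* s))) refl (mod R f x) s)

  mod²-total : ∀ x → ∑± n (λ f → mod² f x) ≈ nat n * 2^ n
  mod²-total x = trans (∑-cong (allFuncs R) λ f → mod-square R f x)
    (complex-second-moment n (cosines R x) (sines R x) λ i → norm²≈1 _)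

  ∑I₂≥ : nat n * 2^ n ≤ ∑± n I₂
  ∑I₂≥ = integral-mono {λ _ → nat n * 2^ n} {λ x → ∑± n (λ f → mod² f x)}
    (integral-const _) (integral-∑ (allFuncs R) {mod²} {I₂} I₂-spec) λ x → ≤-reflexive (sym (mod²-total x))

  ∑I₄≤ : ∑± n I₄ ≤ nat 6 * (nat n * nat n) * 2^ n
  ∑I₄≤ = integral-mono {λ x → ∑± n (λ f → mod⁴ f x)} {λ _ → nat 6 * (nat n * nat n) * 2^ n}
    (integral-∑ (allFuncs R) {mod⁴} {I₄} I₄-spec) (integral-const _) λ x → ≤-trans
      (≤-reflexive (∑-cong (allFuncs R) λ f → *-cong (mod-square R f x) (mod-square R f x)))
      (complex-fourth-moment n (cosines R x) (sines R x) λ i → norm²≈1 _)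

  ⅛ : ℝ
  ⅛ = nat 8 ⁻¹

  -- With I₂ = r² and 8 I₁ ≤ r, interpolation at s = 4r reads 48 r⁴ ≤ 16 r³ (8 I₁) + I₄ ≤ 16 r⁴ +
  -- I₄.
  low-ratio : ∀ f → ¬ 𝓗 R ⅛ f → nat 32 * (I₂ f * I₂ f) ≤ I₄ f
  low-ratio f low = cases (sqrt-nonNeg (I₂-nonNeg f))
    where
    r = sqrt (I₂ f)

    r² : r * r ≈ I₂ f
    r² = sqrt-square (I₂-nonNeg f)

    cases : 0# ≤ r → nat 32 * (I₂ f * I₂ f) ≤ I₄ f
    -- Here r ⁻¹ and so the ratio are arbitrary values; but I₂ vanishes, and Cauchy-Schwarz is
    -- enough.
    cases (inj₂ 0≈r) = ≤-trans (≤-reflexive (trans (*-congˡ (*-congʳ I₂≈0))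
        (trans (solve 1 (λ a → con (ℤ.+ 32) :* (:0 :* a) := :0 :* a) refl (I₂ f)) (*-congʳ (sym I₂≈0)))))
      (I₂²≤I₄ f)
      where
      I₂≈0 : I₂ f ≈ 0#
      I₂≈0 = trans (sym r²) (trans (*-congʳ (sym 0≈r)) (zeroˡ r))
    cases (inj₁ 0<r) = ≤-by (x≤y⇒0≤y-x bound) (begin-equality
      I₄ f - nat 32 * (I₂ f * I₂ f)
        ≈⟨ solve 2 (λ a b → b :- con (ℤ.+ 32) :* (a :* a) := :4 :* :4 :* a :* a :+ b :- con (ℤ.+ 48) :* (a :* a)) refl (I₂ f) (I₄ f) ⟩
      nat 4 * nat 4 * I₂ f * I₂ f + I₄ f - nat 48 * (I₂ f * I₂ f)
        ≈⟨ +-congˡ (-‿cong (trans (solve 2 (λ r a → con (ℤ.+ 48) :* (a :* a) := :3 :* (:4 :* :4 :* a) :* a) refl r (I₂ f))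
             (*-congʳ (*-congˡ (*-congˡ (sym r²)))))) ⟩
      nat 4 * nat 4 * I₂ f * I₂ f + I₄ f - nat 3 * (nat 4 * nat 4 * (r * r)) * I₂ f
        ≈⟨ +-congˡ (-‿cong (*-congʳ (solve 1 (λ r → :3 :* (:4 :* :4 :* (r :* r)) := :3 :* (:4 :* r :* (:4 :* r))) refl r))) ⟩
      nat 4 * nat 4 * I₂ f * I₂ f + I₄ f - nat 3 * (nat 4 * r * (nat 4 * r)) * I₂ f ∎)
      where
      8I₁≤r : nat 8 * I₁ f ≤ r
      8I₁≤r = ≮⇒≥ λ r<8I₁ → low (*-cancelˡ-≤ (*-pos (nat-pos 7) 0<r) (begin
        nat 8 * r * ⅛               ≈⟨ solve 3 (λ e r i → e :* r :* i := (e :* i) :* r) refl (nat 8) r ⅛ ⟩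
        nat 8 * ⅛ * r               ≈⟨ *-congʳ (*-inverse (nat-pos 7)) ⟩
        1# * r                      ≈⟨ *-identityˡ r ⟩
        r                           ≤⟨ <⇒≤ r<8I₁ ⟩
        nat 8 * I₁ f                ≈⟨ *-identityʳ _ ⟨
        nat 8 * I₁ f * 1#           ≈⟨ *-congˡ (*-inverse 0<r) ⟨
        nat 8 * I₁ f * (r * r ⁻¹)   ≈⟨ solve 4 (λ e i r j → e :* i :* (r :* j) := e :* r :* (i :* j)) refl (nat 8) (I₁ f) r (r ⁻¹) ⟩
        nat 8 * r * FR R f          ∎))

      bound : nat 3 * (nat 4 * r * (nat 4 * r)) * I₂ f ≤ nat 4 * nat 4 * I₂ f * I₂ f + I₄ f
      bound = begin
        nat 3 * (nat 4 * r * (nat 4 * r)) * I₂ f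
          ≤⟨ interpolation f (nat 4 * r) (*-nonNeg (nat-nonNeg 4) (<⇒≤ 0<r)) ⟩
        nat 2 * (nat 4 * r * (nat 4 * r) * (nat 4 * r)) * I₁ f + I₄ f
          ≈⟨ +-congʳ (solve 2 (λ r i → :2 :* (:4 :* r :* (:4 :* r) :* (:4 :* r)) :* i :=
               :4 :* :4 :* (r :* r) :* r :* (con (ℤ.+ 8) :* i)) refl r (I₁ f)) ⟩
        nat 4 * nat 4 * (r * r) * r * (nat 8 * I₁ f) + I₄ f
          ≤⟨ +-monoˡ-≤ _ (*-monoˡ-≤ (*-nonNeg (*-nonNeg (*-nonNeg (nat-nonNeg 4) (nat-nonNeg 4)) (square-nonNeg r)) (<⇒≤ 0<r)) 8I₁≤r) ⟩
        nat 4 * nat 4 * (r * r) * r * r + I₄ f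
          ≈⟨ +-congʳ (trans (*-assoc _ r r) (*-cong (*-congˡ r²) r²)) ⟩
        nat 4 * nat 4 * I₂ f * I₂ f + I₄ f ∎

  high : Func R → ℝ
  high f = 𝟙 (𝓗 R ⅛ f)

  -- A bound for each single f whose sum counts the high ones. If f is high, 24 n I₂ ≤ 144 n² + I₂²
  -- and I₂² ≤ I₄; otherwise 24 n I₂ ≤ 6 n² + 24 I₂² and 32 I₂² ≤ I₄. On average the left side is at
  -- least 24 n² and the last two terms on the right are at most 12 n², so 144 n² times the
  -- proportion of high f is at least 12 n².
  I₂≤ : ∀ f → nat 24 * nat n * I₂ f ≤ nat 144 * (nat n * nat n) * high f + nat 6 * (nat n * nat n) + I₄ f
  I₂≤ f = cases em
    where
    cases : Dec (𝓗 R ⅛ f) →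
            nat 24 * nat n * I₂ f ≤ nat 144 * (nat n * nat n) * high f + nat 6 * (nat n * nat n) + I₄ f
    cases (yes h) = begin
      nat 24 * nat n * I₂ f
        ≤⟨ ≤-by (+-nonNeg (+-nonNeg (square-nonNeg (I₂ f - nat 12 * nat n)) (*-nonNeg (nat-nonNeg 6) (square-nonNeg (nat n))))
             (x≤y⇒0≤y-x (I₂²≤I₄ f)))
             (solve 3 (λ n a b → con (ℤ.+ 144) :* (n :* n) :* :1 :+ con (ℤ.+ 6) :* (n :* n) :+ b :- con (ℤ.+ 24) :* n :* a
               := (a :- con (ℤ.+ 12) :* n) :* (a :- con (ℤ.+ 12) :* n) :+ con (ℤ.+ 6) :* (n :* n) :+ (b :- a :* a)) refl (nat n) (I₂ f) (I₄ f)) ⟩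
      nat 144 * (nat n * nat n) * 1# + nat 6 * (nat n * nat n) + I₄ f
        ≈⟨ +-congʳ (+-congʳ (*-congˡ (𝟙-yes h))) ⟨
      nat 144 * (nat n * nat n) * high f + nat 6 * (nat n * nat n) + I₄ f ∎
    cases (no ¬h) = begin
      nat 24 * nat n * I₂ f
        ≤⟨ ≤-by (+-nonNeg (+-nonNeg (*-nonNeg (nat-nonNeg 6) (square-nonNeg (nat n - nat 2 * I₂ f)))
             (*-nonNeg (nat-nonNeg 8) (square-nonNeg (I₂ f)))) (x≤y⇒0≤y-x (low-ratio f ¬h)))
             (solve 3 (λ n a b → con (ℤ.+ 144) :* (n :* n) :* :0 :+ con (ℤ.+ 6) :* (n :* n) :+ b :- con (ℤ.+ 24) :* n :* a
               := con (ℤ.+ 6) :* ((n :- :2 :* a) :* (n :- :2 :* a)) :+ con (ℤ.+ 8) :* (a :* a) :+ (b :- con (ℤ.+ 32) :* (a :* a))) refl (nat n) (I₂ f) (I₄ f)) ⟩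
      nat 144 * (nat n * nat n) * 0# + nat 6 * (nat n * nat n) + I₄ f
        ≈⟨ +-congʳ (+-congʳ (*-congˡ (𝟙-no ¬h))) ⟨
      nat 144 * (nat n * nat n) * high f + nat 6 * (nat n * nat n) + I₄ f ∎

  many-high : 0# < nat n → 2^ n ≤ nat 12 * ∑± n high
  many-high 0<n = *-cancelˡ-≤ (*-pos (nat-pos 11) (*-pos 0<n 0<n)) (≤-by (x≤y⇒0≤y-x total)
    (solve 3 (λ n w h → con (ℤ.+ 12) :* (n :* n) :* (con (ℤ.+ 12) :* h) :- con (ℤ.+ 12) :* (n :* n) :* w
      := con (ℤ.+ 144) :* (n :* n) :* h :+ con (ℤ.+ 6) :* (n :* n) :* w :+ con (ℤ.+ 6) :* (n :* n) :* w :- con (ℤ.+ 24) :* n :* (n :* w))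
      refl (nat n) (2^ n) (∑± n high)))
    where
    total : nat 24 * nat n * (nat n * 2^ n) ≤
            nat 144 * (nat n * nat n) * ∑± n high + nat 6 * (nat n * nat n) * 2^ n + nat 6 * (nat n * nat n) * 2^ n
    total = begin
      nat 24 * nat n * (nat n * 2^ n)
        ≤⟨ *-monoˡ-≤ (*-nonNeg (nat-nonNeg 24) (<⇒≤ 0<n)) ∑I₂≥ ⟩
      nat 24 * nat n * ∑± n I₂
        ≈⟨ ∑-*ˡ (allFuncs R) (nat 24 * nat n) I₂ ⟨
      ∑± n (λ f → nat 24 * nat n * I₂ f)
        ≤⟨ ∑-mono (allFuncs R) I₂≤ ⟩
      ∑± n (λ f → nat 144 * (nat n * nat n) * high f + nat 6 * (nat n * nat n) + I₄ f)
        ≈⟨ trans (∑-+ (allFuncs R) _ _) (+-congʳ (trans (∑-+ (allFuncs R) _ _)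
             (+-cong (∑-*ˡ (allFuncs R) _ high) (∑±-const n _)))) ⟩
      nat 144 * (nat n * nat n) * ∑± n high + nat 6 * (nat n * nat n) * 2^ n + ∑± n I₄
        ≤⟨ +-monoʳ-≤ _ ∑I₄≤ ⟩
      nat 144 * (nat n * nat n) * ∑± n high + nat 6 * (nat n * nat n) * 2^ n + nat 6 * (nat n * nat n) * 2^ n ∎

-- At least a quarter of the integers up to R are squarefree

module SquarefreeDensity where

  open import Data.Nat.Base using (NonZero; _+_; _*_; _/_; _≤_; _<_; s≤s; s≤s⁻¹; z≤n)
  open import Data.Nat.Divisibility using (_∣_; divides)
  open import Data.Nat.DivMod using (/-monoˡ-≤; m/n*n≤m; m*n/n≡m; m<n*o⇒m/o<n)
  open import Data.Nat.Primality.Factorisation using (factorise; factors)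
  open import Data.Nat.Properties
  open import Data.Nat.Solver using (module +-*-Solver)
  open import Relation.Binary.PropositionalEquality using (refl; sym; trans; cong; subst)

  -1^n≡±1 : ∀ n → ℤ.-1ℤ ℤ.^ n ≡ ℤ.1ℤ ⊎ ℤ.-1ℤ ℤ.^ n ≡ ℤ.-1ℤ
  -1^n≡±1 zero    = inj₁ refl
  -1^n≡±1 (suc n) with -1^n≡±1 n
  ... | inj₁ eq = inj₂ (cong (ℤ.-1ℤ ℤ.*_) eq)
  ... | inj₂ eq = inj₁ (cong (ℤ.-1ℤ ℤ.*_) eq)

  -1^n≢0 : ∀ n → ℤ.-1ℤ ℤ.^ n ≢ ℤ.0ℤ
  -1^n≢0 n eq with -1^n≡±1 n
  ... | inj₁ h = contradiction (trans (sym h) eq) λ ()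
  ... | inj₂ h = contradiction (trans (sym h) eq) λ ()

  μ≡0⇒square-factor : ∀ n → μ (suc n) ≡ ℤ.0ℤ → HasSquareFactor (suc n)
  μ≡0⇒square-factor n eq with hasSquareFactor? (suc n)
  ... | yes h = h
  ... | no _  = contradiction eq (-1^n≢0 (length (factors (factorise (suc n)))))

  length-filter-¬ : ∀ {A : Set} {P : A → Set} (P? : Decidable P) (xs : List A) →
                    length (filter P? xs) + length (filter (λ x → ¬? (P? x)) xs) ≡ length xs
  length-filter-¬ P? []       = refl
  length-filter-¬ P? (x ∷ xs) with P? x
  ... | yes _ = cong suc (length-filter-¬ P? xs)
  ... | no _  = trans (+-suc _ _) (cong suc (length-filter-¬ P? xs))

  m*n≤o⇒m≤o/n : ∀ {m o} n .{{_ : NonZero n}} → m * n ≤ o → m ≤ o / n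
  m*n≤o⇒m≤o/n {m} n h = subst (_≤ _) (m*n/n≡m m n) (/-monoˡ-≤ n h)

  μ≡0? : Decidable (λ n → μ n ≡ ℤ.0ℤ)
  μ≡0? n = μ n ℤ.≟ ℤ.0ℤ

  -- ∑ ⌊R / d²⌋ over 2 ≤ d ≤ k + 1
  square-multiples : ℕ → ℕ → ℕ
  square-multiples zero    R = 0
  square-multiples (suc k) R = square-multiples k R + R / ((2 + k) * (2 + k))

  square-multiples-step : ∀ k R → square-multiples k R ≤ square-multiples k (suc R)
  square-multiples-step zero    R = z≤n
  square-multiples-step (suc k) R = +-mono-≤ (square-multiples-step k R) (/-monoˡ-≤ ((2 + k) * (2 + k)) (n≤1+n R))

  /-jump : ∀ n d .{{_ : NonZero d}} → d ∣ suc n → suc (n / d) ≤ suc n / d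
  /-jump n d (divides q eq) = subst (n / d <_) (sym (trans (cong (_/ d) eq) (m*n/n≡m q d)))
    (m<n*o⇒m/o<n (≤-reflexive eq))

  -- The floor belonging to d = 2 + j rises at a multiple of d², and the other floors do not fall.
  square-multiples-jump : ∀ k R j → j < k → (2 + j) * (2 + j) ∣ suc R →
                          suc (square-multiples k R) ≤ square-multiples k (suc R)
  square-multiples-jump (suc k) R j (s≤s j≤k) d²∣ with m≤n⇒m<n∨m≡n j≤k
  ... | inj₁ j<k  = +-mono-≤ (square-multiples-jump k R j j<k d²∣) (/-monoˡ-≤ ((2 + k) * (2 + k)) (n≤1+n R))
  ... | inj₂ refl = subst (_≤ square-multiples (suc k) (suc R)) (+-suc (square-multiples k R) _)
    (+-mono-≤ (square-multiples-step k R) (/-jump R ((2 + k) * (2 + k)) d²∣))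

  non-squarefree : ℕ → ℕ
  non-squarefree R = length (filter μ≡0? (X R))

  non-squarefree-suc : ∀ R → non-squarefree (suc R) ≡ non-squarefree R + length (filter μ≡0? (suc R ∷ []))
  non-squarefree-suc R = trans (cong (λ xs → length (filter μ≡0? xs))
      (trans (cong (map suc) (sym (upTo-∷ʳ R))) (map-++ suc (upTo R) (R ∷ []))))
    (trans (cong length (filter-++ μ≡0? (X R) (suc R ∷ []))) (length-++ (filter μ≡0? (X R))))

  -- A union bound over d, by induction on R with k fixed: the condition R ≤ k + 1 puts every
  -- possible d among those counted.
  non-squarefree-≤ : ∀ k R → R ≤ suc k → non-squarefree R ≤ square-multiples k R
  non-squarefree-≤ k zero    _     = z≤n
  non-squarefree-≤ k (suc R) 1+R≤1+k rewrite non-squarefree-suc R with μ≡0? (suc R)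
  ... | no _   = subst (_≤ square-multiples k (suc R)) (sym (+-identityʳ _))
    (≤-trans (non-squarefree-≤ k R (<⇒≤ 1+R≤1+k)) (square-multiples-step k R))
  ... | yes μ0 with μ≡0⇒square-factor R μ0
  ...   | suc (suc j) , d<2+R , _ , d²∣ = subst (_≤ square-multiples k (suc R)) (sym (+-comm _ 1))
    (≤-trans (s≤s (non-squarefree-≤ k R (<⇒≤ 1+R≤1+k)))
      (square-multiples-jump k R j (s≤s⁻¹ (≤-trans (s≤s⁻¹ d<2+R) 1+R≤1+k)) d²∣))
  ...   | suc zero    , _ , s≤s () , _
  ...   | zero        , _ , () , _

  -- ⌊R/d²⌋ ≤ ⌊R/(d-1)⌋ - ⌊R/d⌋, the integer form of 1/d² ≤ 1/(d-1) - 1/d.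
  /-telescope : ∀ R e .{{_ : NonZero e}} → R / (suc e * suc e) + R / suc e ≤ R / e
  /-telescope R e = m*n≤o⇒m≤o/n e (begin
    (b + a) * e        ≡⟨ +-*-Solver.solve 3 (λ a b e → (b :+ a) :* e := b :* e :+ a :* e) refl a b e ⟩
    b * e + a * e      ≤⟨ +-monoˡ-≤ (a * e) (≤-trans (*-monoʳ-≤ b (n≤1+n e)) b*d≤a) ⟩
    a + a * e          ≡⟨ *-suc a e ⟨
    a * suc e          ≤⟨ m/n*n≤m R (suc e) ⟩
    R                  ∎)
    where
    open ≤-Reasoning
    open +-*-Solver using (_:+_; _:*_; _:=_)
    d = suc e
    a = R / d
    b = R / (d * d)

    b*d≤a : b * d ≤ a
    b*d≤a = m*n≤o⇒m≤o/n d (≤-trans (≤-reflexive (*-assoc b d d)) (m/n*n≤m R (d * d)))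

  -- The term d = 2 is kept as R / 4 and the later ones telescope to R / 2. Telescoping from d = 2
  -- on would only give the bound R.
  square-multiples-bound : ∀ k R → square-multiples (suc k) R + R / (2 + k) ≤ R / 4 + R / 2
  square-multiples-bound zero    R = ≤-refl
  square-multiples-bound (suc k) R = begin
    square-multiples (suc k) R + R / ((3 + k) * (3 + k)) + R / (3 + k)    ≡⟨ +-assoc (square-multiples (suc k) R) _ _ ⟩
    square-multiples (suc k) R + (R / ((3 + k) * (3 + k)) + R / (3 + k))  ≤⟨ +-monoʳ-≤ (square-multiples (suc k) R) (/-telescope R (2 + k)) ⟩
    square-multiples (suc k) R + R / (2 + k)                              ≤⟨ square-multiples-bound k R ⟩
    R / 4 + R / 2                                                         ∎
    where open ≤-Reasoning

  R≤4∣X′∣ : ∀ R → R ≤ 4 * ∣X′∣ R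
  R≤4∣X′∣ R = +-cancelˡ-≤ (3 * R) R (4 * ∣X′∣ R) (begin
    3 * R + R                              ≡⟨ +-comm (3 * R) R ⟩
    4 * R                                  ≡⟨ cong (4 *_) total ⟨
    4 * (non-squarefree R + ∣X′∣ R)        ≡⟨ *-distribˡ-+ 4 (non-squarefree R) (∣X′∣ R) ⟩
    4 * non-squarefree R + 4 * ∣X′∣ R      ≤⟨ +-monoˡ-≤ (4 * ∣X′∣ R) 4B≤3R ⟩
    3 * R + 4 * ∣X′∣ R                     ∎)
    where
    open ≤-Reasoning

    total : non-squarefree R + ∣X′∣ R ≡ R
    total = trans (length-filter-¬ μ≡0? (X R)) (trans (length-map suc (upTo R)) (length-upTo R))

    4B≤3R : 4 * non-squarefree R ≤ 3 * R
    4B≤3R = begin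
      4 * non-squarefree R             ≤⟨ *-monoʳ-≤ 4 (non-squarefree-≤ (suc R) R (≤-trans (n≤1+n R) (n≤1+n (suc R)))) ⟩
      4 * square-multiples (suc R) R   ≤⟨ *-monoʳ-≤ 4 (≤-trans (m≤m+n _ (R / (2 + R))) (square-multiples-bound R R)) ⟩
      4 * (R / 4 + R / 2)              ≡⟨ +-*-Solver.solve 2 (λ a b → con 4 :* (a :+ b) := a :* con 4 :+ con 2 :* (b :* con 2)) refl (R / 4) (R / 2) ⟩
      R / 4 * 4 + 2 * (R / 2 * 2)      ≤⟨ +-mono-≤ (m/n*n≤m R 4) (*-monoʳ-≤ 2 (m/n*n≤m R 2)) ⟩
      3 * R                            ∎
      where open +-*-Solver using (_:+_; _:*_; _:=_; con)

-- From a learner with few samples to a bound on the number of points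

module Learning (em : ExcludedMiddle 0ℓ) (𝓡 : CompleteOrderedField) where

  open Real em 𝓡
  open Rademacher em 𝓡
  open Distribution

  ∑-allFin-1 : ∀ n → ∑ (allFin n) (λ _ → 1#) ≈ nat n
  ∑-allFin-1 n = trans (∑-const (allFin n) 1#) (trans (*-identityʳ _)
    (reflexive (≡.cong nat (length-tabulate {n = n} id))))

  δ : ∀ {n} → Fin n → Fin n → ℝ
  δ j i = if does (j Fin.≟ i) then 1# else 0#

  ∑δ≈1 : ∀ {n} (j : Fin n) → ∑ (allFin n) (δ j) ≈ 1#
  ∑δ≈1 {suc n} Fin.zero    = trans (reflexive (∑-allFin-suc n (δ Fin.zero)))
    (trans (+-congˡ (∑-zero (allFin n))) (+-identityʳ 1#))
  ∑δ≈1 {suc n} (Fin.suc j) = trans (reflexive (∑-allFin-suc n (δ (Fin.suc j))))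
    (trans (+-identityˡ _) (∑δ≈1 j))

  unseen : ∀ {n k} → Vec (Fin n) k → Fin n → ℝ
  unseen []       i = 1#
  unseen (j ∷ ns) i = if does (j Fin.≟ i) then 0# else unseen ns i

  -- The dichotomy required by `weighted-second-moment`: either the coefficient at i vanishes, or
  -- changing the sign at i leaves the labelled sample as it was.
  unseen-cases : ∀ {n k} (ns : Vec (Fin n) k) i →
    unseen ns i ≡ 0# ⊎ (unseen ns i ≡ 1# × (∀ (f : Vec Sign n) t →
      Vec.map (λ j → j , lookup (f [ i ]≔ t) j) ns ≡ Vec.map (λ j → j , lookup f j) ns))
  unseen-cases []       i = inj₂ (≡.refl , λ _ _ → ≡.refl)
  unseen-cases (j ∷ ns) i with j Fin.≟ i
  ... | yes _ = inj₁ ≡.refl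
  ... | no j≢i with unseen-cases ns i
  ...   | inj₁ eq       = inj₁ eq
  ...   | inj₂ (eq , h) = inj₂ (eq , λ f t →
    ≡.cong₂ _∷_ (≡.cong (j ,_) (lookup∘update′ j≢i f t)) (h f t))

  unseen-± : ∀ {n k} (ns : Vec (Fin n) k) i → unseen ns i ∈± 1#
  unseen-± ns i with unseen ns i | unseen-cases ns i
  ... | _ | inj₁ ≡.refl       = ±-zero 0≤1
  ... | _ | inj₂ (≡.refl , _) = ±-nonNeg 0≤1 ≤-refl

  ∑-seen : ∀ {n k} (ns : Vec (Fin n) k) → ∑ (allFin n) (λ i → 1# - unseen ns i) ≤ nat k
  ∑-seen {n} []       = ≤-reflexive (trans (∑-cong (allFin n) λ _ → -‿inverseʳ 1#) (∑-zero (allFin n)))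
  ∑-seen {n} {suc k} (j ∷ ns) = begin
    ∑ (allFin n) (λ i → 1# - unseen (j ∷ ns) i)                ≤⟨ ∑-mono (allFin n) step ⟩
    ∑ (allFin n) (λ i → δ j i + (1# - unseen ns i))            ≈⟨ ∑-+ (allFin n) _ _ ⟩
    ∑ (allFin n) (δ j) + ∑ (allFin n) (λ i → 1# - unseen ns i) ≤⟨ +-mono-≤ (≤-reflexive (∑δ≈1 j)) (∑-seen ns) ⟩
    1# + nat k                                                 ≈⟨ nat-suc k ⟨
    nat (suc k)                                                ∎
    where
    step : ∀ i → 1# - unseen (j ∷ ns) i ≤ δ j i + (1# - unseen ns i)
    step i with j Fin.≟ i
    ... | no _  = ≤-reflexive (sym (+-identityˡ _))
    ... | yes _ = ≤-by (x≤y⇒0≤y-x (proj₂ (unseen-± ns i)))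
      (solve 1 (λ u → :1 :+ (:1 :- u) :- (:1 :- :0) := :1 :- u) refl (unseen ns i))

  signValue-±1 : ∀ s → signValue s ∈± 1#
  signValue-±1 Sign.+ = ±-nonNeg 0≤1 ≤-refl
  signValue-±1 Sign.- = ±-neg (±-nonNeg 0≤1 ≤-refl)

  disagree : Sign → Sign → ℝ
  disagree s t = 𝟙 (¬ (s ≡ t))

  signValue-* : ∀ s t → signValue t * signValue s ≈ 1# - nat 2 * disagree s t
  signValue-* s t = cases (s Sign.≟ t)
    where
    square : ∀ s → signValue s * signValue s ≈ 1#
    square Sign.+ = *-identityˡ 1#
    square Sign.- = solve 0 (:- :1 :* :- :1 := :1) refl

    opposite : ∀ s t → s ≢ t → signValue t * signValue s ≈ - 1#
    opposite Sign.+ Sign.+ h = contradiction ≡.refl h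
    opposite Sign.- Sign.- h = contradiction ≡.refl h
    opposite Sign.+ Sign.- h = *-identityʳ (- 1#)
    opposite Sign.- Sign.+ h = *-identityˡ (- 1#)

    cases : Dec (s ≡ t) → signValue t * signValue s ≈ 1# - nat 2 * disagree s t
    cases (yes ≡.refl) = trans (square s) (trans (solve 0 (:1 := :1 :- :2 :* :0) refl)
      (+-congˡ (-‿cong (*-congˡ (sym (𝟙-no λ s≢s → s≢s ≡.refl))))))
    cases (no s≢t) = trans (opposite s t s≢t) (trans (solve 0 (:- :1 := :1 :- :2 :* :1) refl)
      (+-congˡ (-‿cong (*-congˡ (sym (𝟙-yes s≢t))))))

  module _ {n k : ℕ} (ns : Vec (Fin n) k) where

    -- Chosen so that `dot (hidden h) f` is the correlation of h and f over the points outside the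
    -- sample.
    hidden : Vec Sign n → Fin n → ℝ
    hidden h i = unseen ns i * signValue (lookup h i)

    energy-hidden : ∀ h → energy (hidden h) ≤ nat n
    energy-hidden h = begin
      energy (hidden h)             ≤⟨ ∑-mono (allFin n) (λ i → ≤-trans (±-square
                                         (±-* (unseen-± ns i) (signValue-±1 (lookup h i))))
                                         (≤-reflexive (solve 0 (:1 :* :1 :* (:1 :* :1) := :1) refl))) ⟩
      ∑ (allFin n) (λ _ → 1#)       ≈⟨ ∑-allFin-1 n ⟩
      nat n                         ∎

    -- The full correlation is n minus twice the number of disagreements; deleting a sampled point
    -- removes a term of at most 1, and there are at most k such points.
    correlation : ∀ h f → nat n - nat 2 * ∑ (allFin n) (λ i → disagree (lookup h i) (lookup f i)) - nat k
                          ≤ dot (hidden h) f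
    correlation h f = begin
      nat n - nat 2 * ∑ (allFin n) D - nat k
        ≤⟨ +-monoʳ-≤ _ (-‿anti-≤ (∑-seen ns)) ⟩
      nat n - nat 2 * ∑ (allFin n) D - ∑ (allFin n) (λ i → 1# - unseen ns i)
        ≈⟨ +-congʳ (+-cong (sym (∑-allFin-1 n)) (-‿cong (sym (∑-*ˡ (allFin n) (nat 2) D)))) ⟩
      ∑ (allFin n) (λ _ → 1#) - ∑ (allFin n) (λ i → nat 2 * D i) - ∑ (allFin n) (λ i → 1# - unseen ns i)
        ≈⟨ trans (∑-- (allFin n) _ _) (+-congʳ (∑-- (allFin n) _ _)) ⟨
      ∑ (allFin n) (λ i → 1# - nat 2 * D i - (1# - unseen ns i))
        ≤⟨ ∑-mono (allFin n) pointwise ⟩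
      dot (hidden h) f ∎
      where
      D : Fin n → ℝ
      D i = disagree (lookup h i) (lookup f i)

      pointwise : ∀ i → 1# - nat 2 * D i - (1# - unseen ns i) ≤
                        signValue (lookup f i) * (unseen ns i * signValue (lookup h i))
      pointwise i = cases (unseen-cases ns i)
        where
        u = unseen ns i

        rearranged : signValue (lookup f i) * (u * signValue (lookup h i)) ≈ u * (1# - nat 2 * D i)
        rearranged = trans (solve 3 (λ a u b → a :* (u :* b) := u :* (a :* b)) refl _ u _)
          (*-congˡ (signValue-* (lookup h i) (lookup f i)))

        cases : {B : Set} → u ≡ 0# ⊎ (u ≡ 1# × B) →
                1# - nat 2 * D i - (1# - u) ≤ signValue (lookup f i) * (u * signValue (lookup h i))
        cases (inj₁ u≡0) = ≤-by (*-nonNeg (nat-nonNeg 2) 𝟙-nonNeg) (begin-equality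
          signValue (lookup f i) * (u * signValue (lookup h i)) - (1# - nat 2 * D i - (1# - u))
            ≈⟨ +-congʳ rearranged ⟩
          u * (1# - nat 2 * D i) - (1# - nat 2 * D i - (1# - u))
            ≈⟨ +-cong (*-congʳ (reflexive u≡0)) (-‿cong (+-congˡ (-‿cong (+-congˡ (-‿cong (reflexive u≡0)))))) ⟩
          0# * (1# - nat 2 * D i) - (1# - nat 2 * D i - (1# - 0#))
            ≈⟨ solve 1 (λ d → :0 :* (:1 :- :2 :* d) :- (:1 :- :2 :* d :- (:1 :- :0)) := :2 :* d) refl (D i) ⟩
          nat 2 * D i ∎)
        cases (inj₂ (u≡1 , _)) = ≤-reflexive (begin-equality
          1# - nat 2 * D i - (1# - u)       ≈⟨ +-congˡ (-‿cong (+-congˡ (-‿cong (reflexive u≡1)))) ⟩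
          1# - nat 2 * D i - (1# - 1#)      ≈⟨ solve 1 (λ d → :1 :- :2 :* d :- (:1 :- :1) := :1 :* (:1 :- :2 :* d)) refl (D i) ⟩
          1# * (1# - nat 2 * D i)           ≈⟨ *-congʳ (reflexive u≡1) ⟨
          u * (1# - nat 2 * D i)            ≈⟨ rearranged ⟨
          signValue (lookup f i) * (u * signValue (lookup h i)) ∎)

  ∑-samples : ∀ {A : Set} (xs : List A) (p : A → ℝ) → ∑ xs p ≈ 1# → ∀ m →
              ∑ (allVecs xs m) (Vec.foldr (λ _ → ℝ) (λ a q → p a * q) 1#) ≈ 1#
  ∑-samples xs p total zero    = +-identityʳ 1#
  ∑-samples {A} xs p total (suc m) = begin-equality
    ∑ (allVecs xs (suc m)) P                              ≈⟨ ∑-allVecs xs m P ⟩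
    ∑ xs (λ x → ∑ (allVecs xs m) λ v → p x * P v)         ≈⟨ ∑-cong xs (λ x → trans (∑-*ˡ (allVecs xs m) (p x) P)
                                                               (trans (*-congˡ (∑-samples xs p total m)) (*-identityʳ (p x)))) ⟩
    ∑ xs p                                                ≈⟨ total ⟩
    1#                                                    ∎
    where
    P : ∀ {k} → Vec A k → ℝ
    P = Vec.foldr (λ _ → ℝ) (λ a q → p a * q) 1#

  module _ (R m : ℕ) (𝓐 : Algorithm R m) (0<n : 0# < nat (∣X′∣ R)) (4m≤n : 4 ℕ.* m ℕ.≤ ∣X′∣ R) where

    open FourierRatio em 𝓡 R using (n; ⅛; high; many-high)

    𝓤 : DistributionOnX′ R
    𝓤 = record
      { prob        = λ _ → nat n ⁻¹
      ; prob-nonNeg = λ _ → <⇒≤ (⁻¹-pos 0<n)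
      ; prob-total  = trans (∑-const (allFin n) (nat n ⁻¹)) (trans
          (*-congʳ (reflexive (≡.cong nat (length-tabulate {n = n} id)))) (*-inverse 0<n))
      }

    output : Func R → Vec (X′ R) m → Func R → ℝ
    output f ns = prob (𝓐 (labelled R m f ns))

    output-nonNeg : ∀ f ns h → 0# ≤ output f ns h
    output-nonNeg f ns = prob-nonNeg (𝓐 (labelled R m f ns))

    Fails : Func R → Func R → Set
    Fails f h = fromℕ 4 ⁻¹ ≤ error R 𝓤 f h

    error-* : ∀ f h → nat n * error R 𝓤 f h ≈ ∑ (allFin n) (λ i → disagree (lookup h i) (lookup f i))
    error-* f h = begin-equality
      nat n * error R 𝓤 f h       ≈⟨ *-congˡ (∑-*ˡ (allFin n) (nat n ⁻¹) _) ⟩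
      nat n * (nat n ⁻¹ * S)      ≈⟨ *-assoc _ _ _ ⟨
      nat n * nat n ⁻¹ * S        ≈⟨ *-congʳ (*-inverse 0<n) ⟩
      1# * S                      ≈⟨ *-identityˡ S ⟩
      S                           ∎
      where
      S = ∑ (allFin n) (λ i → disagree (lookup h i) (lookup f i))

    -- Fewer than n/4 disagreements and at most n/4 sampled points leave n - 2(n/4) - n/4 = n/4.
    success⇒correlated : ∀ ns f h → ¬ Fails f h → nat n ≤ nat 4 * dot (hidden ns h) f
    success⇒correlated ns f h ¬fails = begin
      nat n
        ≤⟨ ≤-by (+-nonNeg (x≤y⇒0≤y-x 4m≤n′) (*-nonNeg (nat-nonNeg 2) (x≤y⇒0≤y-x 4S≤n)))
             (solve 3 (λ n S m → :4 :* (n :- :2 :* S :- m) :- n := (n :- :4 :* m) :+ :2 :* (n :- :4 :* S)) refl (nat n) S (nat m)) ⟩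
      nat 4 * (nat n - nat 2 * S - nat m)
        ≤⟨ *-monoˡ-≤ (nat-nonNeg 4) (correlation {n} {m} ns h f) ⟩
      nat 4 * dot (hidden ns h) f ∎
      where
      S = ∑ (allFin n) (λ i → disagree (lookup h i) (lookup f i))

      4m≤n′ : nat 4 * nat m ≤ nat n
      4m≤n′ = ≤-trans (≤-reflexive (sym (nat-* 4 m))) (nat-mono-≤ 4m≤n)

      4*¼ : nat 4 * fromℕ 4 ⁻¹ ≈ 1#
      4*¼ = trans (*-congˡ (sym (⁻¹-cong (nat-pos 3) (nat≈·1 4)))) (*-inverse (nat-pos 3))

      4S≤n : nat 4 * S ≤ nat n
      4S≤n = begin
        nat 4 * S                           ≈⟨ *-congˡ (error-* f h) ⟨
        nat 4 * (nat n * error R 𝓤 f h)     ≤⟨ *-monoˡ-≤ (nat-nonNeg 4) (*-monoˡ-≤ (<⇒≤ 0<n) (<⇒≤ (≰⇒> ¬fails))) ⟩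
        nat 4 * (nat n * fromℕ 4 ⁻¹)        ≈⟨ solve 3 (λ a n i → a :* (n :* i) := n :* (a :* i)) refl (nat 4) (nat n) (fromℕ 4 ⁻¹) ⟩
        nat n * (nat 4 * fromℕ 4 ⁻¹)        ≈⟨ trans (*-congˡ 4*¼) (*-identityʳ _) ⟩
        nat n                               ∎

    -- The pointwise form of Chebyshev's inequality, ready to be weighted by the output
    -- probabilities.
    success-≤ : ∀ ns f h → nat n * nat n * 𝟙 (¬ Fails f h) ≤ nat 16 * (dot (hidden ns h) f * dot (hidden ns h) f)
    success-≤ ns f h = cases em
      where
      W = dot (hidden ns h) f

      cases : Dec (¬ Fails f h) → nat n * nat n * 𝟙 (¬ Fails f h) ≤ nat 16 * (W * W)
      cases (yes ¬fails) = begin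
        nat n * nat n * 𝟙 (¬ Fails f h)     ≈⟨ trans (*-congˡ (𝟙-yes ¬fails)) (*-identityʳ _) ⟩
        nat n * nat n                       ≤⟨ *-mono-≤ (<⇒≤ 0<n) (≤-trans (<⇒≤ 0<n) n≤4W) n≤4W n≤4W ⟩
        nat 4 * W * (nat 4 * W)             ≈⟨ solve 1 (λ w → :4 :* w :* (:4 :* w) := con (ℤ.+ 16) :* (w :* w)) refl W ⟩
        nat 16 * (W * W)                    ∎
        where
        n≤4W = success⇒correlated ns f h ¬fails
      cases (no fails) = ≤-trans (≤-reflexive (trans (*-congˡ (𝟙-no fails)) (zeroʳ _)))
        (*-nonNeg (nat-nonNeg 16) (square-nonNeg W))

    -- For fixed points and fixed h, the output probability depends on f through the labels at `ns`
    -- alone, so it is an admissible weight; this also absorbs the internal randomness.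
    hidden-moment : ∀ ns h → ∑± n (λ f → output f ns h * (dot (hidden ns h) f * dot (hidden ns h) f))
                             ≈ ∑± n (λ f → output f ns h) * energy (hidden ns h)
    hidden-moment ns h = weighted-second-moment n (λ f → output f ns h) (hidden ns h)
      λ i → cases i (unseen-cases {n} {m} ns i)
      where
      cases : ∀ i → _ → hidden ns h i ≈ 0# ⊎ (∀ f t → output (f [ i ]≔ t) ns h ≈ output f ns h)
      cases i (inj₁ u≡0)       = inj₁ (trans (*-congʳ (reflexive u≡0)) (zeroˡ _))
      cases i (inj₂ (_ , same)) = inj₂ λ f t → reflexive (≡.cong (λ sample → prob (𝓐 sample) h) (same f t))

    success : Func R → Vec (X′ R) m → ℝ
    success f ns = ∑[ h ∈ allFuncs R ] (output f ns h * 𝟙 (¬ Fails f h))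

    -- The sum over h is moved outside so that h is fixed while f varies. Summed back over h, the
    -- weights of each f total 1, which gives the factor `2^ n`.
    ∑-success : ∀ ns → nat n * ∑± n (λ f → success f ns) ≤ nat 16 * 2^ n
    ∑-success ns = *-cancelˡ-≤ 0<n (begin
      nat n * (nat n * ∑± n (λ f → success f ns))
        ≈⟨ *-assoc _ _ _ ⟨
      nat n * nat n * ∑± n (λ f → success f ns)
        ≈⟨ trans (∑-cong (allFuncs R) λ f → ∑-*ˡ (allFuncs R) (nat n * nat n) _) (∑-*ˡ (allFuncs R) (nat n * nat n) _) ⟨
      ∑± n (λ f → ∑[ h ∈ allFuncs R ] (nat n * nat n * (output f ns h * 𝟙 (¬ Fails f h))))
        ≤⟨ ∑-mono (allFuncs R) (λ f → ∑-mono (allFuncs R) λ h → term f h) ⟩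
      ∑± n (λ f → ∑[ h ∈ allFuncs R ] (nat 16 * (output f ns h * (dot (hidden ns h) f * dot (hidden ns h) f))))
        ≈⟨ trans (∑-swap (allFuncs R) (allFuncs R) _) (∑-cong (allFuncs R) λ h →
             trans (∑-*ˡ (allFuncs R) (nat 16) _) (*-congˡ (hidden-moment ns h))) ⟩
      ∑± n (λ h → nat 16 * (∑± n (λ f → output f ns h) * energy (hidden ns h)))
        ≤⟨ ∑-mono (allFuncs R) (λ h → *-monoˡ-≤ (nat-nonNeg 16)
             (*-monoˡ-≤ (∑-nonNeg (allFuncs R) λ f → output-nonNeg f ns h) (energy-hidden ns h))) ⟩
      ∑± n (λ h → nat 16 * (∑± n (λ f → output f ns h) * nat n))
        ≈⟨ trans (∑-*ˡ (allFuncs R) (nat 16) _) (*-congˡ (∑-*ʳ (allFuncs R) _ (nat n))) ⟩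
      nat 16 * (∑± n (λ h → ∑± n (λ f → output f ns h)) * nat n)
        ≈⟨ *-congˡ (*-congʳ (trans (∑-swap (allFuncs R) (allFuncs R) _)
             (∑-cong (allFuncs R) λ f → prob-total (𝓐 (labelled R m f ns))))) ⟩
      nat 16 * (2^ n * nat n)
        ≈⟨ solve 3 (λ a w n → a :* (w :* n) := n :* (a :* w)) refl (nat 16) (2^ n) (nat n) ⟩
      nat n * (nat 16 * 2^ n) ∎)
      where
      term : ∀ f h → nat n * nat n * (output f ns h * 𝟙 (¬ Fails f h)) ≤
                     nat 16 * (output f ns h * (dot (hidden ns h) f * dot (hidden ns h) f))
      term f h = begin
        nat n * nat n * (output f ns h * 𝟙 (¬ Fails f h))
          ≈⟨ solve 3 (λ a p i → a :* (p :* i) := p :* (a :* i)) refl (nat n * nat n) (output f ns h) _ ⟩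
        output f ns h * (nat n * nat n * 𝟙 (¬ Fails f h))
          ≤⟨ *-monoˡ-≤ (output-nonNeg f ns h) (success-≤ ns f h) ⟩
        output f ns h * (nat 16 * (dot (hidden ns h) f * dot (hidden ns h) f))
          ≈⟨ solve 3 (λ a p i → p :* (a :* i) := a :* (p :* i)) refl (nat 16) (output f ns h) _ ⟩
        nat 16 * (output f ns h * (dot (hidden ns h) f * dot (hidden ns h) f)) ∎

    samples : List (Vec (X′ R) m)
    samples = allVecs (allFin n) m

    weight : Vec (X′ R) m → ℝ
    weight = sampleProb R m 𝓤

    weight-nonNeg : ∀ ns → 0# ≤ weight ns
    weight-nonNeg = go
      where
      go : ∀ {k} (ns : Vec (X′ R) k) → 0# ≤ Vec.foldr (λ _ → ℝ) (λ _ p → nat n ⁻¹ * p) 1# ns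
      go []       = 0≤1
      go (_ ∷ ns) = *-nonNeg (<⇒≤ (⁻¹-pos 0<n)) (go ns)

    weight-total : ∑ samples weight ≈ 1#
    weight-total = ∑-samples (allFin n) (prob 𝓤) (prob-total 𝓤) m

    successProb : Func R → ℝ
    successProb f = ∑[ ns ∈ samples ] (weight ns * success f ns)

    success-nonNeg : ∀ f → 0# ≤ successProb f
    success-nonNeg f = ∑-nonNeg samples λ ns → *-nonNeg (weight-nonNeg ns)
      (∑-nonNeg (allFuncs R) λ h → *-nonNeg (output-nonNeg f ns h) 𝟙-nonNeg)

    failure+success : ∀ f → failureProb R m 𝓐 𝓤 f + successProb f ≈ 1#
    failure+success f = begin-equality
      failureProb R m 𝓐 𝓤 f + successProb f
        ≈⟨ ∑-+ samples _ _ ⟨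
      ∑[ ns ∈ samples ] (weight ns * (∑[ h ∈ allFuncs R ] (output f ns h * 𝟙 (Fails f h))) + weight ns * success f ns)
        ≈⟨ ∑-cong samples (λ ns → trans (sym (distribˡ _ _ _)) (trans (*-congˡ (one ns)) (*-identityʳ _))) ⟩
      ∑ samples weight
        ≈⟨ weight-total ⟩
      1# ∎
      where
      one : ∀ ns → (∑[ h ∈ allFuncs R ] (output f ns h * 𝟙 (Fails f h))) + success f ns ≈ 1#
      one ns = trans (sym (∑-+ (allFuncs R) _ _)) (trans
        (∑-cong (allFuncs R) λ h → trans (sym (distribˡ _ _ _)) (trans (*-congˡ 𝟙-complement) (*-identityʳ _)))
        (prob-total (𝓐 (labelled R m f ns))))

    ∑-successProb : nat n * ∑± n successProb ≤ nat 16 * 2^ n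
    ∑-successProb = begin
      nat n * ∑± n successProb
        ≈⟨ *-congˡ (trans (∑-swap (allFuncs R) samples _) (∑-cong samples λ ns → ∑-*ˡ (allFuncs R) (weight ns) _)) ⟩
      nat n * ∑ samples (λ ns → weight ns * ∑± n (λ f → success f ns))
        ≈⟨ trans (∑-cong samples λ ns → solve 3 (λ w n s → w :* (n :* s) := n :* (w :* s)) refl (weight ns) (nat n) _)
             (∑-*ˡ samples (nat n) _) ⟨
      ∑ samples (λ ns → weight ns * (nat n * ∑± n (λ f → success f ns)))
        ≤⟨ ∑-mono samples (λ ns → *-monoˡ-≤ (weight-nonNeg ns) (∑-success ns)) ⟩
      ∑ samples (λ ns → weight ns * (nat 16 * 2^ n))
        ≈⟨ trans (∑-*ʳ samples weight _) (trans (*-congʳ weight-total) (*-identityˡ _)) ⟩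
      nat 16 * 2^ n ∎

    -- With H the number of high f and S the sum of the success probabilities: 2H ≤ 3S, nS ≤ 16 · 2ⁿ
    -- and 2ⁿ ≤ 12H. Hence 2nH ≤ 3 · 16 · 12 H, and 288 = 3 · 16 · 12 / 2.
    few-points : ∀ {η} → η ≤ ⅛ → SucceedsOn R m 𝓐 𝓤 η → nat n ≤ nat 288
    few-points {η} η≤⅛ succeeds = *-cancelˡ-≤ 0<H (begin
      ∑± n high * nat n
        ≈⟨ *-comm _ _ ⟩
      nat n * ∑± n high
        ≤⟨ 0≤y-x⇒x≤y (0≤-halve (≤-by (x≤y⇒0≤y-x bound)
             (solve 2 (λ h n → (con (ℤ.+ 288) :* h :- n :* h) :+ (con (ℤ.+ 288) :* h :- n :* h) :- :0
               := con (ℤ.+ 48) :* (con (ℤ.+ 12) :* h) :- n :* (:2 :* h)) refl (∑± n high) (nat n)))) ⟩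
      nat 288 * ∑± n high
        ≈⟨ *-comm _ _ ⟩
      ∑± n high * nat 288 ∎)
      where
      0<H : 0# < ∑± n high
      0<H = *-cancelˡ-< (nat-nonNeg 12) (≤-<-trans (≤-reflexive (zeroʳ _)) (<-≤-trans (2^-pos n) (many-high 0<n)))

      3*⅓ : nat 3 * fromℕ 3 ⁻¹ ≈ 1#
      3*⅓ = trans (*-congˡ (sym (⁻¹-cong (nat-pos 2) (nat≈·1 3)))) (*-inverse (nat-pos 2))

      likely : ∀ f → nat 2 * high f ≤ nat 3 * successProb f
      likely f = cases em
        where
        p = failureProb R m 𝓐 𝓤 f
        q = successProb f

        cases : Dec (𝓗 R ⅛ f) → nat 2 * high f ≤ nat 3 * successProb f
        cases (yes h) = begin
          nat 2 * high f                    ≈⟨ trans (*-congˡ (𝟙-yes h)) (*-identityʳ _) ⟩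
          nat 2                             ≤⟨ ≤-by (x≤y⇒0≤y-x (≤-trans
                                                 (*-monoˡ-≤ (nat-nonNeg 3) (succeeds f (≤-trans η≤⅛ h))) (≤-reflexive 3*⅓)))
                                               (begin-equality
            nat 3 * q - nat 2                 ≈⟨ solve 2 (λ p q → :3 :* q :- :2 := :1 :- :3 :* p :+ :3 :* (p :+ q :- :1)) refl p q ⟩
            1# - nat 3 * p + nat 3 * (p + q - 1#) ≈⟨ +-congˡ (*-congˡ (+-congʳ (failure+success f))) ⟩
            1# - nat 3 * p + nat 3 * (1# - 1#)    ≈⟨ solve 1 (λ p → :1 :- :3 :* p :+ :3 :* (:1 :- :1) := :1 :- :3 :* p) refl p ⟩
            1# - nat 3 * p                    ∎) ⟩
          nat 3 * successProb f             ∎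
        cases (no ¬h) = ≤-trans (≤-reflexive (trans (*-congˡ (𝟙-no ¬h)) (zeroʳ _)))
          (*-nonNeg (nat-nonNeg 3) (success-nonNeg f))

      bound : nat n * (nat 2 * ∑± n high) ≤ nat 48 * (nat 12 * ∑± n high)
      bound = begin
        nat n * (nat 2 * ∑± n high)             ≤⟨ *-monoˡ-≤ (<⇒≤ 0<n) (≤-trans (≤-reflexive (sym (∑-*ˡ (allFuncs R) (nat 2) high)))
                                                     (≤-trans (∑-mono (allFuncs R) likely) (≤-reflexive (∑-*ˡ (allFuncs R) (nat 3) successProb)))) ⟩
        nat n * (nat 3 * ∑± n successProb)      ≈⟨ solve 3 (λ n a s → n :* (a :* s) := a :* (n :* s)) refl (nat n) (nat 3) _ ⟩
        nat 3 * (nat n * ∑± n successProb)      ≤⟨ *-monoˡ-≤ (nat-nonNeg 3) ∑-successProb ⟩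
        nat 3 * (nat 16 * 2^ n)                 ≈⟨ solve 1 (λ w → :3 :* (con (ℤ.+ 16) :* w) := con (ℤ.+ 48) :* w) refl (2^ n) ⟩
        nat 48 * 2^ n                           ≤⟨ *-monoˡ-≤ (nat-nonNeg 48) (many-high 0<n) ⟩
        nat 48 * (nat 12 * ∑± n high)           ∎

theorem1p7 : (em : ExcludedMiddle 0ℓ) (𝓡 : CompleteOrderedField) →
    let open CompleteOrderedField 𝓡 renaming (Carrier to ℝ)
        open Analysis em 𝓡
    in
    ∃ λ (c : ℝ) → 0# < c ×
      ((η : ℕ → ℝ) →
       (∀ R → 1 ℕ.≤ R → 0# < η R) →
       η ⟶ 0# →
       Eventually (λ R → 𝓗 R (η R) (μ-restricted R)) →
       Eventually (λ R → ∀ (m : ℕ) (𝓐 : Algorithm R m) →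
         (∀ (𝓓 : DistributionOnX′ R) → SucceedsOn R m 𝓐 𝓓 (η R)) →
         c * fromℕ R ≤ fromℕ m))
-- 1/16 is the product of the 1/4 in m > n/4 and the 1/4 in n ≥ R/4. The threshold 1153 = 4 · 288 +
-- 1 forces n ≥ 289.
theorem1p7 em 𝓡 = nat 16 ⁻¹ , ⁻¹-pos (nat-pos 15) , λ η _ η⟶0 _ →
  let (N , small) = η⟶0 (nat 8 ⁻¹) (⁻¹-pos (nat-pos 7)) in
  N ℕ.⊔ 1153 , λ R large m 𝓐 succeeds → conclude R m (ℕ.≰⇒> λ 4m≤n →
    let n    = ∣X′∣ R
        289≤n = enough R (ℕ.≤-trans (ℕ.m≤n⊔m N 1153) large)
        0<n  = <-≤-trans (nat-pos 288) (nat-mono-≤ 289≤n)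
    in <⇒≱ (<-≤-trans (<-by 0<1 (solve 1 (λ x → :1 :+ x :- x := :1) refl (nat 288))) (nat-mono-≤ 289≤n))
         (few-points R m 𝓐 0<n 4m≤n (≤-trans (≤-reflexive (solve 1 (λ x → x := x :- :0) refl (η R)))
           (<⇒≤ (proj₁ (small R (ℕ.≤-trans (ℕ.m≤m⊔n N 1153) large))))) (succeeds (𝓤 R m 𝓐 0<n 4m≤n))))
  where
  open Real em 𝓡
  open Learning em 𝓡
  open SquarefreeDensity using (R≤4∣X′∣)

  enough : ∀ R → 1153 ℕ.≤ R → 289 ℕ.≤ ∣X′∣ R
  enough R 1153≤R = ℕ.≰⇒> λ n≤288 → ℕ.<⇒≱ 1153≤R (ℕ.≤-trans (R≤4∣X′∣ R) (ℕ.*-monoʳ-≤ 4 n≤288))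

  conclude : ∀ R m → ∣X′∣ R ℕ.< 4 ℕ.* m → nat 16 ⁻¹ * fromℕ R ≤ fromℕ m
  conclude R m n<4m = *-cancelˡ-≤ (nat-pos 15) (begin
    nat 16 * (nat 16 ⁻¹ * fromℕ R)      ≈⟨ *-assoc _ _ _ ⟨
    nat 16 * nat 16 ⁻¹ * fromℕ R        ≈⟨ trans (*-congʳ (*-inverse (nat-pos 15))) (*-identityˡ _) ⟩
    fromℕ R                             ≈⟨ fromℕ≈nat R ⟩
    nat R                               ≤⟨ nat-mono-≤ (ℕ.≤-trans (R≤4∣X′∣ R) (ℕ.*-monoʳ-≤ 4 (ℕ.<⇒≤ n<4m))) ⟩
    nat (4 ℕ.* (4 ℕ.* m))               ≡⟨ ≡.cong nat (ℕ.*-assoc 4 4 m) ⟨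
    nat (16 ℕ.* m)                      ≈⟨ nat-* 16 m ⟩
    nat 16 * nat m                      ≈⟨ *-congˡ (fromℕ≈nat m) ⟨
    nat 16 * fromℕ m                    ∎)
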